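{- For every fixed integer $s\ge 5$, as $t\to\infty$ the Ramsey number satisfies $$R(s,t)=\Omega\!\left(t^{\frac{s+1}{2}}(\log t)^{\frac{1}{s-2}-\frac{s+1}{2}}\right).$$
   Context: $R(s,t)$ is the least $n$ such that every graph on $n$ vertices contains a complete graph on $s$ vertices or an independent set of $t$ vertices. -}

module Defs where

open import Data.Nat using (ℕ; _<_)
open import Data.Fin using (Fin)
open import Data.Bool using (Bool; true; false)
open import Data.Product using (Σ; _×_)
open import Data.Sum using (_⊎_)
open import Relation.Binary.PropositionalEquality using (_≡_; _≢_)
open import Relation.Nullary using (¬_)

record Graph (n : ℕ) : Set where
  field
    adj   : Fin n → Fin n → Bool
    sym   : ∀ u v → adj u v ≡ adj v u
    irrefl : ∀ v → adj v v ≡ false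
open Graph public

HasClique : ∀ {n} → Graph n → ℕ → Set
HasClique {n} G s = Σ (Fin s → Fin n) λ f →
  (∀ i j → f i ≡ f j → i ≡ j) × (∀ i j → i ≢ j → adj G (f i) (f j) ≡ true)

HasIndependentSet : ∀ {n} → Graph n → ℕ → Set
HasIndependentSet {n} G t = Σ (Fin t → Fin n) λ f →
  (∀ i j → f i ≡ f j → i ≡ j) × (∀ i j → i ≢ j → adj G (f i) (f j) ≡ false)

RamseyProperty : ℕ → ℕ → ℕ → Set
RamseyProperty s t n = (G : Graph n) → HasClique G s ⊎ HasIndependentSet G t

IsRamseyNumber : ℕ → ℕ → ℕ → Set
IsRamseyNumber s t n = RamseyProperty s t n × (∀ m → m < n → ¬ RamseyProperty s t m)

{-# OPTIONS --safe #-}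
module Submission where

open import Defs renaming (sym to adj-sym)
open import Data.Nat using (ℕ; zero; suc; _+_; _*_; _∸_; _^_; _≤_; _<_; z≤n; s≤s; _!; NonZero; >-nonZero; ⌊_/2⌋; ⌈_/2⌉)
open import Data.Nat.Properties hiding (_≟_)
open import Data.Nat.Logarithm using (⌊log₂_⌋; ⌊log₂⌋-mono-≤; ⌊log₂⌊n/2⌋⌋≡⌊log₂n⌋∸1; ⌊log₂[2^n]⌋≡n)
open import Data.Nat.Tactic.RingSolver using (solve-∀)
open import Data.Fin using (Fin; toℕ; combine; quotient; remainder; inject≤; fromℕ<; _≟_)
open import Data.Fin.Properties using (combine-injective; combine-remQuot; inject≤-injective; toℕ-fromℕ<; toℕ<n)
open import Data.Bool using (Bool; true; false; _∧_; _∨_; not; if_then_else_)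
open import Data.List using (List; []; _∷_; _++_; length; map; concatMap; allFin; take; drop; tabulate; replicate; initLast; _∷ʳ′_)
open import Data.Bool.ListAction using (any; all)
open import Data.List.Properties using (length-map; length-++; length-tabulate; length-replicate; length-take; length-drop)
open import Data.List.Membership.Propositional using (_∈_; _∉_)
open import Data.List.Membership.Propositional.Properties
open import Data.List.Relation.Unary.Any using (here; there)
open import Data.List.Relation.Unary.All as All using (All; []; _∷_)
open import Data.List.Relation.Unary.AllPairs as AllPairs using (AllPairs; []; _∷_)
open import Data.List.Relation.Unary.Unique.Propositional using (Unique)
import Data.List.Relation.Unary.Unique.Propositional.Properties as Uniq
open import Data.Vec as Vec using (Vec; []; _∷_; lookup)
open import Data.Product using (Σ; ∃; _×_; _,_; proj₁; proj₂)
open import Data.Product.Properties using (≡-dec)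
open import Data.Sum using (_⊎_; inj₁; inj₂; [_,_]′)
open import Data.Empty using (⊥; ⊥-elim)
open import Function using (_∘_; id; case_of_)
open import Relation.Nullary using (¬_; Dec; yes; no; does)
open import Relation.Binary.Definitions using (DecidableEquality)
open import Relation.Binary.PropositionalEquality using (_≡_; _≢_; refl; sym; trans; cong; cong₂; subst; module ≡-Reasoning)
open import Data.Vec.Properties using (lookup∘update′)
open import Data.List.Membership.DecPropositional using () renaming (_∈?_ to mem?)
open import Data.List.Relation.Unary.Unique.DecPropositional using () renaming (unique? to distinct?)
import Data.List.Relation.Unary.AllPairs.Properties as AllPairsₚ

-- Write s = r + 2 and g = C(s,2) - 1, so that 2g = r(r+3).  Every vertex v lies in a part P v and in a
-- block B v; there are m parts and m blocks, each holding about log t vertices, and the two partitions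
-- are in general position.  Take a random set H of pairs (part, block) of density 1/q and join v < v' if
-- (P v, B v') is in H.  In a copy x₁ < ... < x_s of K_s only the part of x₁ and only the block of x_s
-- matter, so copies come in bundles: on average less than one bundle contains a given pair x₂x₃, even
-- though 1/q exceeds, by a power of log t, the density at which a pair lies in boundedly many copies.
-- Deleting x₂x₃ from every copy leaves a K_s-free graph.
--
-- An independent set of size t contains sets W < X, lying in few parts or in few blocks, that represent
-- many parts and many blocks respectively; so the union bound runs over few configurations (W, X) and each
-- has many independent chances |W||X|/q of an edge.  That all these edges were deleted is unlikely: reveal
-- the pairs (P w, B x) one at a time, and whenever one lies in H also reveal a copy responsible for its
-- deletion.  The revealed pairs are too few to make later deletions cheap, except through fans (many
-- vertices joined to the same r others), which are excluded beforehand by a first moment bound.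

-- Write c = s - 4, ℓ = log t, ρ = n / m, and ignore constants and powers of R (see below). A
-- configuration of A cells is one of 2^(O(ℓA)), so it has to fail with probability 2^(-κA) for κ of
-- order ℓ; this makes t of order qℓ. A pair lies in m²n^c bundles with g further edges each, so the
-- density is limited by m²n^c ≤ q^g. As m²n^c = n^r / ρ², this allows n^r of order ρ²q^g, and ρ² is
-- what leaves, after all losses, the term 1/(s - 2) in the exponent of log t.
--
-- R is about ℓ^(1/J) with J = 4g constant. It is large enough that Λ < R^(J + 1), so the number of
-- parts or blocks met by successive intervals of an independent set can change by the factor R only
-- boundedly often, and small enough that the powers of R lost on the way cost less than ρ² gains.
--
-- The obstacle is that the exposure conditions on many edges, and a copy that uses revealed edges
-- is far likelier; `exponent-bound` is what keeps such copies rare in total. It needs r ≥ 3, as do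
-- the general position of the partitions and the bound on fans: this is where s ≥ 5 enters.

⟦_⟧ : Bool → ℕ
⟦ true  ⟧ = 1
⟦ false ⟧ = 0

⟦⟧≤1 : ∀ b → ⟦ b ⟧ ≤ 1
⟦⟧≤1 true  = ≤-refl
⟦⟧≤1 false = z≤n

⟦⟧-mono : ∀ {a b} → (a ≡ true → b ≡ true) → ⟦ a ⟧ ≤ ⟦ b ⟧
⟦⟧-mono {false} f = z≤n
⟦⟧-mono {true} {b} f rewrite f refl = ≤-refl

∧-intro : ∀ {a b} → a ≡ true → b ≡ true → a ∧ b ≡ true
∧-intro refl refl = refl

∧-elim₁ : ∀ {a b} → a ∧ b ≡ true → a ≡ true
∧-elim₁ {true} _ = refl

∧-elim₂ : ∀ {a b} → a ∧ b ≡ true → b ≡ true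
∧-elim₂ {true} p = p

∨-elim : ∀ {a b} → a ∨ b ≡ true → a ≡ true ⊎ b ≡ true
∨-elim {true}  _ = inj₁ refl
∨-elim {false} p = inj₂ p

∨-intro₁ : ∀ {a b} → a ≡ true → a ∨ b ≡ true
∨-intro₁ refl = refl

∨-intro₂ : ∀ {a b} → b ≡ true → a ∨ b ≡ true
∨-intro₂ {true}  refl = refl
∨-intro₂ {false} refl = refl

not-true : ∀ {b} → not b ≡ true → b ≡ false
not-true {false} _ = refl

true≢false : ∀ {A : Set} {b} → b ≡ true → b ≡ false → A
true≢false refl ()

dec-true : ∀ {A : Set} (d : Dec A) → does d ≡ true → A
dec-true (yes a) _ = a

true-dec : ∀ {A : Set} (d : Dec A) → A → does d ≡ true
true-dec (yes _) _ = refl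
true-dec (no ¬a) a = ⊥-elim (¬a a)

dec-false : ∀ {A : Set} (d : Dec A) → does d ≡ false → ¬ A
dec-false (no ¬a) _ = ¬a

false-dec : ∀ {A : Set} (d : Dec A) → ¬ A → does d ≡ false
false-dec (yes a) ¬a = ⊥-elim (¬a a)
false-dec (no _)  _  = refl

any-intro : ∀ {A : Set} (p : A → Bool) {x xs} → x ∈ xs → p x ≡ true → any p xs ≡ true
any-intro p (here refl) px = ∨-intro₁ px
any-intro p (there x∈)  px = ∨-intro₂ (any-intro p x∈ px)

any-elim : ∀ {A : Set} (p : A → Bool) xs → any p xs ≡ true → ∃ λ x → x ∈ xs × p x ≡ true
any-elim p (x ∷ xs) h with p x in eq
... | true  = x , here refl , eq
... | false with any-elim p xs h
...   | y , y∈ , py = y , there y∈ , py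

any-false : ∀ {A : Set} (p : A → Bool) {x xs} → any p xs ≡ false → x ∈ xs → p x ≡ false
any-false p {x} h x∈ with p x in eq
... | false = refl
... | true  = true≢false (any-intro p x∈ eq) h

all-intro : ∀ {A : Set} (p : A → Bool) xs → (∀ x → x ∈ xs → p x ≡ true) → all p xs ≡ true
all-intro p []       h = refl
all-intro p (x ∷ xs) h = ∧-intro (h x (here refl)) (all-intro p xs (λ y y∈ → h y (there y∈)))

all-elim : ∀ {A : Set} (p : A → Bool) {xs x} → all p xs ≡ true → x ∈ xs → p x ≡ true
all-elim p h (here refl) = ∧-elim₁ h
all-elim p {y ∷ ys} h (there x∈) = all-elim p (∧-elim₂ {p y} h) x∈

-- Finite sums, counting and filtering over lists

∑ : {A : Set} → List A → (A → ℕ) → ℕ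
∑ []       f = 0
∑ (x ∷ xs) f = f x + ∑ xs f

∑-mono : ∀ {A : Set} (xs : List A) {f g : A → ℕ} → (∀ x → x ∈ xs → f x ≤ g x) → ∑ xs f ≤ ∑ xs g
∑-mono []       h = z≤n
∑-mono (x ∷ xs) h = +-mono-≤ (h x (here refl)) (∑-mono xs (λ y y∈ → h y (there y∈)))

∑-cong : ∀ {A : Set} (xs : List A) {f g : A → ℕ} → (∀ x → f x ≡ g x) → ∑ xs f ≡ ∑ xs g
∑-cong []       h = refl
∑-cong (x ∷ xs) h = cong₂ _+_ (h x) (∑-cong xs h)

+-interchange : ∀ a b c d → (a + b) + (c + d) ≡ (a + c) + (b + d)
+-interchange = solve-∀

∑-+ : ∀ {A : Set} (xs : List A) (f g : A → ℕ) → ∑ xs (λ x → f x + g x) ≡ ∑ xs f + ∑ xs g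
∑-+ []       f g = refl
∑-+ (x ∷ xs) f g = trans (cong (f x + g x +_) (∑-+ xs f g)) (+-interchange (f x) (g x) _ _)

∑-*ˡ : ∀ {A : Set} (xs : List A) c (f : A → ℕ) → ∑ xs (λ x → c * f x) ≡ c * ∑ xs f
∑-*ˡ []       c f = sym (*-zeroʳ c)
∑-*ˡ (x ∷ xs) c f = trans (cong (c * f x +_) (∑-*ˡ xs c f)) (sym (*-distribˡ-+ c (f x) _))

∑-*ʳ : ∀ {A : Set} (xs : List A) c (f : A → ℕ) → ∑ xs (λ x → f x * c) ≡ ∑ xs f * c
∑-*ʳ []       c f = refl
∑-*ʳ (x ∷ xs) c f = trans (cong (f x * c +_) (∑-*ʳ xs c f)) (sym (*-distribʳ-+ c (f x) _))

∑-const : ∀ {A : Set} (xs : List A) c → ∑ xs (λ _ → c) ≡ length xs * c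
∑-const []       c = refl
∑-const (x ∷ xs) c = cong (c +_) (∑-const xs c)

∑-bound : ∀ {A : Set} (xs : List A) {f : A → ℕ} c → (∀ x → x ∈ xs → f x ≤ c) → ∑ xs f ≤ length xs * c
∑-bound xs c h = ≤-trans (∑-mono xs h) (≤-reflexive (∑-const xs c))

∑-++ : ∀ {A : Set} (xs ys : List A) (f : A → ℕ) → ∑ (xs ++ ys) f ≡ ∑ xs f + ∑ ys f
∑-++ []       ys f = refl
∑-++ (x ∷ xs) ys f = trans (cong (f x +_) (∑-++ xs ys f)) (sym (+-assoc (f x) _ _))

∑-map : ∀ {A B : Set} (h : A → B) (xs : List A) (f : B → ℕ) → ∑ (map h xs) f ≡ ∑ xs (λ x → f (h x))
∑-map h []       f = refl
∑-map h (x ∷ xs) f = cong (f (h x) +_) (∑-map h xs f)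

∑-concatMap : ∀ {A B : Set} (h : A → List B) (xs : List A) (f : B → ℕ) →
  ∑ (concatMap h xs) f ≡ ∑ xs (λ x → ∑ (h x) f)
∑-concatMap h []       f = refl
∑-concatMap h (x ∷ xs) f = trans (∑-++ (h x) _ f) (cong (∑ (h x) f +_) (∑-concatMap h xs f))

∑-swap : ∀ {A B : Set} (xs : List A) (ys : List B) (f : A → B → ℕ) →
  ∑ xs (λ x → ∑ ys (f x)) ≡ ∑ ys (λ y → ∑ xs (λ x → f x y))
∑-swap []       ys f = sym (trans (∑-const ys 0) (*-zeroʳ (length ys)))
∑-swap (x ∷ xs) ys f = trans (cong (∑ ys (f x) +_) (∑-swap xs ys f)) (sym (∑-+ ys (f x) _))

∑-member : ∀ {A : Set} {x : A} {xs} (f : A → ℕ) → x ∈ xs → f x ≤ ∑ xs f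
∑-member f (here refl) = m≤m+n _ _
∑-member f (there {x = y} x∈) = ≤-trans (∑-member f x∈) (m≤n+m _ (f y))

count : {A : Set} → (A → Bool) → List A → ℕ
count p xs = ∑ xs (λ x → ⟦ p x ⟧)

any≤count : ∀ {A : Set} (p : A → Bool) xs → ⟦ any p xs ⟧ ≤ count p xs
any≤count p xs with any p xs in eq
... | false = z≤n
... | true with any-elim p xs eq
...   | x , x∈ , px = ≤-trans (≤-reflexive (cong ⟦_⟧ (sym px))) (∑-member (λ x → ⟦ p x ⟧) x∈)

count-any : ∀ {A C : Set} (xs : List A) (cs : List C) (p : A → C → Bool) →
  count (λ x → any (p x) cs) xs ≤ ∑ cs (λ c → count (λ x → p x c) xs)
count-any xs cs p = ≤-trans (∑-mono xs (λ x _ → any≤count (p x) cs))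
  (≤-reflexive (∑-swap xs cs (λ x c → ⟦ p x c ⟧)))

keep : {A : Set} → (A → Bool) → List A → List A
keep p []       = []
keep p (x ∷ xs) = if p x then x ∷ keep p xs else keep p xs

keep-∈ : ∀ {A : Set} (p : A → Bool) {x xs} → x ∈ xs → p x ≡ true → x ∈ keep p xs
keep-∈ p {x} (here refl) px rewrite px = here refl
keep-∈ p {x} {y ∷ ys} (there x∈) px with p y
... | true  = there (keep-∈ p x∈ px)
... | false = keep-∈ p x∈ px

∈-keep : ∀ {A : Set} (p : A → Bool) {x} xs → x ∈ keep p xs → x ∈ xs × p x ≡ true
∈-keep p (y ∷ ys) x∈ with p y in eq
∈-keep p (y ∷ ys) (here refl) | true = here refl , eq
∈-keep p (y ∷ ys) (there x∈) | true with ∈-keep p ys x∈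
... | a , b = there a , b
∈-keep p (y ∷ ys) x∈ | false with ∈-keep p ys x∈
... | a , b = there a , b

All-keep : ∀ {A : Set} {Q : A → Set} (p : A → Bool) {xs} → All Q xs → All Q (keep p xs)
All-keep p [] = []
All-keep p (_∷_ {x} q qs) with p x
... | true  = q ∷ All-keep p qs
... | false = All-keep p qs

AllPairs-keep : ∀ {A : Set} {Q : A → A → Set} (p : A → Bool) {xs} → AllPairs Q xs → AllPairs Q (keep p xs)
AllPairs-keep p [] = []
AllPairs-keep p (_∷_ {x} q qs) with p x
... | true  = All-keep p q ∷ AllPairs-keep p qs
... | false = AllPairs-keep p qs

length-keep : ∀ {A : Set} (p : A → Bool) xs → length (keep p xs) ≡ count p xs
length-keep p [] = refl
length-keep p (x ∷ xs) with p x
... | true  = cong suc (length-keep p xs)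
... | false = length-keep p xs

keep-split : ∀ {A : Set} (p : A → Bool) xs → length xs ≡ length (keep p xs) + length (keep (not ∘ p) xs)
keep-split p [] = refl
keep-split p (x ∷ xs) with p x
... | true  = cong suc (keep-split p xs)
... | false = trans (cong suc (keep-split p xs)) (sym (+-suc _ _))

-- Distinctness, fibres of maps and representatives

_⊑_ : {A : Set} → List A → List A → Set
xs ⊑ ys = ∀ {x} → x ∈ xs → x ∈ ys

∉-all : ∀ {A : Set} {x : A} {xs} → All (x ≢_) xs → x ∉ xs
∉-all (p ∷ ps) (here refl) = p refl
∉-all (p ∷ ps) (there x∈)  = ∉-all ps x∈

all-∉ : ∀ {A : Set} {x : A} {xs} → x ∉ xs → All (x ≢_) xs
all-∉ {xs = []}     h = []
all-∉ {xs = y ∷ ys} h = (λ e → h (here e)) ∷ all-∉ (h ∘ there)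

take-⊑ : ∀ {A : Set} k (xs : List A) → take k xs ⊑ xs
take-⊑ (suc k) (x ∷ xs) (here e)  = here e
take-⊑ (suc k) (x ∷ xs) (there m) = there (take-⊑ k xs m)

drop-⊑ : ∀ {A : Set} k (xs : List A) → drop k xs ⊑ xs
drop-⊑ zero    xs       m = m
drop-⊑ (suc k) (x ∷ xs) m = there (drop-⊑ k xs m)

unique-length : ∀ {A : Set} {xs ys : List A} → Unique xs → xs ⊑ ys → length xs ≤ length ys
unique-length [] h = z≤n
unique-length {xs = x ∷ xs} (p ∷ ps) h with ∈-∃++ (h (here refl))
... | as , bs , refl = subst (suc (length xs) ≤_) (sym eq) (s≤s (unique-length ps sub))
  where
  eq : length (as ++ x ∷ bs) ≡ suc (length (as ++ bs))
  eq = trans (length-++ as) (trans (+-suc _ _) (cong suc (sym (length-++ as))))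
  sub : xs ⊑ (as ++ bs)
  sub {y} y∈ with ∈-++⁻ as (h (there y∈))
  ... | inj₁ a = ∈-++⁺ˡ a
  ... | inj₂ (here refl) = ⊥-elim (∉-all p y∈)
  ... | inj₂ (there b) = ∈-++⁺ʳ as b

InjOn : {A B : Set} → (A → B) → List A → Set
InjOn f xs = ∀ {x y} → x ∈ xs → y ∈ xs → f x ≡ f y → x ≡ y

unique-map : ∀ {A B : Set} (f : A → B) {xs} → Unique xs → InjOn f xs → Unique (map f xs)
unique-map f [] inj = []
unique-map f {x ∷ xs} (p ∷ ps) inj =
  all-∉ (λ fx∈ → case ∈-map⁻ f fx∈ of λ { (y , y∈ , e) → ∉-all p (subst (_∈ xs) (sym (inj (here refl) (there y∈) e)) y∈) })
  ∷ unique-map f ps (λ a b → inj (there a) (there b))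

unique-map-inj : ∀ {A B : Set} (f : A → B) {xs} → Unique (map f xs) → InjOn f xs
unique-map-inj f {x ∷ xs} (p ∷ ps) (here refl) (here refl) e = refl
unique-map-inj f {x ∷ xs} (p ∷ ps) (here refl) (there b) e = ⊥-elim (∉-all p (subst (_∈ map f xs) (sym e) (∈-map⁺ f b)))
unique-map-inj f {x ∷ xs} (p ∷ ps) (there a) (here refl) e = ⊥-elim (∉-all p (subst (_∈ map f xs) e (∈-map⁺ f a)))
unique-map-inj f {x ∷ xs} (p ∷ ps) (there a) (there b) e = unique-map-inj f ps a b e

-- A bound on the fibres of `f`, tested on duplicate-free lists so that fibres need not be
-- enumerated.
Load : {A C : Set} → (A → C) → ℕ → Set
Load f Λ = ∀ c xs → Unique xs → (∀ {x} → x ∈ xs → f x ≡ c) → length xs ≤ Λ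

module _ {A C : Set} (_≟C_ : DecidableEquality C) (f : A → C) {Λ : ℕ} (load : Load f Λ) where

  load-cover : ∀ xs cs → Unique xs → (∀ {x} → x ∈ xs → f x ∈ cs) → length xs ≤ length cs * Λ
  load-cover [] [] u h = z≤n
  load-cover (x ∷ xs) [] u h with h (here refl)
  ... | ()
  load-cover xs (c ∷ cs) u h = subst (_≤ Λ + length cs * Λ) (sym (keep-split p xs))
    (+-mono-≤ (load c (keep p xs) (AllPairs-keep p u) (λ x∈ → dec-true (_ ≟C _) (proj₂ (∈-keep p xs x∈))))
              (load-cover (keep (not ∘ p) xs) cs (AllPairs-keep (not ∘ p) u) rest))
    where
    p : A → Bool
    p x = does (f x ≟C c)
    rest : ∀ {x} → x ∈ keep (not ∘ p) xs → f x ∈ cs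
    rest {x} x∈ with ∈-keep (not ∘ p) xs x∈
    ... | x∈xs , np with h x∈xs
    ...   | there m = m
    ...   | here e = ⊥-elim (dec-false (f x ≟C c) (not-true np) e)

module _ {A C : Set} (_≟C_ : DecidableEquality C) (f : A → C) where

  -- One element for each value of `f`, the first to occur. With `f` = `P` its length is the number
  -- of parts that the list meets.
  reps : List A → List A
  reps []       = []
  reps (x ∷ xs) = x ∷ keep (λ y → not (does (f x ≟C f y))) (reps xs)

  reps-⊑ : ∀ xs → reps xs ⊑ xs
  reps-⊑ (x ∷ xs) (here e) = here e
  reps-⊑ (x ∷ xs) (there y∈) = there (reps-⊑ xs (proj₁ (∈-keep _ (reps xs) y∈)))

  reps-unique : ∀ xs → Unique (map f (reps xs))
  reps-unique [] = []
  reps-unique (x ∷ xs) =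
    all-∉ (λ fx∈ → case ∈-map⁻ f fx∈ of λ { (y , y∈ , e) →
        dec-false (f x ≟C f y) (not-true (proj₂ (∈-keep p (reps xs) y∈))) e })
    ∷ aux (reps-unique xs)
    where
    p : A → Bool
    p y = not (does (f x ≟C f y))
    aux : ∀ {ys} → Unique (map f ys) → Unique (map f (keep p ys))
    aux {[]} [] = []
    aux {y ∷ ys} (q ∷ qs) with p y
    ... | false = aux qs
    ... | true  = all-∉ (λ m → case ∈-map⁻ f m of λ { (z , z∈ , e) →
                   ∉-all q (subst (_∈ map f ys) (sym e) (∈-map⁺ f (proj₁ (∈-keep p ys z∈)))) }) ∷ aux qs

  reps-cover : ∀ xs {y} → y ∈ xs → f y ∈ map f (reps xs)
  reps-cover (x ∷ xs) (here refl) = here refl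
  reps-cover (x ∷ xs) {y} (there y∈) with f x ≟C f y
  ... | yes e = here (sym e)
  ... | no ne with ∈-map⁻ f (reps-cover xs y∈)
  ...   | z , z∈ , e = there (subst (_∈ map f (keep (λ v → not (does (f x ≟C f v))) (reps xs))) (sym e)
          (∈-map⁺ f (keep-∈ (λ v → not (does (f x ≟C f v))) z∈ (not-does (f x ≟C f z) (λ e' → ne (trans e' (sym e)))))))
    where
    not-does : ∀ {Q : Set} (d : Dec Q) → ¬ Q → not (does d) ≡ true
    not-does (yes q) h = ⊥-elim (h q)
    not-does (no _)  h = refl

unique-of-map : ∀ {A B : Set} (f : A → B) {xs} → Unique (map f xs) → Unique xs
unique-of-map f {[]} [] = []
unique-of-map f {x ∷ xs} (p ∷ ps) = all-∉ (λ x∈ → ∉-all p (∈-map⁺ f x∈)) ∷ unique-of-map f ps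

-- Enumerations of tuples, k-subsets and subsets

allLists : {A : Set} → ℕ → List A → List (List A)
allLists zero    xs = [] ∷ []
allLists (suc k) xs = concatMap (λ x → map (x ∷_) (allLists k xs)) xs

∑-allLists-suc : ∀ {A : Set} k (xs : List A) (f : List A → ℕ) →
  ∑ (allLists (suc k) xs) f ≡ ∑ xs (λ x → ∑ (allLists k xs) (λ l → f (x ∷ l)))
∑-allLists-suc k xs f = trans (∑-concatMap _ xs f) (∑-cong xs (λ x → ∑-map (x ∷_) (allLists k xs) f))

∑1 : ∀ {A : Set} (xs : List A) → ∑ xs (λ _ → 1) ≡ length xs
∑1 xs = trans (∑-const xs 1) (*-identityʳ _)

length-allLists : ∀ {A : Set} k (xs : List A) → length (allLists k xs) ≡ length xs ^ k
length-allLists zero xs = refl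
length-allLists (suc k) xs = trans (sym (∑1 (allLists (suc k) xs)))
  (trans (∑-allLists-suc k xs (λ _ → 1))
  (trans (∑-cong xs (λ _ → trans (∑1 (allLists k xs)) (length-allLists k xs)))
         (∑-const xs (length xs ^ k))))

∈-concatMap⁺′ : ∀ {A B : Set} {f : A → List B} {x xs y} → x ∈ xs → y ∈ f x → y ∈ concatMap f xs
∈-concatMap⁺′ {f = f} {xs = x ∷ xs} (here refl) y∈ = ∈-++⁺ˡ y∈
∈-concatMap⁺′ {f = f} {xs = x ∷ xs} (there x∈) y∈ = ∈-++⁺ʳ (f x) (∈-concatMap⁺′ {f = f} x∈ y∈)

∈-concatMap⁻′ : ∀ {A B : Set} (f : A → List B) (xs : List A) {y} → y ∈ concatMap f xs → ∃ λ x → x ∈ xs × y ∈ f x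
∈-concatMap⁻′ f (x ∷ xs) y∈ with ∈-++⁻ (f x) y∈
... | inj₁ a = x , here refl , a
... | inj₂ b with ∈-concatMap⁻′ f xs b
...   | x′ , m , d = x′ , there m , d

∈-allLists : ∀ {A : Set} {xs : List A} l → l ⊑ xs → l ∈ allLists (length l) xs
∈-allLists []      h = here refl
∈-allLists {xs = xs} (x ∷ l) h = ∈-concatMap⁺′ (h (here refl)) (∈-map⁺ (x ∷_) (∈-allLists l (h ∘ there)))

∈-allLists-length : ∀ {A : Set} k (xs : List A) {l} → l ∈ allLists k xs → length l ≡ k × l ⊑ xs
∈-allLists-length zero xs (here refl) = refl , λ ()
∈-allLists-length (suc k) xs l∈ with ∈-concatMap⁻′ (λ x → map (x ∷_) (allLists k xs)) xs l∈
... | z , z∈ , m with ∈-map⁻ (z ∷_) m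
...   | l′ , l′∈ , refl with ∈-allLists-length k xs l′∈
...     | e , sub = cong suc e , λ { (here refl) → z∈ ; (there y∈) → sub y∈ }

combos : {A : Set} → ℕ → List A → List (List A)
combos zero    xs       = [] ∷ []
combos (suc k) []       = []
combos (suc k) (x ∷ xs) = map (x ∷_) (combos k xs) ++ combos (suc k) xs

-- Pascal's rule reduces this to (n + 1)^(k+1) ≥ n^(k+1) + (k + 1) n^k. The factor `k !` is what
-- makes the first moments over sets of Λ + 1 vertices small.
combos-length : ∀ {A : Set} k (xs : List A) → k ! * length (combos k xs) ≤ length xs ^ k
combos-length zero xs = ≤-refl
combos-length (suc k) [] = ≤-trans (≤-reflexive (*-zeroʳ (suc k !))) z≤n
combos-length (suc k) (x ∷ xs) = begin
  suc k ! * length (map (x ∷_) (combos k xs) ++ combos (suc k) xs)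
    ≡⟨ cong (suc k ! *_) (trans (length-++ (map (x ∷_) (combos k xs))) (cong (_+ b) (length-map (x ∷_) (combos k xs)))) ⟩
  suc k ! * (a + b)
    ≡⟨ *-distribˡ-+ (suc k !) a b ⟩
  suc k * k ! * a + suc k ! * b
    ≡⟨ cong (_+ suc k ! * b) (*-assoc (suc k) (k !) a) ⟩
  suc k * (k ! * a) + suc k ! * b
    ≤⟨ +-mono-≤ (*-monoʳ-≤ (suc k) (combos-length k xs)) (combos-length (suc k) xs) ⟩
  suc k * n ^ k + n * n ^ k
    ≤⟨ bernoulli k ⟩
  suc n ^ suc k ∎
  where
  open ≤-Reasoning
  n = length xs
  a = length (combos k xs)
  b = length (combos (suc k) xs)
  lem : ∀ k n y → suc (suc k) * (n * y) + n * (n * y) ≤ suc n * (suc k * y + n * y)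
  lem k n y = ≤-trans (m≤m+n _ (suc k * y)) (≤-reflexive (eq k n y))
    where
    eq : ∀ k n y → suc (suc k) * (n * y) + n * (n * y) + suc k * y ≡ suc n * (suc k * y + n * y)
    eq = solve-∀
  bernoulli : ∀ k → suc k * n ^ k + n * n ^ k ≤ suc n ^ suc k
  bernoulli zero = ≤-reflexive (cong suc (trans (*-identityʳ n) (sym (*-identityʳ n))))
  bernoulli (suc k) = ≤-trans (lem k n (n ^ k)) (*-monoʳ-≤ (suc n) (bernoulli k))

-- Turns a lower bound on a count into a member of the list over which a first moment bound sums.
combos-keep : ∀ {A : Set} k (p : A → Bool) xs → k ≤ count p xs →
  ∃ λ ys → ys ∈ combos k xs × (∀ {y} → y ∈ ys → y ∈ xs × p y ≡ true)
combos-keep zero p xs h = [] , here refl , λ ()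
combos-keep (suc k) p (x ∷ xs) h with p x in eq
... | false with combos-keep (suc k) p xs h
...   | ys , m , g = ys , ∈-++⁺ʳ _ m , λ y∈ → there (proj₁ (g y∈)) , proj₂ (g y∈)
combos-keep (suc k) p (x ∷ xs) (s≤s h) | true with combos-keep k p xs h
...   | ys , m , g = x ∷ ys , ∈-++⁺ˡ (∈-map⁺ (x ∷_) m) ,
        λ { (here refl) → here refl , eq ; (there y∈) → there (proj₁ (g y∈)) , proj₂ (g y∈) }

combos-unique : ∀ {A : Set} k (xs : List A) {ys} → Unique xs → ys ∈ combos k xs → Unique ys × ys ⊑ xs × length ys ≡ k
combos-unique zero xs u (here refl) = [] , (λ ()) , refl
combos-unique (suc k) (x ∷ xs) (p ∷ u) m with ∈-++⁻ (map (x ∷_) (combos k xs)) m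
... | inj₂ m′ with combos-unique (suc k) xs u m′
...   | a , b , c = a , there ∘ b , c
combos-unique (suc k) (x ∷ xs) (p ∷ u) m | inj₁ m′ with ∈-map⁻ (x ∷_) m′
...   | zs , z∈ , refl with combos-unique k xs u z∈
...     | a , b , c = all-∉ (λ x∈ → ∉-all p (b x∈)) ∷ a ,
          (λ { (here e) → here e ; (there y∈) → there (b y∈) }) , cong suc c

subs : {A : Set} → List A → List (List A)
subs []       = [] ∷ []
subs (x ∷ xs) = map (x ∷_) (subs xs) ++ subs xs

length-subs : ∀ {A : Set} (xs : List A) → length (subs xs) ≡ 2 ^ length xs
length-subs [] = refl
length-subs (x ∷ xs) = trans (length-++ (map (x ∷_) (subs xs)))
  (cong₂ _+_ (trans (length-map (x ∷_) (subs xs)) (length-subs xs)) (trans (length-subs xs) (sym (+-identityʳ _))))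

keep∈subs : ∀ {A : Set} (p : A → Bool) xs → keep p xs ∈ subs xs
keep∈subs p [] = here refl
keep∈subs p (x ∷ xs) with p x
... | true  = ∈-++⁺ˡ (∈-map⁺ (x ∷_) (keep∈subs p xs))
... | false = ∈-++⁺ʳ (map (x ∷_) (subs xs)) (keep∈subs p xs)

∈allFin : ∀ {n} (i : Fin n) → i ∈ allFin n
∈allFin = ∈-allFin

^-distribʳ-* : ∀ k a b → (a * b) ^ k ≡ a ^ k * b ^ k
^-distribʳ-* zero    a b = refl
^-distribʳ-* (suc k) a b = trans (cong (a * b *_) (^-distribʳ-* k a b)) (e a b (a ^ k) (b ^ k))
  where
  e : ∀ a b x y → a * b * (x * y) ≡ a * x * (b * y)
  e = solve-∀

∏ : List ℕ → ℕ
∏ []       = 1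
∏ (t ∷ ts) = t * ∏ ts

-- The product probability space, as exact counting

vecs : (q N : ℕ) → List (Vec (Fin q) N)
vecs q zero    = [] ∷ []
vecs q (suc N) = concatMap (λ c → map (c ∷_) (vecs q N)) (allFin q)

∑-vecs : ∀ q N (f : Vec (Fin q) (suc N) → ℕ) →
  ∑ (vecs q (suc N)) f ≡ ∑ (allFin q) (λ c → ∑ (vecs q N) (λ v → f (c ∷ v)))
∑-vecs q N f = trans (∑-concatMap _ (allFin q) f) (∑-cong (allFin q) (λ c → ∑-map (c ∷_) (vecs q N) f))

length-allFin : ∀ n → length (allFin n) ≡ n
length-allFin n = length-tabulate id

∑-vecs-1 : ∀ q N → ∑ (vecs q N) (λ _ → 1) ≡ q ^ N
∑-vecs-1 q zero = refl
∑-vecs-1 q (suc N) = trans (∑-vecs q N (λ _ → 1))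
  (trans (∑-cong (allFin q) (λ _ → ∑-vecs-1 q N))
  (trans (∑-const (allFin q) (q ^ N)) (cong (_* q ^ N) (length-allFin q))))

-- Independence of one coordinate from a function that ignores it. Summing over all vectors stands
-- for expectation, and the denominator q is multiplied out.
coordinate-independent : ∀ q N (i : Fin N) (Y : Fin q → Bool) (f : Vec (Fin q) N → ℕ) →
  (∀ ω c → f (ω Vec.[ i ]≔ c) ≡ f ω) →
  ∑ (vecs q N) (λ ω → ⟦ Y (lookup ω i) ⟧ * f ω) * q ≡ count Y (allFin q) * ∑ (vecs q N) f
coordinate-independent q (suc N) Fin.zero Y f inv = begin
  ∑ (vecs q (suc N)) (λ ω → ⟦ Y (lookup ω Fin.zero) ⟧ * f ω) * q
    ≡⟨ cong (_* q) (∑-vecs q N _) ⟩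
  ∑ (allFin q) (λ c → ∑ (vecs q N) (λ v → ⟦ Y c ⟧ * f (c ∷ v))) * q
    ≡⟨ cong (_* q) (∑-cong (allFin q) (λ c → ∑-*ˡ (vecs q N) ⟦ Y c ⟧ (λ v → f (c ∷ v)))) ⟩
  ∑ (allFin q) (λ c → ⟦ Y c ⟧ * S c) * q
    ≡⟨ sym (∑-*ʳ (allFin q) q _) ⟩
  ∑ (allFin q) (λ c → ⟦ Y c ⟧ * S c * q)
    ≡⟨ ∑-cong (allFin q) (λ c → trans (*-assoc ⟦ Y c ⟧ (S c) q) (cong (⟦ Y c ⟧ *_) (total c))) ⟩
  ∑ (allFin q) (λ c → ⟦ Y c ⟧ * ∑ (vecs q (suc N)) f)
    ≡⟨ ∑-*ʳ (allFin q) _ _ ⟩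
  count Y (allFin q) * ∑ (vecs q (suc N)) f ∎
  where
  open ≡-Reasoning
  S : Fin q → ℕ
  S c = ∑ (vecs q N) (λ v → f (c ∷ v))
  total : ∀ c → S c * q ≡ ∑ (vecs q (suc N)) f
  total c = sym (trans (∑-vecs q N f)
    (trans (∑-cong (allFin q) (λ d → ∑-cong (vecs q N) (λ v → inv (c ∷ v) d)))
    (trans (∑-const (allFin q) (S c)) (trans (cong (_* S c) (length-allFin q)) (*-comm q (S c))))))
coordinate-independent q (suc N) (Fin.suc i) Y f inv = begin
  ∑ (vecs q (suc N)) (λ ω → ⟦ Y (lookup ω (Fin.suc i)) ⟧ * f ω) * q
    ≡⟨ cong (_* q) (∑-vecs q N _) ⟩
  ∑ (allFin q) (λ c → ∑ (vecs q N) (λ v → ⟦ Y (lookup v i) ⟧ * f (c ∷ v))) * q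
    ≡⟨ sym (∑-*ʳ (allFin q) q _) ⟩
  ∑ (allFin q) (λ c → ∑ (vecs q N) (λ v → ⟦ Y (lookup v i) ⟧ * f (c ∷ v)) * q)
    ≡⟨ ∑-cong (allFin q) (λ c → coordinate-independent q N i Y (λ v → f (c ∷ v)) (λ v d → inv (c ∷ v) d)) ⟩
  ∑ (allFin q) (λ c → count Y (allFin q) * ∑ (vecs q N) (λ v → f (c ∷ v)))
    ≡⟨ ∑-*ˡ (allFin q) (count Y (allFin q)) _ ⟩
  count Y (allFin q) * ∑ (allFin q) (λ c → ∑ (vecs q N) (λ v → f (c ∷ v)))
    ≡⟨ cong (count Y (allFin q) *_) (sym (∑-vecs q N f)) ⟩
  count Y (allFin q) * ∑ (vecs q (suc N)) f ∎
  where open ≡-Reasoning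

Constraint : ℕ → ℕ → Set
Constraint q N = Fin N × (Fin q → Bool)

satisfies : ∀ {q N} → List (Constraint q N) → Vec (Fin q) N → Bool
satisfies cs ω = all (λ c → proj₂ c (lookup ω (proj₁ c))) cs

choices : ∀ {q N} → List (Constraint q N) → ℕ
choices {q} []             = 1
choices {q} ((_ , Y) ∷ cs) = count Y (allFin q) * choices cs

⟦∧⟧ : ∀ a b → ⟦ a ∧ b ⟧ ≡ ⟦ a ⟧ * ⟦ b ⟧
⟦∧⟧ true  b = sym (+-identityʳ _)
⟦∧⟧ false b = refl

satisfies-update : ∀ {q N} (cs : List (Constraint q N)) {i} → i ∉ map proj₁ cs → ∀ ω c →
  satisfies cs (ω Vec.[ i ]≔ c) ≡ satisfies cs ω
satisfies-update []             i∉ ω c = refl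
satisfies-update ((j , Y) ∷ cs) i∉ ω c = cong₂ _∧_
  (cong Y (lookup∘update′ (λ e → i∉ (here (sym e))) ω c)) (satisfies-update cs (i∉ ∘ there) ω c)

-- Peels off one constraint at a time by independence; the probabilities multiply because the
-- coordinates are distinct.
count-satisfies : ∀ {q N} (cs : List (Constraint q N)) → Unique (map proj₁ cs) →
  count (satisfies cs) (vecs q N) * q ^ length cs ≡ q ^ N * choices cs
count-satisfies {q} {N} [] u = cong (_* 1) (∑-vecs-1 q N)
count-satisfies {q} {N} ((i , Y) ∷ cs) (p ∷ u) = begin
  count (satisfies ((i , Y) ∷ cs)) (vecs q N) * (q * q ^ length cs)
    ≡⟨ cong (_* (q * q ^ length cs)) (∑-cong (vecs q N) (λ ω → ⟦∧⟧ (Y (lookup ω i)) _)) ⟩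
  ∑ (vecs q N) (λ ω → ⟦ Y (lookup ω i) ⟧ * ⟦ satisfies cs ω ⟧) * (q * q ^ length cs)
    ≡⟨ sym (*-assoc (∑ (vecs q N) (λ ω → ⟦ Y (lookup ω i) ⟧ * ⟦ satisfies cs ω ⟧)) q (q ^ length cs)) ⟩
  ∑ (vecs q N) (λ ω → ⟦ Y (lookup ω i) ⟧ * ⟦ satisfies cs ω ⟧) * q * q ^ length cs
    ≡⟨ cong (_* q ^ length cs) (coordinate-independent q N i Y _ (λ ω c → cong ⟦_⟧ (satisfies-update cs (∉-all p) ω c))) ⟩
  count Y (allFin q) * count (satisfies cs) (vecs q N) * q ^ length cs
    ≡⟨ *-assoc (count Y (allFin q)) _ _ ⟩
  count Y (allFin q) * (count (satisfies cs) (vecs q N) * q ^ length cs)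
    ≡⟨ cong (count Y (allFin q) *_) (count-satisfies cs u) ⟩
  count Y (allFin q) * (q ^ N * choices cs)
    ≡⟨ swap3 (count Y (allFin q)) (q ^ N) (choices cs) ⟩
  q ^ N * (count Y (allFin q) * choices cs) ∎
  where
  open ≡-Reasoning
  swap3 : ∀ a b c → a * (b * c) ≡ b * (a * c)
  swap3 = solve-∀

all-map : ∀ {A B : Set} (f : A → B) (p : B → Bool) xs → all p (map f xs) ≡ all (p ∘ f) xs
all-map f p []       = refl
all-map f p (x ∷ xs) = cong (p (f x) ∧_) (all-map f p xs)

map-∘′ : ∀ {A B C : Set} (g : B → C) (f : A → B) xs → map g (map f xs) ≡ map (λ x → g (f x)) xs
map-∘′ g f []       = refl
map-∘′ g f (x ∷ xs) = cong (g (f x) ∷_) (map-∘′ g f xs)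

map-id′ : ∀ {A : Set} (xs : List A) → map (λ x → x) xs ≡ xs
map-id′ []       = refl
map-id′ (x ∷ xs) = cong (x ∷_) (map-id′ xs)

choices-map : ∀ {A : Set} {q N} (h : A → Fin N) (Y : Fin q → Bool) xs →
  choices (map (λ x → h x , Y) xs) ≡ count Y (allFin q) ^ length xs
choices-map h Y []       = refl
choices-map {q = q} h Y (x ∷ xs) = cong (count Y (allFin q) *_) (choices-map h Y xs)

choices-++ : ∀ {q N} (cs ds : List (Constraint q N)) → choices (cs ++ ds) ≡ choices cs * choices ds
choices-++ []             ds = sym (+-identityʳ _)
choices-++ {q} ((i , Y) ∷ cs) ds = trans (cong (count Y (allFin q) *_) (choices-++ cs ds))
  (sym (*-assoc (count Y (allFin q)) (choices cs) (choices ds)))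

count-same : ∀ {A : Set} {q N} (h : A → Fin N) (Y : Fin q → Bool) xs → Unique (map h xs) →
  count (λ ω → all (λ x → Y (lookup ω (h x))) xs) (vecs q N) * q ^ length xs ≡ q ^ N * count Y (allFin q) ^ length xs
count-same {A} {q} {N} h Y xs u = begin
  count (λ ω → all (λ x → Y (lookup ω (h x))) xs) (vecs q N) * q ^ length xs
    ≡⟨ cong₂ (λ a b → a * q ^ b) (∑-cong (vecs q N) (λ ω → cong ⟦_⟧ (sym (all-map (λ x → h x , Y) _ xs))))
             (sym (length-map (λ x → h x , Y) xs)) ⟩
  count (satisfies cs) (vecs q N) * q ^ length cs
    ≡⟨ count-satisfies cs (subst Unique (sym (map-∘′ proj₁ (λ x → h x , Y) xs)) u) ⟩
  q ^ N * choices cs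
    ≡⟨ cong (q ^ N *_) (choices-map h Y xs) ⟩
  q ^ N * count Y (allFin q) ^ length xs ∎
  where
  open ≡-Reasoning
  cs = map (λ x → h x , Y) xs

-- Adaptive exposure of a random edge set of density 1/q

module Exploration (q₀ N : ℕ) {E : Set} (enc : E → Fin N) (enc-inj : ∀ {e e′} → enc e ≡ enc e′ → e ≡ e′) where

  q : ℕ
  q = suc q₀

  Ω : Set
  Ω = Vec (Fin q) N

  isZero : Fin q → Bool
  isZero c = does (c ≟ Fin.zero)

  on : Ω → E → Bool
  on ω e = isZero (lookup ω (enc e))

  allOn allOff : Ω → List E → Bool
  allOn  ω = all (on ω)
  allOff ω = all (λ e → not (on ω e))

  -- G n k / (qⁿ 2ᵏ) bounds the probability that n further queries, or fewer if k of them are hits,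
  -- are answered by misses and by hits each of which has a witness of conditional probability ≤ 1/2.
  G : ℕ → ℕ → ℕ
  G n       zero    = q ^ n
  G zero    (suc k) = 2 ^ suc k
  G (suc n) (suc k) = q₀ * G n (suc k) + G n k

  -- Divided by (2q)^n 2^k, the right side is (1 - 1/(2q))^n + 2^(-k). One query is survived with
  -- probability at most (1 - 1/q) + 1/(2q); if k hits occur, they alone cost 2^(-k).
  G-bound : ∀ n k → 2 ^ n * G n k ≤ 2 ^ k * suc (2 * q₀) ^ n + (2 * q) ^ n
  G-bound n zero = ≤-trans (≤-reflexive (sym (^-distribʳ-* n 2 q))) (m≤n+m _ _)
  G-bound zero (suc k) = ≤-trans (≤-reflexive (e (2 ^ k))) (m≤m+n _ _)
    where
    e : ∀ a → 2 * a + 0 ≡ 2 * a * 1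
    e = solve-∀
  G-bound (suc n) (suc k) = begin
    2 * 2 ^ n * (q₀ * G n (suc k) + G n k)
      ≡⟨ e₁ (2 ^ n) q₀ (G n (suc k)) (G n k) ⟩
    2 * q₀ * (2 ^ n * G n (suc k)) + 2 * (2 ^ n * G n k)
      ≤⟨ +-mono-≤ (*-monoʳ-≤ (2 * q₀) (G-bound n (suc k))) (*-monoʳ-≤ 2 (G-bound n k)) ⟩
    2 * q₀ * (2 * 2 ^ k * suc (2 * q₀) ^ n + (2 * q) ^ n) + 2 * (2 ^ k * suc (2 * q₀) ^ n + (2 * q) ^ n)
      ≡⟨ e₂ q₀ (2 ^ k) (suc (2 * q₀) ^ n) ((2 * q) ^ n) ⟩
    2 * 2 ^ k * (suc (2 * q₀) * suc (2 * q₀) ^ n) + 2 * suc q₀ * (2 * q) ^ n ∎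
    where
    open ≤-Reasoning
    e₁ : ∀ a b c d → 2 * a * (b * c + d) ≡ 2 * b * (a * c) + 2 * (a * d)
    e₁ = solve-∀
    e₂ : ∀ b k u v → 2 * b * (2 * k * u + v) + 2 * (k * u + v) ≡ 2 * k * (suc (2 * b) * u) + 2 * suc b * v
    e₂ = solve-∀

  count-zero : count isZero (allFin q) ≡ 1
  count-zero = cong suc (trans (∑-const′ (tabulate Fin.suc) aux) refl)
    where
    ∑-const′ : ∀ {A : Set} (xs : List A) {f : A → ℕ} → (∀ x → x ∈ xs → f x ≡ 0) → ∑ xs f ≡ 0
    ∑-const′ []       h = refl
    ∑-const′ (x ∷ xs) h = cong₂ _+_ (h x (here refl)) (∑-const′ xs (λ y m → h y (there m)))
    aux : ∀ x → x ∈ tabulate Fin.suc → ⟦ isZero x ⟧ ≡ 0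
    aux x m with ∈-tabulate⁻ m
    ... | i , refl = refl

  count-nonzero : count (not ∘ isZero) (allFin q) ≡ q₀
  count-nonzero = +-cancelˡ-≡ 1 _ _ (trans (cong (_+ count (not ∘ isZero) (allFin q)) (sym count-zero))
    (trans (sym (∑-+ (allFin q) (λ c → ⟦ isZero c ⟧) (λ c → ⟦ not (isZero c) ⟧)))
    (trans (∑-cong (allFin q) (λ c → one (isZero c))) (trans (∑1 (allFin q)) (length-allFin q)))))
    where
    one : ∀ b → ⟦ b ⟧ + ⟦ not b ⟧ ≡ 1
    one true  = refl
    one false = refl

  all-++ : ∀ {A : Set} (p : A → Bool) xs ys → all p (xs ++ ys) ≡ all p xs ∧ all p ys
  all-++ p []       ys = refl
  all-++ p (x ∷ xs) ys with p x
  ... | true  = all-++ p xs ys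
  ... | false = refl

  cylinder : ∀ F X → Unique (F ++ X) →
    count (λ ω → allOn ω F ∧ allOff ω X) (vecs q N) * q ^ (length F + length X) ≡ q ^ N * q₀ ^ length X
  cylinder F X u = begin
    count (λ ω → allOn ω F ∧ allOff ω X) (vecs q N) * q ^ (length F + length X)
      ≡⟨ cong₂ (λ a b → a * q ^ b) (∑-cong (vecs q N) (λ ω → cong ⟦_⟧ (sym (split ω)))) (sym len) ⟩
    count (satisfies cs) (vecs q N) * q ^ length cs
      ≡⟨ count-satisfies cs (subst Unique (sym mapeq) (unique-map enc u (λ _ _ e → enc-inj e))) ⟩
    q ^ N * choices cs
      ≡⟨ cong (q ^ N *_) ch ⟩
    q ^ N * q₀ ^ length X ∎
    where
    open ≡-Reasoning
    cF = map (λ e → enc e , isZero) F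
    cX = map (λ e → enc e , not ∘ isZero) X
    cs = cF ++ cX
    split : ∀ ω → satisfies cs ω ≡ allOn ω F ∧ allOff ω X
    split ω = trans (all-++ _ cF cX) (cong₂ _∧_ (all-map _ _ F) (all-map _ _ X))
    len : length cs ≡ length F + length X
    len = trans (length-++ cF) (cong₂ _+_ (length-map _ F) (length-map _ X))
    map-++′ : ∀ {A B : Set} (f : A → B) xs ys → map f (xs ++ ys) ≡ map f xs ++ map f ys
    map-++′ f []       ys = refl
    map-++′ f (x ∷ xs) ys = cong (f x ∷_) (map-++′ f xs ys)
    mapeq : map proj₁ cs ≡ map enc (F ++ X)
    mapeq = trans (map-++′ proj₁ cF cX) (trans (cong₂ _++_ (map-∘′ proj₁ _ F) (map-∘′ proj₁ _ X)) (sym (map-++′ enc F X)))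
    ch : choices cs ≡ q₀ ^ length X
    ch = trans (choices-++ cF cX) (trans (cong₂ _*_ (choices-map enc isZero F) (choices-map enc (not ∘ isZero) X))
      (trans (cong₂ (λ a b → a ^ length F * b ^ length X) count-zero count-nonzero)
             (trans (cong (_* q₀ ^ length X) (^-zeroˡ (length F))) (*-identityˡ _))))

  module _ (ev : Ω → Bool) (h f₀ n₀ : ℕ) where

    inState : List E → List E → Ω → Bool
    inState F X ω = (allOn ω F ∧ allOff ω X) ∧ ev ω

    mass : List E → List E → ℕ
    mass F X = count (inState F X) (vecs q N)

    -- The last field of `query` is the inequality ∑ q^(-|T|) ≤ 1/2 multiplied by 2q^h: after a hit
    -- at `z`, some witness `T` is on with conditional probability at most 1/2. Disjointness from
    -- everything revealed makes q^(-|T|) the right probability.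
    data Step (F X : List E) : Set where
      impossible : (∀ ω → inState F X ω ≡ true → ⊥) → Step F X
      query : (z : E) (Ts : List (List E)) → z ∉ F → z ∉ X →
        (∀ {T} → T ∈ Ts → Unique (T ++ (z ∷ F) ++ X) × length T ≤ h) →
        (∀ ω → inState F X ω ≡ true → on ω z ≡ true → ∃ λ T → T ∈ Ts × allOn ω T ≡ true) →
        2 * ∑ Ts (λ T → q ^ (h ∸ length T)) ≤ q ^ h → Step F X

    module _ (step : ∀ F X → Unique (F ++ X) → length F ≤ f₀ → length X ≤ n₀ → Step F X) where

      unique-insert : ∀ {z : E} F X → Unique (F ++ X) → z ∉ F → z ∉ X → Unique (F ++ z ∷ X)
      unique-insert [] X u z∉F z∉X = all-∉ z∉X ∷ u
      unique-insert {z} (e ∷ F) X (p ∷ u) z∉F z∉X =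
        all-∉ (λ m → case ∈-++⁻ F m of λ
          { (inj₁ a) → ∉-all p (∈-++⁺ˡ a)
          ; (inj₂ (here refl)) → z∉F (here refl)
          ; (inj₂ (there b)) → ∉-all p (∈-++⁺ʳ F b) })
        ∷ unique-insert F X u (z∉F ∘ there) z∉X

      mass≤cylinder : ∀ F X → mass F X ≤ count (λ ω → allOn ω F ∧ allOff ω X) (vecs q N)
      mass≤cylinder F X = ∑-mono (vecs q N) (λ ω _ → ⟦⟧-mono {inState F X ω} ∧-elim₁)

      splitting : ∀ F X z Ts → (∀ ω → inState F X ω ≡ true → on ω z ≡ true → ∃ λ T → T ∈ Ts × allOn ω T ≡ true) →
        mass F X ≤ mass F (z ∷ X) + ∑ Ts (λ T → mass (T ++ z ∷ F) X)
      splitting F X z Ts cover = ≤-trans (∑-mono (vecs q N) (λ ω _ → pointwise ω))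
        (≤-reflexive (trans (∑-+ (vecs q N) _ _)
          (cong (mass F (z ∷ X) +_) (∑-swap (vecs q N) Ts (λ ω T → ⟦ inState (T ++ z ∷ F) X ω ⟧)))))
        where
        pointwise : ∀ ω → ⟦ inState F X ω ⟧ ≤ ⟦ inState F (z ∷ X) ω ⟧ + ∑ Ts (λ T → ⟦ inState (T ++ z ∷ F) X ω ⟧)
        pointwise ω with inState F X ω in st
        ... | false = z≤n
        ... | true with on ω z in oz
        ...   | false = ≤-trans (≤-reflexive (cong ⟦_⟧ (sym st))) (m≤m+n _ _)
        ...   | true with cover ω st oz
        ...     | T , T∈ , aT = ≤-trans (≤-trans (≤-reflexive (cong ⟦_⟧ (sym new)))
                     (∑-member (λ T → ⟦ inState (T ++ z ∷ F) X ω ⟧) T∈)) (m≤n+m _ _)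
          where
          a₁ = ∧-elim₁ st
          new : inState (T ++ z ∷ F) X ω ≡ true
          new = ∧-intro (∧-intro (trans (all-++ (on ω) T (z ∷ F)) (∧-intro aT (∧-intro oz (∧-elim₁ a₁))))
                  (∧-elim₂ {allOn ω F} a₁)) (∧-elim₂ {allOn ω F ∧ allOff ω X} st)

      -- Says that the probability of the event, conditional on the state, is at most G n k / (q^n
      -- 2^k). A miss adds one edge to `X`, a hit adds `z` and a witness to `F`, at most `suc h`
      -- edges; the two hypotheses on lengths keep every state within reach of `step`.
      mass-bound : ∀ n k F X → Unique (F ++ X) → length F + k * suc h ≤ f₀ → length X + n ≤ n₀ →
        mass F X * q ^ (length F + length X) * (q ^ n * 2 ^ k) ≤ q ^ N * q₀ ^ length X * G n k
      mass-bound n zero F X u hF hX = begin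
        mass F X * q ^ (length F + length X) * (q ^ n * 1)
          ≤⟨ *-monoˡ-≤ (q ^ n * 1) (*-monoˡ-≤ (q ^ (length F + length X)) (mass≤cylinder F X)) ⟩
        count (λ ω → allOn ω F ∧ allOff ω X) (vecs q N) * q ^ (length F + length X) * (q ^ n * 1)
          ≡⟨ cong₂ _*_ (cylinder F X u) (*-identityʳ (q ^ n)) ⟩
        q ^ N * q₀ ^ length X * q ^ n ∎
        where open ≤-Reasoning
      mass-bound zero (suc k) F X u hF hX = begin
        mass F X * q ^ (length F + length X) * (1 * 2 ^ suc k)
          ≤⟨ *-monoˡ-≤ (1 * 2 ^ suc k) (*-monoˡ-≤ (q ^ (length F + length X)) (mass≤cylinder F X)) ⟩
        count (λ ω → allOn ω F ∧ allOff ω X) (vecs q N) * q ^ (length F + length X) * (1 * 2 ^ suc k)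
          ≡⟨ cong₂ _*_ (cylinder F X u) (*-identityˡ (2 ^ suc k)) ⟩
        q ^ N * q₀ ^ length X * 2 ^ suc k ∎
        where open ≤-Reasoning
      mass-bound (suc n) (suc k) F X u hF hX
        with step F X u (≤-trans (m≤m+n _ _) hF) (≤-trans (m≤m+n _ _) hX)
      ... | impossible never = ≤-trans (≤-reflexive (cong (λ a → a * q ^ (length F + length X) * (q ^ suc n * 2 ^ suc k)) vanish)) z≤n
        where
        vanish : mass F X ≡ 0
        vanish = n≤0⇒n≡0 (≤-trans (∑-bound (vecs q N) 0 (λ ω _ → zeroAt ω)) (≤-reflexive (*-zeroʳ (length (vecs q N)))))
          where
          zeroAt : ∀ ω → ⟦ inState F X ω ⟧ ≤ 0
          zeroAt ω with inState F X ω in st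
          ... | false = z≤n
          ... | true  = ⊥-elim (never ω st)
      ... | query z Ts z∉F z∉X good cover small = begin
        mass F X * Q * (q * q ^ n * 2 ^ suc k)
          ≤⟨ *-monoˡ-≤ (q * q ^ n * 2 ^ suc k) (*-monoˡ-≤ Q (splitting F X z Ts cover)) ⟩
        (m₁ + m₂) * Q * (q * q ^ n * 2 ^ suc k)
          ≡⟨ e₁ m₁ m₂ Q q (q ^ n) (2 ^ k) ⟩
        m₁ * (q * Q) * (q ^ n * 2 ^ suc k) + 2 * (m₂ * (q * Q) * (q ^ n * 2 ^ k))
          ≤⟨ +-mono-≤ offCase onCase ⟩
        q ^ N * (q₀ * q₀ ^ length X) * G n (suc k) + q ^ N * q₀ ^ length X * G n k
          ≡⟨ e₂ (q ^ N) q₀ (q₀ ^ length X) (G n (suc k)) (G n k) ⟩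
        q ^ N * q₀ ^ length X * (q₀ * G n (suc k) + G n k) ∎
        where
        open ≤-Reasoning
        Q  = q ^ (length F + length X)
        m₁ = mass F (z ∷ X)
        m₂ = ∑ Ts (λ T → mass (T ++ z ∷ F) X)
        W  = q ^ N * q₀ ^ length X * G n k
        e₁ : ∀ a b Q q y t → (a + b) * Q * (q * y * (2 * t)) ≡ a * (q * Q) * (y * (2 * t)) + 2 * (b * (q * Q) * (y * t))
        e₁ = solve-∀
        e₂ : ∀ a b c d e → a * (b * c) * d + a * c * e ≡ a * c * (b * d + e)
        e₂ = solve-∀
        offCase : m₁ * (q * Q) * (q ^ n * 2 ^ suc k) ≤ q ^ N * (q₀ * q₀ ^ length X) * G n (suc k)
        offCase = subst (λ a → m₁ * q ^ a * (q ^ n * 2 ^ suc k) ≤ q ^ N * (q₀ * q₀ ^ length X) * G n (suc k))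
          (+-suc (length F) (length X))
          (mass-bound n (suc k) F (z ∷ X) (unique-insert F X u z∉F z∉X) hF (≤-trans (≤-reflexive (sym (+-suc (length X) n))) hX))
        one : ∀ T → T ∈ Ts → mass (T ++ z ∷ F) X * (q * Q) * (q ^ n * 2 ^ k) * q ^ h ≤ W * q ^ (h ∸ length T)
        one T T∈ = begin
          mass (T ++ z ∷ F) X * (q * Q) * (q ^ n * 2 ^ k) * q ^ h
            ≡⟨ cong (mass (T ++ z ∷ F) X * (q * Q) * (q ^ n * 2 ^ k) *_) qh ⟩
          mass (T ++ z ∷ F) X * (q * Q) * (q ^ n * 2 ^ k) * (q ^ length T * q ^ (h ∸ length T))
            ≡⟨ e₃ (mass (T ++ z ∷ F) X) (q * Q) (q ^ n * 2 ^ k) (q ^ length T) (q ^ (h ∸ length T)) ⟩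
          mass (T ++ z ∷ F) X * (q ^ length T * (q * Q)) * (q ^ n * 2 ^ k) * q ^ (h ∸ length T)
            ≡⟨ cong (λ a → mass (T ++ z ∷ F) X * a * (q ^ n * 2 ^ k) * q ^ (h ∸ length T)) qexp ⟩
          mass (T ++ z ∷ F) X * q ^ (length (T ++ z ∷ F) + length X) * (q ^ n * 2 ^ k) * q ^ (h ∸ length T)
            ≤⟨ *-monoˡ-≤ (q ^ (h ∸ length T)) (mass-bound n k (T ++ z ∷ F) X
                 (subst Unique (sym (++-assoc′ T (z ∷ F) X)) (proj₁ (good T∈))) hF′ (≤-trans (+-monoʳ-≤ (length X) (n≤1+n n)) hX)) ⟩
          W * q ^ (h ∸ length T) ∎
          where
          ++-assoc′ : ∀ (as bs cs : List E) → (as ++ bs) ++ cs ≡ as ++ bs ++ cs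
          ++-assoc′ []       bs cs = refl
          ++-assoc′ (a ∷ as) bs cs = cong (a ∷_) (++-assoc′ as bs cs)
          e₃ : ∀ a b c d e → a * b * c * (d * e) ≡ a * (d * b) * c * e
          e₃ = solve-∀
          lenT : length (T ++ z ∷ F) ≡ length T + suc (length F)
          lenT = length-++ T
          qh : q ^ h ≡ q ^ length T * q ^ (h ∸ length T)
          qh = trans (cong (q ^_) (sym (m+[n∸m]≡n (proj₂ (good T∈))))) (^-distribˡ-+-* q (length T) (h ∸ length T))
          qexp : q ^ length T * (q * Q) ≡ q ^ (length (T ++ z ∷ F) + length X)
          qexp = trans (sym (^-distribˡ-+-* q (length T) (suc (length F + length X))))
            (cong (q ^_) (trans (sym (+-assoc (length T) (suc (length F)) (length X))) (cong (_+ length X) (sym lenT))))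
          hF′ : length (T ++ z ∷ F) + k * suc h ≤ f₀
          hF′ = ≤-trans (≤-reflexive (cong (_+ k * suc h) lenT))
            (≤-trans (+-monoˡ-≤ (k * suc h) (+-monoˡ-≤ (suc (length F)) (proj₂ (good T∈))))
            (≤-trans (≤-reflexive (e₄ h (length F) (k * suc h))) hF))
            where
            e₄ : ∀ h f c → h + suc f + c ≡ f + (suc h + c)
            e₄ = solve-∀
        onCase : 2 * (m₂ * (q * Q) * (q ^ n * 2 ^ k)) ≤ W
        onCase = *-cancelʳ-≤ _ W (q ^ h) {{m^n≢0 q h}} (begin
          2 * (m₂ * (q * Q) * (q ^ n * 2 ^ k)) * q ^ h
            ≡⟨ *-assoc 2 (m₂ * (q * Q) * (q ^ n * 2 ^ k)) (q ^ h) ⟩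
          2 * (m₂ * (q * Q) * (q ^ n * 2 ^ k) * q ^ h)
            ≡⟨ cong (2 *_) (trans (cong (_* q ^ h) (trans (cong (_* (q ^ n * 2 ^ k)) (sym (∑-*ʳ Ts (q * Q) _))) (sym (∑-*ʳ Ts (q ^ n * 2 ^ k) _)))) (sym (∑-*ʳ Ts (q ^ h) _))) ⟩
          2 * ∑ Ts (λ T → mass (T ++ z ∷ F) X * (q * Q) * (q ^ n * 2 ^ k) * q ^ h)
            ≤⟨ *-monoʳ-≤ 2 (∑-mono Ts one) ⟩
          2 * ∑ Ts (λ T → W * q ^ (h ∸ length T))
            ≡⟨ cong (2 *_) (∑-*ˡ Ts W _) ⟩
          2 * (W * ∑ Ts (λ T → q ^ (h ∸ length T)))
            ≡⟨ e₅ W (∑ Ts (λ T → q ^ (h ∸ length T))) ⟩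
          W * (2 * ∑ Ts (λ T → q ^ (h ∸ length T)))
            ≤⟨ *-monoʳ-≤ W small ⟩
          W * q ^ h ∎)
          where
          e₅ : ∀ a b → 2 * (a * b) ≡ a * (2 * b)
          e₅ = solve-∀

      -- Starting from nothing revealed, n = 2qκ queries make both terms of `G-bound` at most
      -- 2^(-κ).
      exploration : ∀ κ → κ * suc h ≤ f₀ → 2 * q * κ ≤ n₀ → count ev (vecs q N) * 2 ^ κ ≤ 2 * q ^ N
      exploration κ hf hn = *-cancelʳ-≤ _ _ (q ^ n) {{m^n≢0 q n}} (begin
        count ev (vecs q N) * 2 ^ κ * q ^ n
          ≡⟨ e₁ (count ev (vecs q N)) (2 ^ κ) (q ^ n) ⟩
        mass [] [] * 1 * (q ^ n * 2 ^ κ)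
          ≤⟨ mass-bound n κ [] [] [] hf hn ⟩
        q ^ N * 1 * G n κ
          ≤⟨ *-monoʳ-≤ (q ^ N * 1) G≤ ⟩
        q ^ N * 1 * (2 * q ^ n)
          ≡⟨ e₂ (q ^ N) (q ^ n) ⟩
        2 * q ^ N * q ^ n ∎)
        where
        open ≤-Reasoning
        n = 2 * q * κ
        e₁ : ∀ a b c → a * b * c ≡ a * 1 * (c * b)
        e₁ = solve-∀
        e₂ : ∀ a b → a * 1 * (2 * b) ≡ 2 * a * b
        e₂ = solve-∀
        a = suc (2 * q₀)
        2q : 2 * q ≡ suc a
        2q = e q₀
          where
          e : ∀ x → 2 * suc x ≡ suc (suc (2 * x))
          e = solve-∀
        bern : ∀ j → a ^ suc j + suc j * a ^ j ≤ suc a ^ suc j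
        bern zero = ≤-reflexive (e a)
          where
          e : ∀ a → a * 1 + 1 ≡ suc a * 1
          e = solve-∀
        bern (suc j) = ≤-trans (≤-trans (m≤m+n _ (suc j * a ^ j)) (≤-reflexive (e a j (a ^ j)))) (*-monoʳ-≤ (suc a) (bern j))
          where
          e : ∀ a j y → a * (a * y) + suc (suc j) * (a * y) + suc j * y ≡ suc a * (a * y + suc j * y)
          e = solve-∀
        -- As a + 1 = 2q, this is (1 - 1/(2q))^(2q) ≤ 1/2, a case of Bernoulli's inequality.
        half : 2 * a ^ suc a ≤ suc a ^ suc a
        half = ≤-trans (≤-trans (≤-reflexive (e a (a ^ a))) (+-monoʳ-≤ (a ^ suc a) (*-monoˡ-≤ (a ^ a) (n≤1+n a)))) (bern a)
          where
          e : ∀ a y → 2 * (a * y) ≡ a * y + a * y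
          e = solve-∀
        small : 2 ^ κ * a ^ n ≤ (2 * q) ^ n
        small = begin
          2 ^ κ * a ^ n
            ≡⟨ cong (λ b → 2 ^ κ * a ^ (b * κ)) 2q ⟩
          2 ^ κ * a ^ (suc a * κ)
            ≡⟨ cong (2 ^ κ *_) (sym (^-*-assoc a (suc a) κ)) ⟩
          2 ^ κ * (a ^ suc a) ^ κ
            ≡⟨ sym (^-distribʳ-* κ 2 (a ^ suc a)) ⟩
          (2 * a ^ suc a) ^ κ
            ≤⟨ ^-monoˡ-≤ κ half ⟩
          (suc a ^ suc a) ^ κ
            ≡⟨ ^-*-assoc (suc a) (suc a) κ ⟩
          suc a ^ (suc a * κ)
            ≡⟨ cong (λ b → b ^ (b * κ)) (sym 2q) ⟩
          (2 * q) ^ n ∎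
        G≤ : G n κ ≤ 2 * q ^ n
        G≤ = *-cancelˡ-≤ (2 ^ n) {{m^n≢0 2 n}} (begin
          2 ^ n * G n κ
            ≤⟨ G-bound n κ ⟩
          2 ^ κ * a ^ n + (2 * q) ^ n
            ≤⟨ +-monoˡ-≤ _ small ⟩
          (2 * q) ^ n + (2 * q) ^ n
            ≡⟨ cong₂ _+_ (^-distribʳ-* n 2 q) (^-distribʳ-* n 2 q) ⟩
          2 ^ n * q ^ n + 2 ^ n * q ^ n
            ≡⟨ e (2 ^ n) (q ^ n) ⟩
          2 ^ n * (2 * q ^ n) ∎)
          where
          e : ∀ a b → a * b + a * b ≡ a * (2 * b)
          e = solve-∀

-- Edge sets of copies and the exponent inequality

tri : ℕ → ℕ
tri zero    = 0
tri (suc k) = suc k + tri k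

2tri : ∀ k → 2 * tri k ≡ k * suc k
2tri zero    = refl
2tri (suc k) = trans (*-distribˡ-+ 2 (suc k) (tri k)) (trans (cong (2 * suc k +_) (2tri k)) (e k))
  where
  e : ∀ k → 2 * suc k + k * suc k ≡ suc k * suc (suc k)
  e = solve-∀

-- Applied to the parts of x₁, ..., x_{s-1} and the blocks of x₂, ..., x_s, it lists the pairs (P
-- xᵢ, B xⱼ) with i < j, which are the edges of a copy.
stair : {A : Set} → List A → List A → List (A × A)
stair (p ∷ ps) (b ∷ bs) = map (p ,_) (b ∷ bs) ++ stair ps bs
stair _        _        = []

length-stair : ∀ {A : Set} (ps bs : List A) → length ps ≡ length bs → length (stair ps bs) ≡ tri (length bs)
length-stair []       []       e = refl
length-stair (p ∷ ps) (b ∷ bs) e = trans (length-++ (map (p ,_) (b ∷ bs)))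
  (cong₂ _+_ (length-map (p ,_) (b ∷ bs)) (length-stair ps bs (suc-injective e)))

stair-∈ : ∀ {A : Set} (ps bs : List A) {e} → e ∈ stair ps bs → proj₁ e ∈ ps × proj₂ e ∈ bs
stair-∈ (p ∷ ps) (b ∷ bs) e∈ with ∈-++⁻ (map (p ,_) (b ∷ bs)) e∈
... | inj₂ m = there (proj₁ (stair-∈ ps bs m)) , there (proj₂ (stair-∈ ps bs m))
... | inj₁ m with ∈-map⁻ (p ,_) m
...   | b′ , b∈ , refl = here refl , b∈

stair-unique : ∀ {A : Set} (ps bs : List A) → Unique ps → Unique bs → Unique (stair ps bs)
stair-unique [] bs u v = []
stair-unique (p ∷ ps) [] u v = []
stair-unique (p ∷ ps) (b ∷ bs) (a ∷ u) v@(_ ∷ v′) = Uniq.++⁺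
  (unique-map (p ,_) v (λ { _ _ refl → refl }))
  (stair-unique ps bs u v′)
  (λ { (m₁ , m₂) → case ∈-map⁻ (p ,_) m₁ of λ { (_ , _ , refl) → ∉-all a (proj₁ (stair-∈ ps bs m₂)) } })

total : List ℕ → ℕ
total []       = 0
total (t ∷ ts) = t + total ts

-- The second elementary symmetric function; on entries 0 and 1 it counts the pairs of ones.
pairs : List ℕ → ℕ
pairs []       = 0
pairs (t ∷ ts) = t * total ts + pairs ts

Small : ℕ → Set
Small t = t ≤ 1

2pairs : ∀ ts → All Small ts → 2 * pairs ts + total ts ≡ total ts * total ts
2pairs [] [] = refl
2pairs (zero ∷ ts) (_ ∷ s) = 2pairs ts s
2pairs (suc zero ∷ ts) (_ ∷ s) = trans (e₁ (total ts) (pairs ts)) (trans (cong (λ a → a + suc (2 * total ts)) (2pairs ts s)) (e₂ (total ts)))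
  where
  e₁ : ∀ t p → 2 * (1 * t + p) + (1 + t) ≡ (2 * p + t) + suc (2 * t)
  e₁ = solve-∀
  e₂ : ∀ t → t * t + suc (2 * t) ≡ (1 + t) * (1 + t)
  e₂ = solve-∀
2pairs (suc (suc t) ∷ ts) (s≤s () ∷ s)

total≤length : ∀ ts → All Small ts → total ts ≤ length ts
total≤length []       []       = z≤n
total≤length (t ∷ ts) (s ∷ ss) = +-mono-≤ s (total≤length ts ss)

-- e counts the revealed edges of a copy through w, x; α counts its other vertices joined to w or x by a
-- revealed edge, θ those on any revealed edge, and pr the pairs of the latter.  The hypothesis e ≤ g,
-- that the copy is not completely revealed, is needed when α = r.
exponent-bound : ∀ r g e α θ pr → 3 ≤ r → 2 * g ≡ r * (r + 3) → e ≤ g → e ≤ 1 + 2 * α + pr →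
  2 * pr + θ ≡ θ * θ → α ≤ θ → θ ≤ r → 1 ≤ θ → 2 * e ≤ (r + 1) * θ + 2 * α
exponent-bound r g e α θ pr 3≤r 2g e≤g e≤ prs α≤θ θ≤r 1≤θ with m≤n⇒m<n∨m≡n θ≤r
... | inj₁ θ<r = +-cancelʳ-≤ θ _ _ (begin
  2 * e + θ                      ≤⟨ +-monoˡ-≤ θ (*-monoʳ-≤ 2 e≤) ⟩
  2 * (1 + 2 * α + pr) + θ       ≡⟨ e₁ α pr θ ⟩
  2 + 2 * α + 2 * α + (2 * pr + θ) ≡⟨ cong (2 + 2 * α + 2 * α +_) prs ⟩
  2 + 2 * α + 2 * α + θ * θ      ≤⟨ +-monoˡ-≤ (θ * θ) (+-monoˡ-≤ (2 * α) (+-monoʳ-≤ 2 (*-monoʳ-≤ 2 α≤θ))) ⟩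
  2 + 2 * θ + 2 * α + θ * θ      ≡⟨ e₂ α θ ⟩
  2 + θ * θ + (2 * θ + 2 * α)    ≤⟨ +-monoˡ-≤ (2 * θ + 2 * α) key ⟩
  r * θ + (2 * θ + 2 * α)        ≡⟨ e₃ r α θ ⟩
  (r + 1) * θ + 2 * α + θ ∎)
  where
  open ≤-Reasoning
  e₁ : ∀ α pr θ → 2 * (1 + 2 * α + pr) + θ ≡ 2 + 2 * α + 2 * α + (2 * pr + θ)
  e₁ = solve-∀
  e₂ : ∀ α θ → 2 + 2 * θ + 2 * α + θ * θ ≡ 2 + θ * θ + (2 * θ + 2 * α)
  e₂ = solve-∀
  e₃ : ∀ r α θ → r * θ + (2 * θ + 2 * α) ≡ (r + 1) * θ + 2 * α + θ
  e₃ = solve-∀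
  -- This is θ(r - θ) ≥ 2. For θ ≥ 2 it follows from θ < r, while θ = 1 requires r ≥ 3, that is s ≥
  -- 5.
  two : ∀ θ → 1 ≤ θ → 3 ≤ r → suc θ ≤ r → 2 + θ * θ ≤ r * θ
  two (suc zero)    _ h _ = ≤-trans h (≤-reflexive (sym (*-identityʳ r)))
  two (suc (suc θ)) _ _ h = ≤-trans (≤-trans (+-monoˡ-≤ ((2 + θ) * (2 + θ)) (m≤m+n 2 θ)) ≤-refl) (*-monoˡ-≤ (2 + θ) h)
  key : 2 + θ * θ ≤ r * θ
  key = two θ 1≤θ 3≤r θ<r
... | inj₂ refl with m≤n⇒m<n∨m≡n α≤θ
...   | inj₂ refl = ≤-trans (*-monoʳ-≤ 2 e≤g) (≤-reflexive (trans 2g (e₁ r)))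
  where
  e₁ : ∀ r → r * (r + 3) ≡ (r + 1) * r + 2 * r
  e₁ = solve-∀
...   | inj₁ α<r = +-cancelʳ-≤ r _ _ (begin
  2 * e + r                      ≤⟨ +-monoˡ-≤ r (*-monoʳ-≤ 2 e≤) ⟩
  2 * (1 + 2 * α + pr) + r       ≡⟨ e₁ α pr r ⟩
  2 * suc α + 2 * α + (2 * pr + r) ≡⟨ cong (2 * suc α + 2 * α +_) prs ⟩
  2 * suc α + 2 * α + r * r      ≤⟨ +-monoˡ-≤ (r * r) (+-monoˡ-≤ (2 * α) (*-monoʳ-≤ 2 α<r)) ⟩
  2 * r + 2 * α + r * r          ≡⟨ e₂ r α ⟩
  (r + 1) * r + 2 * α + r ∎)
  where
  open ≤-Reasoning
  e₁ : ∀ α pr θ → 2 * (1 + 2 * α + pr) + θ ≡ 2 * suc α + 2 * α + (2 * pr + θ)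
  e₁ = solve-∀
  e₂ : ∀ r α → 2 * r + 2 * α + r * r ≡ (r + 1) * r + 2 * α + r
  e₂ = solve-∀

∑-allLists-product : ∀ {A : Set} (f : A → ℕ) k xs →
  ∑ (allLists k xs) (λ l → ∏ (map f l)) ≡ ∑ xs f ^ k
∑-allLists-product f zero xs = refl
∑-allLists-product f (suc k) xs = trans (∑-allLists-suc k xs _)
  (trans (∑-cong xs (λ x → trans (∑-*ˡ (allLists k xs) (f x) _) (cong (f x *_) (∑-allLists-product f k xs))))
         (∑-*ʳ xs (∑ xs f ^ k) f))

∏-pow : ∀ {A : Set} x (f : A → ℕ) l → ∏ (map (λ a → x ^ f a) l) ≡ x ^ total (map f l)
∏-pow x f []      = refl
∏-pow x f (a ∷ l) = trans (cong (x ^ f a *_) (∏-pow x f l)) (sym (^-distribˡ-+-* x (f a) _))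

module _ {n : ℕ} where
  opaque
    memᵇ : Fin n → List (Fin n) → Bool
    memᵇ x xs = does (mem? _≟_ x xs)

    memᵇ-true : ∀ {x xs} → memᵇ x xs ≡ true → x ∈ xs
    memᵇ-true = dec-true (mem? _≟_ _ _)

    memᵇ-intro : ∀ {x xs} → x ∈ xs → memᵇ x xs ≡ true
    memᵇ-intro = true-dec (mem? _≟_ _ _)

    memᵇ-false : ∀ {x xs} → memᵇ x xs ≡ false → x ∉ xs
    memᵇ-false = dec-false (mem? _≟_ _ _)

  memᵇ-count : ∀ L → count (λ p → memᵇ p L) (allFin n) ≤ length L
  memᵇ-count L = subst (_≤ length L) (length-keep _ (allFin n))
    (unique-length (AllPairs-keep _ (Uniq.allFin⁺ n)) (λ m → memᵇ-true (proj₂ (∈-keep _ (allFin n) m))))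

memᵇ-load : ∀ {n m Λ} (f : Fin n → Fin m) → Load f Λ → ∀ L → count (λ v → memᵇ (f v) L) (allFin n) ≤ length L * Λ
memᵇ-load {n} f load L = subst (_≤ _) (length-keep _ (allFin n))
  (load-cover _≟_ f load _ L (AllPairs-keep _ (Uniq.allFin⁺ n)) (λ m → memᵇ-true (proj₂ (∈-keep _ (allFin n) m))))

-- Copies through a pair and their conditional expected number

module Copies {n m : ℕ} (c : ℕ) (P B : Fin n → Fin m) where

  E : Set
  E = Fin m × Fin m

  _≟E_ : DecidableEquality E
  _≟E_ = ≡-dec _≟_ _≟_

  -- A copy x₁ < w < x < x₄ < ... < x_s through the pair w, x is stored as the part of x₁, the vertices
  -- x₄, ..., x_{s-1} and the block of x_s.
  Copy : Set
  Copy = Fin m × List (Fin n) × Fin m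

  opaque
    copies : List Copy
    copies = concatMap (λ p → concatMap (λ vs → map (λ b → p , vs , b) (allFin m)) (allLists c (allFin n))) (allFin m)

    ∑-copies : ∀ (f : Copy → ℕ) →
      ∑ copies f ≡ ∑ (allFin m) (λ p → ∑ (allLists c (allFin n)) (λ vs → ∑ (allFin m) (λ b → f (p , vs , b))))
    ∑-copies f = trans (∑-concatMap _ (allFin m) f) (∑-cong (allFin m) (λ p →
      trans (∑-concatMap _ (allLists c (allFin n)) f) (∑-cong (allLists c (allFin n)) (λ vs → ∑-map _ (allFin m) f))))

    copies-length : ∀ {τ} → τ ∈ copies → length (proj₁ (proj₂ τ)) ≡ c
    copies-length τ∈ with ∈-concatMap⁻′ _ (allFin m) τ∈
    ... | p , _ , m₁ with ∈-concatMap⁻′ _ (allLists c (allFin n)) m₁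
    ...   | vs , vs∈ , m₂ with ∈-map⁻ (λ b → p , vs , b) m₂
    ...     | _ , _ , refl = proj₁ (∈-allLists-length c (allFin n) vs∈)

    ∈-copies : ∀ p vs b → length vs ≡ c → (p , vs , b) ∈ copies
    ∈-copies p vs b refl = ∈-concatMap⁺′ (∈allFin p) (∈-concatMap⁺′ (∈-allLists vs (λ {v} _ → ∈allFin v))
      (∈-map⁺ (λ b → p , vs , b) (∈allFin b)))

  partsOf blocksOf : Fin n → Fin n → Copy → List (Fin m)
  partsOf  w x (p , vs , b) = p ∷ P w ∷ P x ∷ map P vs
  blocksOf w x (p , vs , b) = B w ∷ B x ∷ (map B vs ++ b ∷ [])

  opaque
    edges : Fin n → Fin n → Copy → List E
    edges w x τ = stair (partsOf w x τ) (blocksOf w x τ)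

    edges-stair : ∀ w x τ → edges w x τ ≡ stair (partsOf w x τ) (blocksOf w x τ)
    edges-stair w x τ = refl

    valid : Fin n → Fin n → Copy → Bool
    valid w x τ = does (distinct? _≟_ (partsOf w x τ)) ∧ does (distinct? _≟_ (blocksOf w x τ))

    valid-parts : ∀ {w x τ} → valid w x τ ≡ true → Unique (partsOf w x τ)
    valid-parts {w} {x} {τ} v = dec-true (distinct? _≟_ (partsOf w x τ)) (∧-elim₁ v)

    valid-blocks : ∀ {w x τ} → valid w x τ ≡ true → Unique (blocksOf w x τ)
    valid-blocks {w} {x} {τ} v = dec-true (distinct? _≟_ (blocksOf w x τ)) (∧-elim₂ {does (distinct? _≟_ (partsOf w x τ))} v)

    valid-intro : ∀ {w x τ} → Unique (partsOf w x τ) → Unique (blocksOf w x τ) → valid w x τ ≡ true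
    valid-intro {w} {x} {τ} uP uB = ∧-intro (true-dec (distinct? _≟_ (partsOf w x τ)) uP) (true-dec (distinct? _≟_ (blocksOf w x τ)) uB)

    ∈ᵇ : List E → E → Bool
    ∈ᵇ F e = does (mem? _≟E_ e F)

    ∈ᵇ-true : ∀ {F e} → ∈ᵇ F e ≡ true → e ∈ F
    ∈ᵇ-true = dec-true (mem? _≟E_ _ _)

    ∈ᵇ-intro : ∀ {F e} → e ∈ F → ∈ᵇ F e ≡ true
    ∈ᵇ-intro = true-dec (mem? _≟E_ _ _)

    ∈ᵇ-false : ∀ {F e} → ∈ᵇ F e ≡ false → e ∉ F
    ∈ᵇ-false = dec-false (mem? _≟E_ _ _)

  -- In terms of s, r = s - 2 and h = C(s,2).
  r h : ℕ
  r = 2 + c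
  h = tri (1 + r)

  nbrsOfBlock nbrsOfPart : List E → Fin m → List (Fin m)
  nbrsOfBlock F b = map proj₁ (keep (λ e → does (proj₂ e ≟ b)) F)
  nbrsOfPart  F p = map proj₂ (keep (λ e → does (proj₁ e ≟ p)) F)

  ∈-nbrsOfBlock : ∀ {F p b} → (p , b) ∈ F → p ∈ nbrsOfBlock F b
  ∈-nbrsOfBlock {b = b} e∈ = ∈-map⁺ proj₁ (keep-∈ _ e∈ (true-dec (b ≟ b) refl))

  ∈-nbrsOfPart : ∀ {F p b} → (p , b) ∈ F → b ∈ nbrsOfPart F p
  ∈-nbrsOfPart {p = p} e∈ = ∈-map⁺ proj₂ (keep-∈ _ e∈ (true-dec (p ≟ p) refl))

  -- Here q = y². Given that `F` is on, a copy with e revealed edges is on with probability q^(e -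
  -- h), so the goal is a bound on the sum of q^e over copies. The weights below are half-integral
  -- powers of q, which is why q is taken to be a square.
  module Spread {Λ : ℕ} (loadP : Load P Λ) (loadB : Load B Λ) (w x : Fin n) (F : List E) (D f y Ψ : ℕ)
    (y≥1 : 1 ≤ y) (c≥1 : 1 ≤ c) (len : length F ≤ f)
    (dw₁ : length (nbrsOfBlock F (B w)) ≤ D) (dx₁ : length (nbrsOfBlock F (B x)) ≤ D)
    (dw₂ : length (nbrsOfPart F (P w)) ≤ D) (dx₂ : length (nbrsOfPart F (P x)) ≤ D)
    (Ψ-end : 2 * D * y ^ (r + 3) + f * y ^ (r + 1) + m ≤ Ψ * y ^ (r + 3))
    (Ψ-mid : 2 * D * Λ * y ^ (r + 3) + 2 * f * Λ * y ^ (r + 1) + n ≤ Ψ * y ^ (r + 3))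
    (main : 4 * (m * n ^ c * m) ≤ y ^ (r * (r + 3)))
    (rest : 4 * Ψ ^ r ≤ y * y)
    where

    φ : E → Bool
    φ e = ∈ᵇ F e

    φ# : E → ℕ
    φ# e = ⟦ φ e ⟧

    revealed : Copy → ℕ
    revealed τ = count φ (edges w x τ)

    partAttached partTouched blockAttached blockTouched : Fin m → Bool
    partAttached  p = memᵇ p (nbrsOfBlock F (B w) ++ nbrsOfBlock F (B x))
    blockAttached b = memᵇ b (nbrsOfPart F (P w) ++ nbrsOfPart F (P x))
    partTouched   p = memᵇ p (map proj₁ F)
    blockTouched  b = memᵇ b (map proj₂ F)

    -- A middle vertex of a copy comes after `w` and `x`, so it is joined to them only through its
    -- block; with the other free vertices it can also use its part.
    attached touched : Fin n → Bool
    attached v = blockAttached (B v)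
    touched  v = partTouched (P v) ∨ blockTouched (B v)

    φ-∈ : ∀ {p b} → φ (p , b) ≡ true → (p , b) ∈ F
    φ-∈ = ∈ᵇ-true

    φ-partTouched : ∀ {p b} → φ (p , b) ≡ true → partTouched p ≡ true
    φ-partTouched e = memᵇ-intro (∈-map⁺ proj₁ (φ-∈ e))

    φ-blockTouched : ∀ {p b} → φ (p , b) ≡ true → blockTouched b ≡ true
    φ-blockTouched e = memᵇ-intro (∈-map⁺ proj₂ (φ-∈ e))

    φ≤ : ∀ {p b s t} → (φ (p , b) ≡ true → s ≡ true) → (φ (p , b) ≡ true → t ≡ true) → ⟦ φ (p , b) ⟧ ≤ ⟦ s ⟧ * ⟦ t ⟧
    φ≤ {p} {b} {s} {t} hs ht = ≤-trans (⟦⟧-mono {φ (p , b)} {s ∧ t} (λ e → ∧-intro (hs e) (ht e))) (≤-reflexive (⟦∧⟧ s t))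

    row : Fin m → List (Fin m) → ℕ
    row p bs = count (λ b → φ (p , b)) bs

    count-row : ∀ p bs → count φ (map (p ,_) bs) ≡ row p bs
    count-row p bs = ∑-map (p ,_) bs (λ e → ⟦ φ e ⟧)

    row-bound : ∀ p s (g : Fin m → Bool) (g′ : Fin n → Bool) vs b →
      (∀ v → ⟦ φ (p , B v) ⟧ ≤ s * ⟦ g′ v ⟧) → ⟦ φ (p , b) ⟧ ≤ s * ⟦ g b ⟧ →
      row p (map B vs ++ b ∷ []) ≤ s * total (map (λ v → ⟦ g′ v ⟧) vs ++ ⟦ g b ⟧ ∷ [])
    row-bound p s g g′ [] b hv hb = ≤-trans (≤-reflexive (+-identityʳ _)) (≤-trans hb (≤-reflexive (cong (s *_) (sym (+-identityʳ _)))))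
    row-bound p s g g′ (v ∷ vs) b hv hb = ≤-trans (+-mono-≤ (hv v) (row-bound p s g g′ vs b hv hb))
      (≤-reflexive (sym (*-distribˡ-+ s ⟦ g′ v ⟧ _)))

    touches : List (Fin n) → Fin m → List ℕ
    touches vs b = map (λ v → ⟦ touched v ⟧) vs ++ ⟦ blockTouched b ⟧ ∷ []

    attaches : List (Fin n) → Fin m → List ℕ
    attaches vs b = map (λ v → ⟦ attached v ⟧) vs ++ ⟦ blockAttached b ⟧ ∷ []

    inner : ∀ p vs b → count φ (stair (p ∷ map P vs) (map B vs ++ b ∷ [])) ≤ row p (map B vs ++ b ∷ []) + pairs (touches vs b)
    inner p [] b = m≤m+n _ _
    inner p (v ∷ vs) b = begin
      count φ (map (p ,_) bs ++ stair (P v ∷ map P vs) bs′)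
        ≡⟨ ∑-++ (map (p ,_) bs) (stair (P v ∷ map P vs) bs′) φ# ⟩
      count φ (map (p ,_) bs) + count φ (stair (P v ∷ map P vs) bs′)
        ≤⟨ +-mono-≤ (≤-reflexive (count-row p bs)) (inner (P v) vs b) ⟩
      row p bs + (row (P v) bs′ + pairs (touches vs b))
        ≤⟨ +-monoʳ-≤ (row p bs) (+-monoˡ-≤ (pairs (touches vs b))
             (row-bound (P v) ⟦ touched v ⟧ blockTouched touched vs b
               (λ v′ → φ≤ {t = touched v′} (λ e → ∨-intro₁ (φ-partTouched e)) (λ e → ∨-intro₂ (φ-blockTouched e)))
               (φ≤ {t = blockTouched b} (λ e → ∨-intro₁ (φ-partTouched e)) φ-blockTouched))) ⟩
      row p bs + (⟦ touched v ⟧ * total (touches vs b) + pairs (touches vs b)) ∎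
      where
      open ≤-Reasoning
      bs′ = map B vs ++ b ∷ []
      bs  = B v ∷ bs′

    -- One edge joins `w` to `x`, an attached vertex has at most two edges to them, and any other
    -- revealed edge joins two touched vertices.
    revealed-bound : ∀ p vs b → revealed (p , vs , b) ≤
      1 + 2 * (⟦ partAttached p ⟧ + total (attaches vs b)) + pairs (⟦ partTouched p ⟧ ∷ touches vs b)
    revealed-bound p vs b = begin
      count φ (edges w x (p , vs , b))
        ≡⟨ cong (count φ) (edges-stair w x (p , vs , b)) ⟩
      count φ (map (p ,_) (B w ∷ B x ∷ bs) ++ (map (P w ,_) (B x ∷ bs) ++ stair (P x ∷ map P vs) bs))
        ≡⟨ trans (∑-++ (map (p ,_) (B w ∷ B x ∷ bs)) (map (P w ,_) (B x ∷ bs) ++ stair (P x ∷ map P vs) bs) φ#) (cong₂ _+_ (count-row p (B w ∷ B x ∷ bs))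
             (trans (∑-++ (map (P w ,_) (B x ∷ bs)) (stair (P x ∷ map P vs) bs) φ#) (cong (_+ count φ (stair (P x ∷ map P vs) bs)) (count-row (P w) (B x ∷ bs))))) ⟩
      (⟦ φ (p , B w) ⟧ + (⟦ φ (p , B x) ⟧ + row p bs)) + ((⟦ φ (P w , B x) ⟧ + row (P w) bs) + count φ (stair (P x ∷ map P vs) bs))
        ≤⟨ +-mono-≤ (+-mono-≤ (root₁ w (λ e → ∈-++⁺ˡ (∈-nbrsOfBlock e))) (+-mono-≤ (root₁ x (λ e → ∈-++⁺ʳ (nbrsOfBlock F (B w)) (∈-nbrsOfBlock e)))
               (row-bound p ⟦ partTouched p ⟧ blockTouched touched vs b
                 (λ v′ → φ≤ {t = touched v′} φ-partTouched (λ e → ∨-intro₂ (φ-blockTouched e)))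
                 (φ≤ {t = blockTouched b} φ-partTouched φ-blockTouched))))
             (+-mono-≤ (+-mono-≤ (⟦⟧≤1 (φ (P w , B x))) (rootRow w (λ e → ∈-++⁺ˡ (∈-nbrsOfPart e))))
               (≤-trans (inner (P x) vs b) (+-monoˡ-≤ (pairs (touches vs b)) (rootRow x (λ e → ∈-++⁺ʳ (nbrsOfPart F (P w)) (∈-nbrsOfPart e)))))) ⟩
      (⟦ partAttached p ⟧ + (⟦ partAttached p ⟧ + ⟦ partTouched p ⟧ * total (touches vs b)))
        + ((1 + 1 * total (attaches vs b)) + (1 * total (attaches vs b) + pairs (touches vs b)))
        ≡⟨ e ⟦ partAttached p ⟧ (⟦ partTouched p ⟧ * total (touches vs b)) (total (attaches vs b)) (pairs (touches vs b)) ⟩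
      1 + 2 * (⟦ partAttached p ⟧ + total (attaches vs b)) + (⟦ partTouched p ⟧ * total (touches vs b) + pairs (touches vs b)) ∎
      where
      open ≤-Reasoning
      bs = map B vs ++ b ∷ []
      e : ∀ a t α pr → (a + (a + t)) + ((1 + 1 * α) + (1 * α + pr)) ≡ 1 + 2 * (a + α) + (t + pr)
      e = solve-∀
      root₁ : ∀ u → ((p , B u) ∈ F → p ∈ nbrsOfBlock F (B w) ++ nbrsOfBlock F (B x)) → ⟦ φ (p , B u) ⟧ ≤ ⟦ partAttached p ⟧
      root₁ u i = ⟦⟧-mono {φ (p , B u)} (λ e → memᵇ-intro (i (φ-∈ e)))
      rootRow : ∀ u → (∀ {b} → (P u , b) ∈ F → b ∈ nbrsOfPart F (P w) ++ nbrsOfPart F (P x)) →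
        row (P u) bs ≤ 1 * total (attaches vs b)
      rootRow u i = row-bound (P u) 1 blockAttached attached vs b
        (λ v → ≤-trans (at (B v)) (≤-reflexive (sym (*-identityˡ _)))) (≤-trans (at b) (≤-reflexive (sym (*-identityˡ _))))
        where
        at : ∀ b → ⟦ φ (P u , b) ⟧ ≤ ⟦ blockAttached b ⟧
        at b = ⟦⟧-mono {φ (P u , b)} (λ e → memᵇ-intro (i (φ-∈ e)))

    partAttached⇒Touched : ∀ p → partAttached p ≡ true → partTouched p ≡ true
    partAttached⇒Touched p e with ∈-++⁻ (nbrsOfBlock F (B w)) (memᵇ-true e)
    ... | inj₁ m with ∈-map⁻ proj₁ m
    ...   | _ , e∈ , refl = memᵇ-intro (∈-map⁺ proj₁ (proj₁ (∈-keep _ F e∈)))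
    partAttached⇒Touched p e | inj₂ m with ∈-map⁻ proj₁ m
    ...   | _ , e∈ , refl = memᵇ-intro (∈-map⁺ proj₁ (proj₁ (∈-keep _ F e∈)))

    blockAttached⇒Touched : ∀ b → blockAttached b ≡ true → blockTouched b ≡ true
    blockAttached⇒Touched b e with ∈-++⁻ (nbrsOfPart F (P w)) (memᵇ-true e)
    ... | inj₁ m with ∈-map⁻ proj₂ m
    ...   | _ , e∈ , refl = memᵇ-intro (∈-map⁺ proj₂ (proj₁ (∈-keep _ F e∈)))
    blockAttached⇒Touched b e | inj₂ m with ∈-map⁻ proj₂ m
    ...   | _ , e∈ , refl = memᵇ-intro (∈-map⁺ proj₂ (proj₁ (∈-keep _ F e∈)))

    attached⇒touched : ∀ v → attached v ≡ true → touched v ≡ true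
    attached⇒touched v e = ∨-intro₂ (blockAttached⇒Touched (B v) e)

    attaches≤touches : ∀ vs b → total (attaches vs b) ≤ total (touches vs b)
    attaches≤touches []       b = +-monoˡ-≤ 0 (⟦⟧-mono {blockAttached b} (blockAttached⇒Touched b))
    attaches≤touches (v ∷ vs) b = +-mono-≤ (⟦⟧-mono {attached v} (attached⇒touched v)) (attaches≤touches vs b)

    touches-small : ∀ vs b → All Small (touches vs b)
    touches-small []       b = ⟦⟧≤1 (blockTouched b) ∷ []
    touches-small (v ∷ vs) b = ⟦⟧≤1 (touched v) ∷ touches-small vs b

    length-touches : ∀ vs b → length (touches vs b) ≡ length vs + 1
    length-touches []       b = refl
    length-touches (v ∷ vs) b = cong suc (length-touches vs b)

    -- The share of one free vertex in the bound (r + 1)θ + 2α for twice the number of revealed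
    -- edges. Since the shares add up, the sum over copies becomes a product of sums over single
    -- vertices.
    weight : Bool → Bool → ℕ
    weight a t = (r + 1) * ⟦ t ⟧ + 2 * ⟦ a ⟧

    wPart wBlock : Fin m → ℕ
    wPart  p = weight (partAttached p) (partTouched p)
    wBlock b = weight (blockAttached b) (blockTouched b)

    wVertex : Fin n → ℕ
    wVertex v = weight (attached v) (touched v)

    total-weight : ∀ vs b → total (map wVertex vs) + wBlock b ≡ (r + 1) * total (touches vs b) + 2 * total (attaches vs b)
    total-weight [] b = e (r + 1) ⟦ blockTouched b ⟧ ⟦ blockAttached b ⟧
      where
      e : ∀ r t a → r * t + 2 * a ≡ r * (t + 0) + 2 * (a + 0)
      e = solve-∀
    total-weight (v ∷ vs) b = trans (+-assoc (wVertex v) (total (map wVertex vs)) (wBlock b))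
      (trans (cong (wVertex v +_) (total-weight vs b)) (e (r + 1) ⟦ touched v ⟧ ⟦ attached v ⟧ (total (touches vs b)) (total (attaches vs b))))
      where
      e : ∀ r t a T A → r * t + 2 * a + (r * T + 2 * A) ≡ r * (t + T) + 2 * (a + A)
      e = solve-∀

    3≤r : 3 ≤ r
    3≤r = s≤s (s≤s c≥1)

    -- The summand y * y takes care of copies without touched vertices, where at most the edge from
    -- `w` to `x` itself is revealed; the product of weights takes care of all others.
    copy-bound : ∀ p vs b → length vs ≡ c → suc (revealed (p , vs , b)) ≤ h →
      (y * y) ^ revealed (p , vs , b) ≤ y * y + y ^ wPart p * (∏ (map (λ v → y ^ wVertex v) vs) * y ^ wBlock b)
    copy-bound p vs b lv e<h with total (⟦ partTouched p ⟧ ∷ touches vs b) in θ-eq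
    ... | zero = ≤-trans (≤-trans (^-monoʳ-≤ (y * y) {{yy}} e≤1) (≤-reflexive (*-identityʳ (y * y)))) (m≤m+n _ _)
      where
      yy : NonZero (y * y)
      yy = >-nonZero (*-mono-≤ y≥1 y≥1)
      small : All Small (⟦ partTouched p ⟧ ∷ touches vs b)
      small = ⟦⟧≤1 (partTouched p) ∷ touches-small vs b
      pr0 : pairs (⟦ partTouched p ⟧ ∷ touches vs b) ≡ 0
      pr0 = m+n≡0⇒m≡0 _ (m+n≡0⇒m≡0 (2 * pairs (⟦ partTouched p ⟧ ∷ touches vs b))
        (trans (2pairs _ small) (cong₂ _*_ θ-eq θ-eq)))
      α0 : ⟦ partAttached p ⟧ + total (attaches vs b) ≡ 0
      α0 = n≤0⇒n≡0 (≤-trans (+-mono-≤ (⟦⟧-mono {partAttached p} (partAttached⇒Touched p)) (attaches≤touches vs b)) (≤-reflexive θ-eq))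
      e≤1 : revealed (p , vs , b) ≤ 1
      e≤1 = ≤-trans (revealed-bound p vs b) (≤-reflexive (cong₂ (λ α pr → 1 + 2 * α + pr) α0 pr0))
    ... | suc θ′ = begin
      (y * y) ^ revealed (p , vs , b)
        ≡⟨ trans (cong (_^ revealed (p , vs , b)) (cong (y *_) (sym (*-identityʳ y)))) (^-*-assoc y 2 (revealed (p , vs , b))) ⟩
      y ^ (2 * revealed (p , vs , b))
        ≤⟨ ^-monoʳ-≤ y {{>-nonZero y≥1}} exps ⟩
      y ^ (wPart p + (total (map wVertex vs) + wBlock b))
        ≡⟨ trans (^-distribˡ-+-* y (wPart p) _) (cong (y ^ wPart p *_) (trans (^-distribˡ-+-* y (total (map wVertex vs)) (wBlock b))
             (cong (_* y ^ wBlock b) (sym (∏-pow y wVertex vs))))) ⟩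
      y ^ wPart p * (∏ (map (λ v → y ^ wVertex v) vs) * y ^ wBlock b)
        ≤⟨ m≤n+m _ (y * y) ⟩
      y * y + y ^ wPart p * (∏ (map (λ v → y ^ wVertex v) vs) * y ^ wBlock b) ∎
      where
      open ≤-Reasoning
      θ = total (⟦ partTouched p ⟧ ∷ touches vs b)
      α = ⟦ partAttached p ⟧ + total (attaches vs b)
      small : All Small (⟦ partTouched p ⟧ ∷ touches vs b)
      small = ⟦⟧≤1 (partTouched p) ∷ touches-small vs b
      g = r + tri r
      2g : 2 * g ≡ r * (r + 3)
      2g = trans (*-distribˡ-+ 2 r (tri r)) (trans (cong (2 * r +_) (2tri r)) (e r))
        where
        e : ∀ r → 2 * r + r * suc r ≡ r * (r + 3)
        e = solve-∀
      lenθ : length (⟦ partTouched p ⟧ ∷ touches vs b) ≡ r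
      lenθ = trans (cong suc (trans (length-touches vs b) (cong (_+ 1) lv))) (cong suc (+-comm c 1))
      exps : 2 * revealed (p , vs , b) ≤ wPart p + (total (map wVertex vs) + wBlock b)
      exps = ≤-trans (exponent-bound r g (revealed (p , vs , b)) α θ (pairs (⟦ partTouched p ⟧ ∷ touches vs b)) 3≤r 2g
                (≤-pred e<h) (revealed-bound p vs b) (2pairs _ small)
                (+-mono-≤ (⟦⟧-mono {partAttached p} (partAttached⇒Touched p)) (attaches≤touches vs b))
                (≤-trans (total≤length _ small) (≤-reflexive lenθ))
                (≤-trans (s≤s z≤n) (≤-reflexive (sym θ-eq))))
        (≤-reflexive (trans (e (r + 1) ⟦ partTouched p ⟧ (total (touches vs b)) ⟦ partAttached p ⟧ (total (attaches vs b)))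
          (cong (wPart p +_) (sym (total-weight vs b)))))
        where
        e : ∀ r t T a A → r * (t + T) + 2 * (a + A) ≡ r * t + 2 * a + (r * T + 2 * A)
        e = solve-∀

    weight-bound : ∀ a t → (a ≡ true → t ≡ true) → y ^ weight a t ≤ ⟦ a ⟧ * y ^ (r + 3) + ⟦ t ⟧ * y ^ (r + 1) + 1
    weight-bound true true _ = ≤-trans (≤-reflexive (trans (cong (y ^_) (e r)) (sym (*-identityˡ _)))) (≤-trans (m≤m+n _ _) (m≤m+n _ 1))
      where
      e : ∀ r → (r + 1) * 1 + 2 * 1 ≡ r + 3
      e = solve-∀
    weight-bound true false i = case i refl of λ ()
    weight-bound false true _ = ≤-trans (≤-reflexive (trans (cong (y ^_) (e r)) (sym (*-identityˡ _)))) (m≤m+n _ 1)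
      where
      e : ∀ r → (r + 1) * 1 + 0 ≡ r + 1
      e = solve-∀
    weight-bound false false _ = ≤-reflexive (cong (y ^_) (e r))
      where
      e : ∀ r → (r + 1) * 0 + 0 ≡ 0
      e = solve-∀

    sum-weights : ∀ {A : Set} (xs : List A) (a t : A → Bool) → (∀ v → a v ≡ true → t v ≡ true) →
      ∑ xs (λ v → y ^ weight (a v) (t v)) ≤ count a xs * y ^ (r + 3) + count t xs * y ^ (r + 1) + length xs
    sum-weights xs a t i = ≤-trans (∑-mono xs (λ v _ → weight-bound (a v) (t v) (i v)))
      (≤-reflexive (trans (∑-+ xs _ (λ _ → 1)) (cong₂ _+_ (trans (∑-+ xs _ _)
        (cong₂ _+_ (∑-*ʳ xs (y ^ (r + 3)) _) (∑-*ʳ xs (y ^ (r + 1)) _))) (∑1 xs))))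

    length-two : ∀ {A : Set} (xs ys : List A) → length xs ≤ D → length ys ≤ D → length (xs ++ ys) ≤ 2 * D
    length-two xs ys a b = ≤-trans (≤-reflexive (length-++ xs)) (≤-trans (+-mono-≤ a b) (≤-reflexive (cong (D +_) (sym (+-identityʳ D)))))

    -- At most 2D parts are attached and weigh y^(r+3), at most f are touched and weigh y^(r+1), the
    -- rest weigh 1. With f of order y² and m of order y^(r+3), up to logarithms, the three
    -- contributions balance.
    sum-parts : ∑ (allFin m) (λ p → y ^ wPart p) ≤ Ψ * y ^ (r + 3)
    sum-parts = ≤-trans (sum-weights (allFin m) partAttached partTouched partAttached⇒Touched) (≤-trans
      (+-mono-≤ (+-mono-≤ (*-monoˡ-≤ _ (≤-trans (memᵇ-count (nbrsOfBlock F (B w) ++ nbrsOfBlock F (B x))) (length-two (nbrsOfBlock F (B w)) (nbrsOfBlock F (B x)) dw₁ dx₁)))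
        (*-monoˡ-≤ _ (≤-trans (memᵇ-count (map proj₁ F)) (≤-trans (≤-reflexive (length-map proj₁ F)) len)))) (≤-reflexive (length-allFin m))) Ψ-end)

    sum-blocks : ∑ (allFin m) (λ b → y ^ wBlock b) ≤ Ψ * y ^ (r + 3)
    sum-blocks = ≤-trans (sum-weights (allFin m) blockAttached blockTouched blockAttached⇒Touched) (≤-trans
      (+-mono-≤ (+-mono-≤ (*-monoˡ-≤ _ (≤-trans (memᵇ-count (nbrsOfPart F (P w) ++ nbrsOfPart F (P x))) (length-two (nbrsOfPart F (P w)) (nbrsOfPart F (P x)) dw₂ dx₂)))
        (*-monoˡ-≤ _ (≤-trans (memᵇ-count (map proj₂ F)) (≤-trans (≤-reflexive (length-map proj₂ F)) len)))) (≤-reflexive (length-allFin m))) Ψ-end)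

    sum-vertices : ∑ (allFin n) (λ v → y ^ wVertex v) ≤ Ψ * y ^ (r + 3)
    sum-vertices = ≤-trans (sum-weights (allFin n) attached touched attached⇒touched) (≤-trans
      (+-mono-≤ (+-mono-≤ (*-monoˡ-≤ _ (≤-trans (memᵇ-load B loadB (nbrsOfPart F (P w) ++ nbrsOfPart F (P x))) (*-monoˡ-≤ Λ (length-two (nbrsOfPart F (P w)) (nbrsOfPart F (P x)) dw₂ dx₂))))
        (*-monoˡ-≤ _ touched-count)) (≤-reflexive (length-allFin n))) Ψ-mid)
      where
      touched-count : count touched (allFin n) ≤ 2 * f * Λ
      touched-count = begin
        count touched (allFin n)
          ≤⟨ ∑-mono (allFin n) (λ v _ → or (partTouched (P v)) (blockTouched (B v))) ⟩
        ∑ (allFin n) (λ v → ⟦ partTouched (P v) ⟧ + ⟦ blockTouched (B v) ⟧)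
          ≡⟨ ∑-+ (allFin n) _ _ ⟩
        count (partTouched ∘ P) (allFin n) + count (blockTouched ∘ B) (allFin n)
          ≤⟨ +-mono-≤ (≤-trans (memᵇ-load P loadP (map proj₁ F)) (*-monoˡ-≤ Λ (≤-trans (≤-reflexive (length-map proj₁ F)) len)))
                      (≤-trans (memᵇ-load B loadB (map proj₂ F)) (*-monoˡ-≤ Λ (≤-trans (≤-reflexive (length-map proj₂ F)) len))) ⟩
        f * Λ + f * Λ
          ≡⟨ e f Λ ⟩
        2 * f * Λ ∎
        where
        open ≤-Reasoning
        e : ∀ a b → a * b + a * b ≡ 2 * a * b
        e = solve-∀
        or : ∀ a b → ⟦ a ∨ b ⟧ ≤ ⟦ a ⟧ + ⟦ b ⟧
        or true  b = s≤s z≤n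
        or false b = ≤-refl

    -- The weighted sum factors over the r free coordinates into at most (Ψ y^(r+3))^r = Ψ^r q^g,
    -- which is at most q^h / 4 because 4Ψ^r ≤ q and h = g + 1. Untouched copies number m²n^c ≤ q^g
    -- / 4 and count q each, giving another q^h / 4.
    spread : (∀ τ → τ ∈ copies → valid w x τ ≡ true → suc (revealed τ) ≤ h) →
      2 * ∑ (keep (valid w x) copies) (λ τ → (y * y) ^ revealed τ) ≤ (y * y) ^ h
    spread notFull = begin
      2 * ∑ (keep (valid w x) copies) (λ τ → (y * y) ^ revealed τ)
        ≤⟨ *-monoʳ-≤ 2 (∑-mono _ (λ τ m → bound τ (∈-keep (valid w x) copies m))) ⟩
      2 * ∑ (keep (valid w x) copies) U
        ≤⟨ *-monoʳ-≤ 2 (∑-keep copies) ⟩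
      2 * ∑ copies U
        ≡⟨ cong (2 *_) (trans (∑-copies U) factor) ⟩
      2 * (m * (n ^ c * (m * (y * y))) + SP * (SV ^ c * SB))
        ≤⟨ *-monoʳ-≤ 2 (+-monoʳ-≤ (m * (n ^ c * (m * (y * y)))) (*-mono-≤ sum-parts (*-mono-≤ (^-monoˡ-≤ c sum-vertices) sum-blocks))) ⟩
      2 * (m * (n ^ c * (m * (y * y))) + Y * (Y ^ c * Y))
        ≤⟨ *-cancelˡ-≤ 2 (begin
          2 * (2 * (m * (n ^ c * (m * (y * y))) + Y * (Y ^ c * Y)))
            ≡⟨ e₁ m (n ^ c) (y * y) (Y * (Y ^ c * Y)) ⟩
          (y * y) * (4 * (m * n ^ c * m)) + 4 * (Y * (Y ^ c * Y))
            ≡⟨ cong (λ a → (y * y) * (4 * (m * n ^ c * m)) + 4 * a) Y^r ⟩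
          (y * y) * (4 * (m * n ^ c * m)) + 4 * (Ψ ^ r * y ^ (r * (r + 3)))
            ≤⟨ +-mono-≤ (*-monoʳ-≤ (y * y) main) (≤-trans (≤-reflexive (sym (*-assoc 4 (Ψ ^ r) _))) (*-monoˡ-≤ (y ^ (r * (r + 3))) rest)) ⟩
          (y * y) * y ^ (r * (r + 3)) + (y * y) * y ^ (r * (r + 3))
            ≡⟨ cong (λ a → a + a) top ⟩
          (y * y) ^ h + (y * y) ^ h
            ≡⟨ cong ((y * y) ^ h +_) (sym (+-identityʳ _)) ⟩
          2 * (y * y) ^ h ∎) ⟩
      (y * y) ^ h ∎
      where
      open ≤-Reasoning
      U : Copy → ℕ
      U (p , vs , b) = y * y + y ^ wPart p * (∏ (map (λ v → y ^ wVertex v) vs) * y ^ wBlock b)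
      SP = ∑ (allFin m) (λ p → y ^ wPart p)
      SV = ∑ (allFin n) (λ v → y ^ wVertex v)
      SB = ∑ (allFin m) (λ b → y ^ wBlock b)
      Y = Ψ * y ^ (r + 3)
      e₁ : ∀ m nc yy t → 2 * (2 * (m * (nc * (m * yy)) + t)) ≡ yy * (4 * (m * nc * m)) + 4 * t
      e₁ = solve-∀
      top : (y * y) * y ^ (r * (r + 3)) ≡ (y * y) ^ h
      top = trans (cong ((y * y) *_) (trans (cong (y ^_) rr) (trans (sym (^-*-assoc y 2 (r + tri r))) (cong (_^ (r + tri r)) (cong (y *_) (*-identityʳ y))))))
        refl
        where
        rr : r * (r + 3) ≡ 2 * (r + tri r)
        rr = sym (trans (*-distribˡ-+ 2 r (tri r)) (trans (cong (2 * r +_) (2tri r)) (e r)))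
          where
          e : ∀ r → 2 * r + r * suc r ≡ r * (r + 3)
          e = solve-∀
      Y^r : Y * (Y ^ c * Y) ≡ Ψ ^ r * y ^ (r * (r + 3))
      Y^r = trans (e Y (Y ^ c)) (trans (^-distribʳ-* r Ψ (y ^ (r + 3)))
        (cong (Ψ ^ r *_) (trans (^-*-assoc y (r + 3) r) (cong (y ^_) (*-comm (r + 3) r)))))
        where
        e : ∀ a b → a * (b * a) ≡ a * (a * b)
        e = solve-∀
      bound : ∀ τ → τ ∈ copies × valid w x τ ≡ true → (y * y) ^ revealed τ ≤ U τ
      bound τ@(p , vs , b) (τ∈ , v) = copy-bound p vs b (copies-length τ∈) (notFull τ τ∈ v)
      ∑-keep : ∀ ts → ∑ (keep (valid w x) ts) U ≤ ∑ ts U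
      ∑-keep [] = z≤n
      ∑-keep (τ ∷ ts) with valid w x τ
      ... | true  = +-monoʳ-≤ (U τ) (∑-keep ts)
      ... | false = ≤-trans (∑-keep ts) (m≤n+m _ (U τ))
      ∑-plus : ∀ {A : Set} (xs : List A) k c (f : A → ℕ) → length xs ≡ k → ∑ xs (λ x → c + f x) ≡ k * c + ∑ xs f
      ∑-plus xs k c f e = trans (∑-+ xs (λ _ → c) f) (cong (_+ ∑ xs f) (trans (∑-const xs c) (cong (_* c) e)))
      length-lists : length (allLists c (allFin n)) ≡ n ^ c
      length-lists = trans (length-allLists c (allFin n)) (cong (_^ c) (length-allFin n))
      factor : ∑ (allFin m) (λ p → ∑ (allLists c (allFin n)) (λ vs → ∑ (allFin m) (λ b → U (p , vs , b)))) ≡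
        m * (n ^ c * (m * (y * y))) + SP * (SV ^ c * SB)
      factor = trans (∑-cong (allFin m) (λ p → trans (∑-cong (allLists c (allFin n)) (λ vs →
            trans (∑-plus (allFin m) m (y * y) _ (length-allFin m)) (cong (m * (y * y) +_)
              (trans (∑-*ˡ (allFin m) (y ^ wPart p) _) (cong (y ^ wPart p *_) (∑-*ˡ (allFin m) (∏ (map (λ v → y ^ wVertex v) vs)) _))))))
          (trans (∑-plus (allLists c (allFin n)) (n ^ c) (m * (y * y)) _ length-lists)
            (cong (n ^ c * (m * (y * y)) +_) (trans (∑-*ˡ (allLists c (allFin n)) (y ^ wPart p) _)
              (cong (y ^ wPart p *_) (trans (∑-*ʳ (allLists c (allFin n)) SB _) (cong (_* SB) (∑-allLists-product _ c (allFin n)))))))) ))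
        (trans (∑-plus (allFin m) m (n ^ c * (m * (y * y))) _ (length-allFin m))
          (cong (m * (n ^ c * (m * (y * y))) +_) (∑-*ʳ (allFin m) (SV ^ c * SB) _)))

count-mono : ∀ {A : Set} {p p′ : A → Bool} xs → (∀ x → x ∈ xs → p x ≡ true → p′ x ≡ true) → count p xs ≤ count p′ xs
count-mono {p = p} xs i = ∑-mono xs (λ x m → ⟦⟧-mono {p x} (i x m))

count≤length : ∀ {A : Set} (p : A → Bool) xs → count p xs ≤ length xs
count≤length p xs = ≤-trans (∑-bound xs 1 (λ x _ → ⟦⟧≤1 (p x))) (≤-reflexive (*-identityʳ _))

count<length : ∀ {A : Set} (p : A → Bool) xs → all p xs ≡ false → suc (count p xs) ≤ length xs
count<length p (x ∷ xs) e with p x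
... | true  = s≤s (count<length p xs e)
... | false = s≤s (count≤length p xs)

all-mono : ∀ {A : Set} {p p′ : A → Bool} xs → (∀ {x} → p x ≡ true → p′ x ≡ true) → all p xs ≡ true → all p′ xs ≡ true
all-mono {p = p} {p′} xs i a = all-intro p′ xs (λ x m → i (all-elim p a m))

-- Deleted pairs, fans and completely revealed copies

module Graphs {n m : ℕ} (c K : ℕ) (P B : Fin n → Fin m) where

  open Copies c P B

  opaque
    -- The criterion for deletion: `w` and `x` are the second and third vertex of a copy present in
    -- `H`.
    closed : (E → Bool) → Fin n → Fin n → Bool
    closed H w x = any (λ τ → valid w x τ ∧ all H (edges w x τ)) copies

    closed-elim : ∀ {H w x} → closed H w x ≡ true → ∃ λ τ → τ ∈ copies × valid w x τ ≡ true × all H (edges w x τ) ≡ true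
    closed-elim {H} {w} {x} cl with any-elim (λ τ → valid w x τ ∧ all H (edges w x τ)) copies cl
    ... | τ , τ∈ , e = τ , τ∈ , ∧-elim₁ e , ∧-elim₂ {valid w x τ} e

    closed-intro : ∀ {H w x τ} → τ ∈ copies → valid w x τ ≡ true → all H (edges w x τ) ≡ true → closed H w x ≡ true
    closed-intro {H} {w} {x} τ∈ v a = any-intro (λ τ → valid w x τ ∧ all H (edges w x τ)) τ∈ (∧-intro v a)

  -- A part, r - 1 blocks, and K vertices joined to all of them.
  Fan : Set
  Fan = Fin m × List (Fin m) × List (Fin n)

  -- In a copy through `w` and `x`, these are the edges from `x` to the part of x₁ and to the r - 1
  -- blocks of x₄, ..., x_s.
  spokes : Fin m → List (Fin m) → Fin n → List E
  spokes p bs x = (p , B x) ∷ map (P x ,_) bs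

  fanEdges : Fan → List E
  fanEdges (p , bs , xs) = concatMap (spokes p bs) xs

  opaque
    fans : List Fan
    fans = concatMap (λ p → concatMap (λ bs → map (λ xs → p , bs , xs) (combos K (allFin n)))
                            (allLists (suc c) (allFin m))) (allFin m)

    ∈-fans : ∀ {p bs xs} → length bs ≡ suc c → xs ∈ combos K (allFin n) → (p , bs , xs) ∈ fans
    ∈-fans {p} {bs} {xs} lb xs∈ = ∈-concatMap⁺′ (∈allFin p)
      (∈-concatMap⁺′ (subst (λ k → bs ∈ allLists k (allFin m)) lb (∈-allLists bs (λ {b} _ → ∈allFin b)))
        (∈-map⁺ (λ xs → p , bs , xs) xs∈))

    fans-∈ : ∀ {p bs xs} → (p , bs , xs) ∈ fans → length bs ≡ suc c × xs ∈ combos K (allFin n)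
    fans-∈ Y∈ with ∈-concatMap⁻′ _ (allFin m) Y∈
    ... | p , _ , m₁ with ∈-concatMap⁻′ _ (allLists (suc c) (allFin m)) m₁
    ...   | bs , bs∈ , m₂ with ∈-map⁻ (λ xs → p , bs , xs) m₂
    ...     | xs , xs∈ , refl = proj₁ (∈-allLists-length (suc c) (allFin m) bs∈) , xs∈

    length-fans : length fans ≡ m * (m ^ suc c * length (combos K (allFin n)))
    length-fans = trans (sym (∑1 fans)) (trans (∑-concatMap _ (allFin m) (λ _ → 1))
      (trans (∑-cong (allFin m) (λ p → trans (∑-concatMap _ (allLists (suc c) (allFin m)) (λ _ → 1))
        (trans (∑-cong (allLists (suc c) (allFin m)) (λ bs → trans (∑1 (map (λ xs → p , bs , xs) (combos K (allFin n)))) (length-map _ (combos K (allFin n)))))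
          (trans (∑-const (allLists (suc c) (allFin m)) (length (combos K (allFin n))))
            (cong (_* length (combos K (allFin n))) (trans (length-allLists (suc c) (allFin m)) (cong (_^ suc c) (length-allFin m))))))))
        (trans (∑-const (allFin m) _) (cong (_* (m ^ suc c * length (combos K (allFin n)))) (length-allFin m)))))

    -- Ensures that the rK edges of the fan are distinct, hence all present with probability
    -- q^(-rK).
    properFan : Fan → Bool
    properFan (p , bs , xs) = does (distinct? _≟_ bs) ∧ (does (distinct? _≟_ (map P xs)) ∧
      (does (distinct? _≟_ (map B xs)) ∧ not (memᵇ p (map P xs))))

    properFan-intro : ∀ {p bs xs} → Unique bs → Unique (map P xs) → Unique (map B xs) → p ∉ map P xs → properFan (p , bs , xs) ≡ true
    properFan-intro {p} {bs} {xs} ub uP uB p∉ = ∧-intro (true-dec (distinct? _≟_ bs) ub) (∧-intro (true-dec (distinct? _≟_ (map P xs)) uP)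
      (∧-intro (true-dec (distinct? _≟_ (map B xs)) uB) (absent (memᵇ p (map P xs)) refl)))
      where
      absent : ∀ b → memᵇ p (map P xs) ≡ b → not b ≡ true
      absent false _ = refl
      absent true  e = ⊥-elim (p∉ (memᵇ-true e))

    properFan-elim : ∀ {p bs xs} → properFan (p , bs , xs) ≡ true → Unique bs × Unique (map P xs) × Unique (map B xs) × p ∉ map P xs
    properFan-elim {p} {bs} {xs} pr = dec-true (distinct? _≟_ bs) (∧-elim₁ {d₁} pr) ,
      dec-true (distinct? _≟_ (map P xs)) (∧-elim₁ {d₂} (∧-elim₂ {d₁} pr)) ,
      dec-true (distinct? _≟_ (map B xs)) (∧-elim₁ {d₃} (∧-elim₂ {d₂} (∧-elim₂ {d₁} pr))) ,
      memᵇ-false (not-true (∧-elim₂ {d₃} (∧-elim₂ {d₂} (∧-elim₂ {d₁} pr))))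
      where
      d₁ d₂ d₃ : Bool
      d₁ = does (distinct? _≟_ bs)
      d₂ = does (distinct? _≟_ (map P xs))
      d₃ = does (distinct? _≟_ (map B xs))

    nice : (E → Bool) → Bool
    nice H = not (any (λ Y → properFan Y ∧ all H (fanEdges Y)) fans)

    nice-def : ∀ H → nice H ≡ not (any (λ Y → properFan Y ∧ all H (fanEdges Y)) fans)
    nice-def H = refl

    nice-elim : ∀ {H Y} → nice H ≡ true → Y ∈ fans → properFan Y ≡ true → all H (fanEdges Y) ≡ true → ⊥
    nice-elim {H} ok Y∈ pr a = true≢false (any-intro (λ Y → properFan Y ∧ all H (fanEdges Y)) Y∈ (∧-intro pr a)) (not-true ok)

    nice-antitone : ∀ {H H′ : E → Bool} → (∀ {e} → H e ≡ true → H′ e ≡ true) → nice H′ ≡ true → nice H ≡ true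
    nice-antitone {H} {H′} i e with any (λ Y → properFan Y ∧ all H (fanEdges Y)) fans in eq
    ... | false = refl
    ... | true with any-elim (λ Y → properFan Y ∧ all H (fanEdges Y)) fans eq
    ...   | Y , Y∈ , pY = ⊥-elim (nice-elim {H′} e Y∈ (∧-elim₁ pY) (all-mono (fanEdges Y) i (∧-elim₂ {properFan Y} pY)))

  separated : Fin n → Fin n → Bool
  separated w x = not (does (P w ≟ P x)) ∧ not (does (B w ≟ B x))

  -- What nonadjacency of w < x in the final graph amounts to, freed from the order.
  missing : (E → Bool) → Fin n → Fin n → Bool
  missing H w x = not (separated w x) ∨ (not (H (P w , B x)) ∨ closed H w x)

  missingAll : List (Fin n) → List (Fin n) → (E → Bool) → Bool
  missingAll W X H = all (λ w → all (missing H w) X) W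

  module Light {Λ : ℕ} (loadP : Load P Λ) (loadB : Load B Λ) (Δ : ℕ) (F : List E) where

    light : Fin n → Bool
    light v = does (length (nbrsOfBlock F (B v)) ≤? Δ) ∧ does (length (nbrsOfPart F (P v)) ≤? Δ)

    degree-sum : ∀ {f : Fin n → Fin m} (g : E → Fin m) → Load f Λ → ∀ L → Unique L →
      ∑ L (λ v → count (λ e → does (g e ≟ f v)) F) ≤ Λ * length F
    degree-sum {f} g load L u = begin
      ∑ L (λ v → count (λ e → does (g e ≟ f v)) F)
        ≡⟨ ∑-swap L F (λ v e → ⟦ does (g e ≟ f v) ⟧) ⟩
      ∑ F (λ e → count (λ v → does (g e ≟ f v)) L)
        ≤⟨ ∑-bound F Λ (λ e _ → subst (_≤ Λ) (length-keep _ L)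
             (load (g e) (keep (λ v → does (g e ≟ f v)) L) (AllPairs-keep _ u)
               (λ m → sym (dec-true (g e ≟ f _) (proj₂ (∈-keep _ L m)))))) ⟩
      length F * Λ
        ≡⟨ *-comm (length F) Λ ⟩
      Λ * length F ∎
      where open ≤-Reasoning

    -- Double counting: an edge of `F` adds to the degrees of at most Λ vertices through its block
    -- and Λ through its part, while a heavy vertex has a degree above Δ.
    heavy-count : ∀ L → Unique L → count (not ∘ light) L * suc Δ ≤ 2 * Λ * length F
    heavy-count L u = begin
      count (not ∘ light) L * suc Δ
        ≡⟨ sym (∑-*ʳ L (suc Δ) _) ⟩
      ∑ L (λ v → ⟦ not (light v) ⟧ * suc Δ)
        ≤⟨ ∑-mono L (λ v _ → one v) ⟩
      ∑ L (λ v → count (λ e → does (proj₂ e ≟ B v)) F + count (λ e → does (proj₁ e ≟ P v)) F)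
        ≡⟨ ∑-+ L _ _ ⟩
      ∑ L (λ v → count (λ e → does (proj₂ e ≟ B v)) F) + ∑ L (λ v → count (λ e → does (proj₁ e ≟ P v)) F)
        ≤⟨ +-mono-≤ (degree-sum proj₂ loadB L u) (degree-sum proj₁ loadP L u) ⟩
      Λ * length F + Λ * length F
        ≡⟨ e Λ (length F) ⟩
      2 * Λ * length F ∎
      where
      open ≤-Reasoning
      e : ∀ a b → a * b + a * b ≡ 2 * a * b
      e = solve-∀
      big : ∀ k → does (k ≤? Δ) ≡ false → suc Δ ≤ k
      big k e = ≰⇒> (dec-false (k ≤? Δ) e)
      one : ∀ v → ⟦ not (light v) ⟧ * suc Δ ≤ count (λ e → does (proj₂ e ≟ B v)) F + count (λ e → does (proj₁ e ≟ P v)) F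
      one v with does (length (nbrsOfBlock F (B v)) ≤? Δ) in e₁ | does (length (nbrsOfPart F (P v)) ≤? Δ) in e₂
      ... | true  | true  = z≤n
      ... | true  | false = ≤-trans (≤-reflexive (+-identityʳ (suc Δ))) (≤-trans (big _ e₂)
              (≤-trans (≤-reflexive (trans (length-map proj₂ (keep (λ e → does (proj₁ e ≟ P v)) F)) (length-keep _ F))) (m≤n+m _ _)))
      ... | false | b     = ≤-trans (≤-reflexive (+-identityʳ (suc Δ))) (≤-trans (big _ e₁)
              (≤-trans (≤-reflexive (trans (length-map proj₁ (keep (λ e → does (proj₂ e ≟ B v)) F)) (length-keep _ F))) (m≤m+n _ _)))

    full : Fin n → Fin n → Bool
    full w x = closed (∈ᵇ ((P w , B x) ∷ F)) w x

    inFan : Fin m × List (Fin m) → Fin n → Bool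
    inFan (p , bs) x = (does (distinct? _≟_ bs) ∧ not (does (p ≟ P x))) ∧ all (∈ᵇ F) (spokes p bs x)

    -- If the vertices counted meet fewer than K parts, there are at most KΛ of them. If they meet K
    -- parts, one from each forms a fan, the blocks being distinct because `B` is injective on `X`;
    -- but `F` contains no fan.
    fan-count : nice (∈ᵇ F) ≡ true → ∀ p bs → length bs ≡ suc c → does (distinct? _≟_ bs) ≡ true →
      ∀ X → Unique X → InjOn B X → count (inFan (p , bs)) X ≤ K * Λ
    fan-count ok p bs lb distinct-bs X u injB with K ≤? length R
      where
      R = reps _≟_ P (keep (inFan (p , bs)) X)
    ... | no lt = begin
      count (inFan (p , bs)) X
        ≡⟨ sym (length-keep _ X) ⟩
      length L
        ≤⟨ load-cover _≟_ P loadP L (map P R) (AllPairs-keep _ u) (reps-cover _≟_ P L) ⟩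
      length (map P R) * Λ
        ≤⟨ *-monoˡ-≤ Λ (≤-trans (≤-reflexive (length-map P R)) (<⇒≤ (≰⇒> lt))) ⟩
      K * Λ ∎
      where
      open ≤-Reasoning
      L = keep (inFan (p , bs)) X
      R = reps _≟_ P L
    ... | yes K≤ = ⊥-elim (nice-elim ok (∈-fans lb (proj₁ (proj₂ sel))) proper spokes-on)
      where
      L = keep (inFan (p , bs)) X
      R = reps _≟_ P L
      uR : Unique R
      uR = unique-of-map P (reps-unique _≟_ P L)
      -- `fans` uses only vertex lists in the order of `allFin n`, so K of the representatives are
      -- selected anew along that list.
      sel = combos-keep K (λ v → memᵇ v R) (allFin n) (≤-trans K≤ (≤-trans
        (unique-length uR (λ {v} v∈ → keep-∈ _ (∈allFin v) (memᵇ-intro v∈)))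
        (≤-reflexive (length-keep _ (allFin n)))))
      ys = proj₁ sel
      ys⊑R : ys ⊑ R
      ys⊑R m = memᵇ-true (proj₂ (proj₂ (proj₂ sel) m))
      ys-facts = combos-unique K (allFin n) (Uniq.allFin⁺ n) (proj₁ (proj₂ sel))
      inX : ∀ {v} → v ∈ ys → v ∈ X × inFan (p , bs) v ≡ true
      inX m = ∈-keep _ X (reps-⊑ _≟_ P L (ys⊑R m))
      p∉ : p ∉ map P ys
      p∉ m with ∈-map⁻ P m
      ... | v , v∈ , e = true≢false (true-dec (p ≟ P v) e) (not-true (∧-elim₂ {does (distinct? _≟_ bs)} (∧-elim₁ (proj₂ (inX v∈)))))
      proper : properFan (p , bs , ys) ≡ true
      proper = properFan-intro (dec-true (distinct? _≟_ bs) distinct-bs)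
        (unique-map P (proj₁ ys-facts) (λ a b → unique-map-inj P (reps-unique _≟_ P L) (ys⊑R a) (ys⊑R b)))
        (unique-map B (proj₁ ys-facts) (λ a b → injB (proj₁ (inX a)) (proj₁ (inX b)))) p∉
      spokes-on : all (∈ᵇ F) (fanEdges (p , bs , ys)) ≡ true
      spokes-on = all-intro (∈ᵇ F) (fanEdges (p , bs , ys)) (λ e e∈ → case ∈-concatMap⁻′ (spokes p bs) ys e∈ of λ
        { (v , v∈ , m) → all-elim (∈ᵇ F) (∧-elim₂ {does (distinct? _≟_ bs) ∧ not (does (p ≟ P v))} (proj₂ (inX v∈))) m })

    -- All edges of the completed copy except (P w, B x) lie in `F`. Those at `w` place `p` and `bs`
    -- among its neighbours; those at `x` are spokes of the fan they determine.
    fullness : ∀ w x → full w x ≡ true →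
      ∃ λ p → ∃ λ bs → p ∈ nbrsOfBlock F (B w) × bs ∈ allLists (suc c) (nbrsOfPart F (P w)) ×
        does (distinct? _≟_ bs) ≡ true × inFan (p , bs) x ≡ true
    fullness w x fl with closed-elim fl
    ... | τ@(p , vs , b) , τ∈ , vτ , eτ = p , bs , p∈ , bs∈ , distinct-bs , ∧-intro (∧-intro distinct-bs p≢) spokes-in
      where
      bs = map B vs ++ b ∷ []
      z  = (P w , B x)
      uP : Unique (partsOf w x τ)
      uP = valid-parts vτ
      uB : Unique (blocksOf w x τ)
      uB = valid-blocks vτ
      edge : ∀ {e} → e ∈ stair (partsOf w x τ) (blocksOf w x τ) → e ≢ z → e ∈ F
      edge e∈ ne with ∈ᵇ-true (all-elim (∈ᵇ (z ∷ F)) eτ (subst (_ ∈_) (sym (edges-stair w x τ)) e∈))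
      ... | here e≡z = ⊥-elim (ne e≡z)
      ... | there m = m
      lbs : length bs ≡ suc c
      lbs = trans (length-++ (map B vs)) (trans (cong (_+ 1) (trans (length-map B vs) (copies-length τ∈))) (+-comm c 1))
      head≢ : ∀ {A : Set} {a : A} {as} → Unique (a ∷ as) → ∀ {b} → b ∈ as → a ≢ b
      head≢ (q ∷ _) m refl = ∉-all q m
      uB′ : Unique (B x ∷ bs)
      uB′ = AllPairs.tail uB
      distinct-bs : does (distinct? _≟_ bs) ≡ true
      distinct-bs = true-dec (distinct? _≟_ bs) (AllPairs.tail uB′)
      p∈ : p ∈ nbrsOfBlock F (B w)
      p∈ = ∈-nbrsOfBlock (edge (here refl) (λ e → head≢ uB (here refl) (cong proj₂ e)))
      bs∈ : bs ∈ allLists (suc c) (nbrsOfPart F (P w))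
      bs∈ = subst (λ k → bs ∈ allLists k (nbrsOfPart F (P w))) lbs (∈-allLists bs (λ {b′} m →
        ∈-nbrsOfPart (edge (∈-++⁺ʳ (map (p ,_) (B w ∷ B x ∷ bs)) (there (∈-++⁺ˡ (∈-map⁺ (P w ,_) m))))
          (λ e → head≢ uB′ m (sym (cong proj₂ e))))))
      p≢ : not (does (p ≟ P x)) ≡ true
      p≢ with p ≟ P x
      ... | yes e = ⊥-elim (head≢ uP (there (here refl)) e)
      ... | no _  = refl
      inRow : ∀ {b′} → b′ ∈ bs → (P x , b′) ∈ stair (P x ∷ map P vs) bs
      inRow m = first bs m
        where
        first : ∀ cs {b′} → b′ ∈ cs → (P x , b′) ∈ stair (P x ∷ map P vs) cs
        first (c₀ ∷ cs) m = ∈-++⁺ˡ (∈-map⁺ (P x ,_) m)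
      spokes-in : all (∈ᵇ F) (spokes p bs x) ≡ true
      spokes-in = ∧-intro (∈ᵇ-intro (edge (there (here refl)) (λ e → head≢ uP (here refl) (cong proj₁ e))))
        (all-intro (∈ᵇ F) (map (P x ,_) bs) (λ e e∈ → case ∈-map⁻ (P x ,_) e∈ of λ
          { (b′ , b∈ , refl) → ∈ᵇ-intro (edge
              (∈-++⁺ʳ (map (p ,_) (B w ∷ B x ∷ bs)) (∈-++⁺ʳ (map (P w ,_) (B x ∷ bs)) (inRow b∈)))
              (λ e → head≢ uB′ b∈ (sym (cong proj₂ e)))) }))

    -- A light `w` leaves at most Δ choices for the part and Δ^(r-1) for the blocks in `fullness`,
    -- and by `fan-count` each choice accounts for at most KΛ vertices `x`.
    full-count : nice (∈ᵇ F) ≡ true → ∀ w → light w ≡ true → ∀ X → Unique X → InjOn B X →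
      count (λ x → separated w x ∧ full w x) X ≤ Δ ^ r * (K * Λ)
    full-count ok w lw X u injB = begin
      count (λ x → separated w x ∧ full w x) X
        ≤⟨ count-mono X (λ x _ e → included x e) ⟩
      count (λ x → any (λ Y → does (distinct? _≟_ (proj₂ Y)) ∧ inFan Y x) Ys) X
        ≤⟨ count-any X Ys (λ x Y → does (distinct? _≟_ (proj₂ Y)) ∧ inFan Y x) ⟩
      ∑ Ys (λ Y → count (λ x → does (distinct? _≟_ (proj₂ Y)) ∧ inFan Y x) X)
        ≤⟨ ∑-bound Ys (K * Λ) each ⟩
      length Ys * (K * Λ)
        ≤⟨ *-monoˡ-≤ (K * Λ) lenYs ⟩
      Δ ^ r * (K * Λ) ∎
      where
      open ≤-Reasoning
      Lb = allLists (suc c) (nbrsOfPart F (P w))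
      Lp = nbrsOfBlock F (B w)
      Ys : List (Fin m × List (Fin m))
      Ys = concatMap (λ p → map (p ,_) Lb) Lp
      included : ∀ x → separated w x ∧ full w x ≡ true → any (λ Y → does (distinct? _≟_ (proj₂ Y)) ∧ inFan Y x) Ys ≡ true
      included x e with fullness w x (∧-elim₂ {separated w x} e)
      ... | p , bs , p∈ , bs∈ , d , i = any-intro _ (∈-concatMap⁺′ p∈ (∈-map⁺ (p ,_) bs∈)) (∧-intro d i)
      each : ∀ Y → Y ∈ Ys → count (λ x → does (distinct? _≟_ (proj₂ Y)) ∧ inFan Y x) X ≤ K * Λ
      each (p , bs) Y∈ with does (distinct? _≟_ bs) in d
      ... | false = ≤-trans (≤-reflexive (trans (∑-const X 0) (*-zeroʳ (length X)))) z≤n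
      ... | true with ∈-concatMap⁻′ (λ p → map (p ,_) Lb) Lp Y∈
      ...   | p′ , _ , m with ∈-map⁻ (p′ ,_) m
      ...     | _ , bs∈ , refl = ≤-trans (≤-reflexive (∑-cong X (λ x → cong (λ t → ⟦ (t ∧ not (does (p ≟ P x))) ∧ all (∈ᵇ F) (spokes p bs x) ⟧) (sym d))))
                (fan-count ok p bs (proj₁ (∈-allLists-length (suc c) (nbrsOfPart F (P w)) bs∈)) d X u injB)
      dp : length Lp ≤ Δ
      dp = dec-true (length Lp ≤? Δ) (∧-elim₁ lw)
      db : length (nbrsOfPart F (P w)) ≤ Δ
      db = dec-true (length (nbrsOfPart F (P w)) ≤? Δ) (∧-elim₂ {does (length Lp ≤? Δ)} lw)
      lenYs : length Ys ≤ Δ ^ r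
      lenYs = begin
        length Ys
          ≡⟨ trans (sym (∑1 Ys)) (trans (∑-concatMap (λ p → map (p ,_) Lb) Lp (λ _ → 1))
               (trans (∑-cong Lp (λ p → trans (∑1 (map (p ,_) Lb)) (length-map (p ,_) Lb))) (∑-const Lp (length Lb)))) ⟩
        length Lp * length Lb
          ≤⟨ *-mono-≤ dp (≤-trans (≤-reflexive (length-allLists (suc c) (nbrsOfPart F (P w)))) (^-monoˡ-≤ (suc c) db)) ⟩
        Δ * Δ ^ suc c ∎

inj-count : ∀ {A C : Set} (_≟C_ : DecidableEquality C) (f : A → C) {xs} → Unique xs → InjOn f xs → ∀ c →
  count (λ v → does (c ≟C f v)) xs ≤ 1
inj-count _≟C_ f {xs} u inj c = subst (_≤ 1) (length-keep _ xs) (go (keep p xs) (AllPairs-keep p u) (λ m → ∈-keep p xs m))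
  where
  p : _ → Bool
  p v = does (c ≟C f v)
  go : ∀ ys → Unique ys → (∀ {y} → y ∈ ys → y ∈ xs × p y ≡ true) → length ys ≤ 1
  go [] _ _ = z≤n
  go (y ∷ []) _ _ = ≤-refl
  go (y ∷ y′ ∷ ys) ((ne ∷ _) ∷ _) h = ⊥-elim (ne (inj (proj₁ (h (here refl))) (proj₁ (h (there (here refl))))
    (trans (sym (dec-true (c ≟C f y) (proj₂ (h (here refl))))) (dec-true (c ≟C f y′) (proj₂ (h (there (here refl))))))))

encode : ∀ {m} → Fin m × Fin m → Fin (m * m)
encode e = combine (proj₁ e) (proj₂ e)

encode-injective : ∀ {m} {e e′ : Fin m × Fin m} → encode e ≡ encode e′ → e ≡ e′
encode-injective {e = p , b} {p′ , b′} eq with combine-injective p b p′ b′ eq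
... | refl , refl = refl

-- The truth table behind `some-good`. The term for `u` carries the factor ⟦ l ⟧ because full pairs
-- can be counted only at light `w`.
not-good : ∀ p b f o l l′ u → (not p ∧ not b) ∧ (not f ∧ (not o ∧ (l ∧ (l′ ∧ not u)))) ≡ false →
  1 ≤ (⟦ p ⟧ + ⟦ b ⟧) + (⟦ f ⟧ + (⟦ o ⟧ + (⟦ not l ⟧ + (⟦ not l′ ⟧ + ⟦ l ⟧ * ⟦ (not p ∧ not b) ∧ u ⟧))))
not-good true  _     _     _     _     _     _    _ = s≤s z≤n
not-good false true  _     _     _     _     _    _ = s≤s z≤n
not-good false false true  _     _     _     _    _ = s≤s z≤n
not-good false false false true  _     _     _    _ = s≤s z≤n
not-good false false false false false _     _    _ = s≤s z≤n
not-good false false false false true  false _    _ = s≤s z≤n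
not-good false false false false true  true  true _ = s≤s z≤n

-- The exposure strategy for one configuration

module Configurations {n m : ℕ} (c K : ℕ) (P B : Fin n → Fin m) {Λ : ℕ} (loadP : Load P Λ) (loadB : Load B Λ)
  (c≥1 : 1 ≤ c) (y₀ Δ fmax Ψ : ℕ)
  (Ψ-end : 2 * suc Δ * suc y₀ ^ (2 + c + 3) + suc fmax * suc y₀ ^ (2 + c + 1) + m ≤ Ψ * suc y₀ ^ (2 + c + 3))
  (Ψ-mid : 2 * suc Δ * Λ * suc y₀ ^ (2 + c + 3) + 2 * suc fmax * Λ * suc y₀ ^ (2 + c + 1) + n ≤ Ψ * suc y₀ ^ (2 + c + 3))
  (main : 4 * (m * n ^ c * m) ≤ suc y₀ ^ ((2 + c) * (2 + c + 3)))
  (rest : 4 * Ψ ^ (2 + c) ≤ suc y₀ * suc y₀)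
  where

  open Copies c P B public
  open Graphs c K P B public

  -- The first argument is q - 1 for q = (1 + y₀)², written so that `q` and `suc y₀ * suc y₀` are
  -- definitionally equal.
  open Exploration (y₀ + y₀ * suc y₀) (m * m) (encode {m}) encode-injective public

  avoids : List (Fin n) → List (Fin n) → Ω → Bool
  avoids W X ω = nice (on ω) ∧ missingAll W X (on ω)

  module _ (W X : List (Fin n)) (uW : Unique W) (uX : Unique X) (injP : InjOn P W) (injB : InjOn B X) (f n₀ : ℕ)
    (f≤ : f ≤ fmax) (1≤W : 1 ≤ length W) (1≤X : 1 ≤ length X)
    (heavyW : 32 * Λ * f ≤ suc Δ * length W) (heavyX : 32 * Λ * f ≤ suc Δ * length X)
    (few-on : 16 * f ≤ length W * length X) (few-off : 16 * n₀ ≤ length W * length X)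
    (few-full : 16 * (Δ ^ (2 + c) * (K * Λ)) ≤ length X) (few-equal : 32 * Λ ≤ length W)
    where

    module _ (F O : List E) (uFO : Unique (F ++ O)) (lenF : length F ≤ f) (lenO : length O ≤ n₀) (ok : nice (∈ᵇ F) ≡ true) where

      open Light loadP loadB Δ F

      good : Fin n → Fin n → Bool
      good w x = separated w x ∧ (not (∈ᵇ F (P w , B x)) ∧ (not (∈ᵇ O (P w , B x)) ∧ (light w ∧ (light x ∧ not (full w x)))))

      -- Different pairs in W × X query different edges, because `P` is injective on `W` and `B` on
      -- `X`.
      hits : ∀ G → ∑ W (λ w → count (λ x → ∈ᵇ G (P w , B x)) X) ≤ length G
      hits G = begin
        ∑ W (λ w → count (λ x → ∈ᵇ G (P w , B x)) X)
          ≤⟨ ∑-mono W (λ w _ → ∑-mono X (λ x _ → one w x)) ⟩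
        ∑ W (λ w → ∑ X (λ x → ∑ G (λ e → t w x e)))
          ≡⟨ trans (∑-cong W (λ w → ∑-swap X G (t w))) (∑-swap W G (λ w e → ∑ X (λ x → t w x e))) ⟩
        ∑ G (λ e → ∑ W (λ w → ∑ X (λ x → t w x e)))
          ≤⟨ ∑-bound G 1 (λ e _ → each e) ⟩
        length G * 1
          ≡⟨ *-identityʳ _ ⟩
        length G ∎
        where
        open ≤-Reasoning
        t : Fin n → Fin n → E → ℕ
        t w x e = ⟦ does (proj₁ e ≟ P w) ⟧ * ⟦ does (proj₂ e ≟ B x) ⟧
        one : ∀ w x → ⟦ ∈ᵇ G (P w , B x) ⟧ ≤ ∑ G (t w x)
        one w x with ∈ᵇ G (P w , B x) in eq
        ... | false = z≤n
        ... | true = ≤-trans (≤-reflexive (sym (cong₂ (λ a b → ⟦ a ⟧ * ⟦ b ⟧) (true-dec (P w ≟ P w) refl) (true-dec (B x ≟ B x) refl))))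
                        (∑-member (t w x) (∈ᵇ-true eq))
        each : ∀ e → ∑ W (λ w → ∑ X (λ x → t w x e)) ≤ 1
        each e = ≤-trans (≤-reflexive (trans (∑-cong W (λ w → ∑-*ˡ X ⟦ does (proj₁ e ≟ P w) ⟧ _)) (∑-*ʳ W (∑ X (λ x → ⟦ does (proj₂ e ≟ B x) ⟧)) _)))
          (*-mono-≤ (inj-count _≟_ P uW injP (proj₁ e)) (inj-count _≟_ B uX injB (proj₂ e)))

      same : ∀ (g : Fin n → Fin m) → Load g Λ → ∀ x → count (λ w → does (g w ≟ g x)) W ≤ Λ
      same g load x = subst (_≤ Λ) (length-keep _ W) (load (g x) (keep (λ w → does (g w ≟ g x)) W) (AllPairs-keep _ uW)
        (λ m → dec-true (g _ ≟ g x) (proj₂ (∈-keep _ W m))))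

      ∑∑ : (Fin n → Fin n → ℕ) → ℕ
      ∑∑ t = ∑ W (λ w → ∑ X (t w))

      ∑∑-+ : ∀ t u → ∑∑ (λ w x → t w x + u w x) ≡ ∑∑ t + ∑∑ u
      ∑∑-+ t u = trans (∑-cong W (λ w → ∑-+ X (t w) (u w))) (∑-+ W _ _)

      -- There are six reasons for a pair to be unusable, and six of the numerical hypotheses limit
      -- each to a sixteenth of W × X.
      some-good : any (λ w → any (good w) X) W ≡ true
      some-good with any (λ w → any (good w) X) W in eq
      ... | true = refl
      ... | false = ⊥-elim (<-irrefl refl (≤-trans (*-mono-≤ 1≤W 1≤X) (≤-trans (m≤m+n ab _) (≤-reflexive ten))))
        where
        open ≤-Reasoning
        a = length W
        b = length X
        ab = a * b
        Q = Δ ^ (2 + c) * (K * Λ)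
        eqᵗ onᵗ offᵗ hwᵗ hxᵗ fullᵗ : Fin n → Fin n → ℕ
        eqᵗ  w x = ⟦ does (P w ≟ P x) ⟧ + ⟦ does (B w ≟ B x) ⟧
        onᵗ  w x = ⟦ ∈ᵇ F (P w , B x) ⟧
        offᵗ w x = ⟦ ∈ᵇ O (P w , B x) ⟧
        hwᵗ  w x = ⟦ not (light w) ⟧
        hxᵗ  w x = ⟦ not (light x) ⟧
        fullᵗ w x = ⟦ light w ⟧ * ⟦ separated w x ∧ full w x ⟧
        pointwise : ∀ w x → good w x ≡ false → 1 ≤ eqᵗ w x + (onᵗ w x + (offᵗ w x + (hwᵗ w x + (hxᵗ w x + fullᵗ w x))))
        pointwise w x = not-good (does (P w ≟ P x)) (does (B w ≟ B x)) (∈ᵇ F (P w , B x)) (∈ᵇ O (P w , B x)) (light w) (light x) (full w x)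
        sEq : ∑∑ eqᵗ ≤ b * (2 * Λ)
        sEq = ≤-trans (≤-reflexive (∑-swap W X eqᵗ)) (∑-bound X (2 * Λ) (λ x _ →
          ≤-trans (≤-reflexive (∑-+ W _ _)) (≤-trans (+-mono-≤ (same P loadP x) (same B loadB x)) (≤-reflexive (cong (Λ +_) (sym (+-identityʳ Λ)))))))
        hW = count (not ∘ light) W
        hX = count (not ∘ light) X
        sHw : ∑∑ hwᵗ ≡ hW * b
        sHw = trans (∑-cong W (λ w → trans (∑-const X ⟦ not (light w) ⟧) (*-comm b _))) (∑-*ʳ W b _)
        sHx : ∑∑ hxᵗ ≡ a * hX
        sHx = ∑-const W hX
        sFull : ∑∑ fullᵗ ≤ a * Q
        sFull = ∑-bound W Q (λ w _ → ≤-trans (≤-reflexive (∑-*ˡ X ⟦ light w ⟧ _)) (each w))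
          where
          each : ∀ w → ⟦ light w ⟧ * count (λ x → separated w x ∧ full w x) X ≤ Q
          each w with light w in lw
          ... | false = z≤n
          ... | true  = ≤-trans (≤-reflexive (+-identityʳ _)) (full-count ok w lw X uX injB)
        heavy16 : ∀ L → Unique L → 32 * Λ * f ≤ suc Δ * length L → 16 * count (not ∘ light) L ≤ length L
        heavy16 L u h = *-cancelˡ-≤ (suc Δ) (begin
          suc Δ * (16 * count (not ∘ light) L) ≡⟨ e₁ (suc Δ) (count (not ∘ light) L) ⟩
          16 * (count (not ∘ light) L * suc Δ) ≤⟨ *-monoʳ-≤ 16 (heavy-count L u) ⟩
          16 * (2 * Λ * length F)              ≤⟨ *-monoʳ-≤ 16 (*-monoʳ-≤ (2 * Λ) lenF) ⟩
          16 * (2 * Λ * f)                     ≡⟨ e₂ Λ f ⟩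
          32 * Λ * f                           ≤⟨ h ⟩
          suc Δ * length L ∎)
          where
          e₁ : ∀ d x → d * (16 * x) ≡ 16 * (x * d)
          e₁ = solve-∀
          e₂ : ∀ l f → 16 * (2 * l * f) ≡ 32 * l * f
          e₂ = solve-∀
        all≤ : ab ≤ b * (2 * Λ) + (f + (n₀ + (hW * b + (a * hX + a * Q))))
        all≤ = begin
          a * b
            ≡⟨ sym (trans (∑-cong W (λ _ → ∑1 X)) (∑-const W b)) ⟩
          ∑∑ (λ _ _ → 1)
            ≤⟨ ∑-mono W (λ w w∈ → ∑-mono X (λ x x∈ → pointwise w x (any-false (good w) (any-false (λ w → any (good w) X) eq w∈) x∈))) ⟩
          ∑∑ (λ w x → eqᵗ w x + (onᵗ w x + (offᵗ w x + (hwᵗ w x + (hxᵗ w x + fullᵗ w x)))))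
            ≡⟨ trans (∑∑-+ eqᵗ _) (cong (∑∑ eqᵗ +_) (trans (∑∑-+ onᵗ _) (cong (∑∑ onᵗ +_) (trans (∑∑-+ offᵗ _) (cong (∑∑ offᵗ +_)
                 (trans (∑∑-+ hwᵗ _) (cong (∑∑ hwᵗ +_) (∑∑-+ hxᵗ fullᵗ)))))))) ⟩
          ∑∑ eqᵗ + (∑∑ onᵗ + (∑∑ offᵗ + (∑∑ hwᵗ + (∑∑ hxᵗ + ∑∑ fullᵗ))))
            ≤⟨ +-mono-≤ sEq (+-mono-≤ (≤-trans (hits F) lenF) (+-mono-≤ (≤-trans (hits O) lenO)
                 (+-mono-≤ (≤-reflexive sHw) (+-mono-≤ (≤-reflexive sHx) sFull)))) ⟩
          b * (2 * Λ) + (f + (n₀ + (hW * b + (a * hX + a * Q)))) ∎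
        sixteen : 16 * ab ≤ 6 * ab
        sixteen = begin
          16 * ab
            ≤⟨ *-monoʳ-≤ 16 all≤ ⟩
          16 * (b * (2 * Λ) + (f + (n₀ + (hW * b + (a * hX + a * Q)))))
            ≡⟨ e₁ b Λ f n₀ hW a hX Q ⟩
          32 * Λ * b + (16 * f + (16 * n₀ + (16 * hW * b + (a * (16 * hX) + a * (16 * Q)))))
            ≤⟨ +-mono-≤ (*-monoˡ-≤ b few-equal) (+-mono-≤ few-on (+-mono-≤ few-off (+-mono-≤ (*-monoˡ-≤ b (heavy16 W uW heavyW))
                 (+-mono-≤ (*-monoʳ-≤ a (heavy16 X uX heavyX)) (*-monoʳ-≤ a few-full))))) ⟩
          ab + (ab + (ab + (ab + (ab + ab))))
            ≡⟨ e₂ ab ⟩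
          6 * ab ∎
          where
          e₁ : ∀ b l f n hW a hX Q → 16 * (b * (2 * l) + (f + (n + (hW * b + (a * hX + a * Q))))) ≡
            32 * l * b + (16 * f + (16 * n + (16 * hW * b + (a * (16 * hX) + a * (16 * Q)))))
          e₁ = solve-∀
          e₂ : ∀ x → x + (x + (x + (x + (x + x)))) ≡ 6 * x
          e₂ = solve-∀
        ten : ab + 9 * ab ≡ 0
        ten = n≤0⇒n≡0 (+-cancelʳ-≤ (6 * ab) (ab + 9 * ab) 0 (≤-trans (≤-reflexive (e ab)) sixteen))
          where
          e : ∀ x → x + 9 * x + 6 * x ≡ 16 * x
          e = solve-∀

      module Query (w x : Fin n) (gd : good w x ≡ true) where

        z : E
        z = (P w , B x)

        sep : separated w x ≡ true
        sep = ∧-elim₁ gd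
        gd₁ = ∧-elim₂ {separated w x} gd
        gd₂ = ∧-elim₂ {not (∈ᵇ F z)} gd₁
        gd₃ = ∧-elim₂ {not (∈ᵇ O z)} gd₂
        gd₄ = ∧-elim₂ {light w} gd₃

        z∉F : z ∉ F
        z∉F = ∈ᵇ-false (not-true (∧-elim₁ gd₁))

        z∉O : z ∉ O
        z∉O = ∈ᵇ-false (not-true (∧-elim₁ gd₂))

        not-full : full w x ≡ false
        not-full = not-true (∧-elim₂ {light x} gd₄)

        block-deg : ∀ v → light v ≡ true → length (nbrsOfBlock (z ∷ F) (B v)) ≤ suc Δ
        block-deg v lv with does (proj₂ z ≟ B v)
        ... | true  = s≤s (dec-true (_ ≤? Δ) (∧-elim₁ lv))
        ... | false = ≤-trans (dec-true (_ ≤? Δ) (∧-elim₁ lv)) (n≤1+n Δ)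

        part-deg : ∀ v → light v ≡ true → length (nbrsOfPart (z ∷ F) (P v)) ≤ suc Δ
        part-deg v lv with does (proj₁ z ≟ P v)
        ... | true  = s≤s (dec-true (_ ≤? Δ) (∧-elim₂ {does (length (nbrsOfBlock F (B v)) ≤? Δ)} lv))
        ... | false = ≤-trans (dec-true (_ ≤? Δ) (∧-elim₂ {does (length (nbrsOfBlock F (B v)) ≤? Δ)} lv)) (n≤1+n Δ)

        lw : light w ≡ true
        lw = ∧-elim₁ gd₃
        lx : light x ≡ true
        lx = ∧-elim₁ gd₄

        -- The queried edge already counts as revealed, hence one more in the degrees and in the
        -- number of edges.
        module S = Spread loadP loadB w x (z ∷ F) (suc Δ) (suc fmax) (suc y₀) Ψ (s≤s z≤n) c≥1 (s≤s (≤-trans lenF f≤))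
          (block-deg w lw) (block-deg x lx) (part-deg w lw) (part-deg x lx) Ψ-end Ψ-mid main rest

        fresh : E → Bool
        fresh e = not (∈ᵇ (z ∷ F) e)

        offOK : E → Bool
        offOK e = not (∈ᵇ O e)

        new : Copy → List E
        new τ = keep fresh (edges w x τ)

        -- A copy with an edge known to be off cannot be present; leaving such copies out makes
        -- every extension disjoint from `O`.
        usable : Copy → Bool
        usable τ = valid w x τ ∧ all offOK (new τ)

        extensions : List (List E)
        extensions = map new (keep usable copies)

        lenEdges : ∀ τ → τ ∈ copies → length (edges w x τ) ≡ h
        lenEdges τ@(p , vs , b) τ∈ = trans (cong length (edges-stair w x τ)) (trans (length-stair (partsOf w x τ) (blocksOf w x τ) (cong (2 +_) eqlen))
            (cong tri (cong (2 +_) (trans (sym eqlen) (cong suc (trans (length-map P vs) (copies-length τ∈)))))))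
          where
          eqlen : suc (length (map P vs)) ≡ length (map B vs ++ b ∷ [])
          eqlen = trans (cong suc (trans (length-map P vs) (sym (length-map B vs)))) (trans (+-comm 1 _) (sym (length-++ (map B vs))))

        valid-unique : ∀ τ → valid w x τ ≡ true → Unique (edges w x τ)
        valid-unique τ v = subst Unique (sym (edges-stair w x τ))
          (stair-unique (partsOf w x τ) (blocksOf w x τ) (valid-parts v) (valid-blocks v))

        new-length : ∀ τ → τ ∈ copies → S.revealed τ + length (new τ) ≡ h
        new-length τ τ∈ = trans (cong (_+ length (new τ)) (sym (length-keep (∈ᵇ (z ∷ F)) (edges w x τ))))
          (trans (sym (keep-split (∈ᵇ (z ∷ F)) (edges w x τ))) (lenEdges τ τ∈))

        extension-ok : ∀ {T} → T ∈ extensions → Unique (T ++ (z ∷ F) ++ O) × length T ≤ h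
        extension-ok T∈ with ∈-map⁻ new T∈
        ... | τ , τ∈′ , refl with ∈-keep usable copies τ∈′
        ...   | τ∈ , us = Uniq.++⁺ (AllPairs-keep fresh (valid-unique τ (∧-elim₁ us))) (all-∉ z∉FO ∷ uFO) disj ,
                  ≤-trans (m≤n+m _ (S.revealed τ)) (≤-reflexive (new-length τ τ∈))
          where
          z∉FO : z ∉ F ++ O
          z∉FO m = [ z∉F , z∉O ]′ (∈-++⁻ F m)
          disj : ∀ {e} → ¬ (e ∈ new τ × e ∈ (z ∷ F) ++ O)
          disj (a , b) with ∈-++⁻ (z ∷ F) b
          ... | inj₁ m = ∈ᵇ-false (not-true (proj₂ (∈-keep fresh (edges w x τ) a))) m
          ... | inj₂ m = ∈ᵇ-false (not-true (all-elim offOK (∧-elim₂ {valid w x τ} us) a)) m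

        -- In the event the pair is missing although it is separated and its edge is on, so it was
        -- deleted, and a copy responsible for that supplies the extension.
        extension-cover : ∀ ω → inState (avoids W X) h f n₀ F O ω ≡ true → w ∈ W → x ∈ X → on ω z ≡ true →
          ∃ λ T → T ∈ extensions × allOn ω T ≡ true
        extension-cover ω st w∈ x∈ oz with closed-elim closed-wx
          where
          bad : missing (on ω) w x ≡ true
          bad = all-elim (missing (on ω) w) (all-elim (λ w → all (missing (on ω) w) X)
                  (∧-elim₂ {nice (on ω)} (∧-elim₂ {allOn ω F ∧ allOff ω O} st)) w∈) x∈
          closed-wx : closed (on ω) w x ≡ true
          closed-wx with ∨-elim {not (separated w x)} bad
          ... | inj₁ e = true≢false sep (not-true e)
          ... | inj₂ e with ∨-elim {not (on ω z)} e
          ...   | inj₁ e′ = true≢false oz (not-true e′)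
          ...   | inj₂ e′ = e′
        ... | τ , τ∈ , vτ , eτ = new τ , ∈-map⁺ new (keep-∈ usable τ∈ (∧-intro vτ disj)) , onNew
          where
          onNew : allOn ω (new τ) ≡ true
          onNew = all-intro (on ω) (new τ) (λ e m → all-elim (on ω) eτ (proj₁ (∈-keep fresh (edges w x τ) m)))
          disj : all offOK (new τ) ≡ true
          disj = all-intro offOK (new τ) (λ e m → notIn e m)
            where
            notIn : ∀ e → e ∈ new τ → not (∈ᵇ O e) ≡ true
            notIn e m with ∈ᵇ O e in eq
            ... | false = refl
            ... | true = true≢false (all-elim (on ω) onNew m)
                    (not-true (all-elim (λ e → not (on ω e)) (∧-elim₂ {allOn ω F} (∧-elim₁ st)) (∈ᵇ-true eq)))

        -- The extension of a copy consists of its unrevealed edges, so the exponent is the number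
        -- of revealed ones and `spread` applies. That no copy is completely revealed is what
        -- `not-full` provides.
        extension-sum : 2 * ∑ extensions (λ T → q ^ (h ∸ length T)) ≤ q ^ h
        extension-sum = ≤-trans (*-monoʳ-≤ 2 (≤-trans (≤-reflexive (∑-map new (keep usable copies) _))
            (≤-trans (∑-mono (keep usable copies) (λ τ m → ≤-reflexive (cong (q ^_) (expo τ (proj₁ (∈-keep usable copies m))))))
                     (weaken copies))))
          (S.spread (λ τ τ∈ v → subst (suc (S.revealed τ) ≤_) (lenEdges τ τ∈) (count<length (∈ᵇ (z ∷ F)) (edges w x τ) (notAll τ τ∈ v))))
          where
          expo : ∀ τ → τ ∈ copies → h ∸ length (new τ) ≡ S.revealed τ
          expo τ τ∈ = trans (cong (_∸ length (new τ)) (sym (new-length τ τ∈))) (m+n∸n≡m (S.revealed τ) (length (new τ)))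
          notAll : ∀ τ → τ ∈ copies → valid w x τ ≡ true → all (∈ᵇ (z ∷ F)) (edges w x τ) ≡ false
          notAll τ τ∈ v with all (∈ᵇ (z ∷ F)) (edges w x τ) in eq
          ... | false = refl
          ... | true  = true≢false (closed-intro τ∈ v eq) not-full
          weaken : ∀ τs → ∑ (keep usable τs) (λ τ → q ^ S.revealed τ) ≤ ∑ (keep (valid w x) τs) (λ τ → q ^ S.revealed τ)
          weaken [] = z≤n
          weaken (τ ∷ τs) with valid w x τ
          ... | false = weaken τs
          ... | true with all offOK (new τ)
          ...   | true  = +-monoʳ-≤ (q ^ S.revealed τ) (weaken τs)
          ...   | false = ≤-trans (weaken τs) (m≤n+m _ (q ^ S.revealed τ))

    step : ∀ F O → Unique (F ++ O) → length F ≤ f → length O ≤ n₀ → Step (avoids W X) h f n₀ F O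
    step F O u lF lO with nice (∈ᵇ F) in ok
    -- A fan in the revealed edges is a fan in every outcome of this state, which the event
    -- excludes.
    ... | false = impossible (λ ω st → true≢false
            (nice-antitone {∈ᵇ F} {on ω} (λ {e} m → all-elim (on ω) (∧-elim₁ (∧-elim₁ st)) (∈ᵇ-true m))
              (∧-elim₁ (∧-elim₂ {allOn ω F ∧ allOff ω O} st))) ok)
    ... | true with any-elim _ W (some-good F O u lF lO ok)
    ...   | w , w∈ , aw with any-elim _ X aw
    ...     | x , x∈ , gd = query z extensions z∉F z∉O extension-ok (λ ω st → extension-cover ω st w∈ x∈) extension-sum
      where open Query F O u lF lO ok w x gd

    configuration-bound : ∀ κ → κ * suc h ≤ f → 2 * q * κ ≤ n₀ → count (avoids W X) (vecs q (m * m)) * 2 ^ κ ≤ 2 * q ^ (m * m)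
    configuration-bound = exploration (avoids W X) h f n₀ step

-- First moment bound for fans

module Niceness {n m : ℕ} (c K : ℕ) (P B : Fin n → Fin m) (y₀ : ℕ) where

  open Copies c P B
  open Graphs c K P B
  open Exploration (y₀ + y₀ * suc y₀) (m * m) (encode {m}) encode-injective

  length-fanEdges : ∀ p bs xs → length bs ≡ suc c → length (fanEdges (p , bs , xs)) ≡ length xs * r
  length-fanEdges p bs []       e = refl
  length-fanEdges p bs (x ∷ xs) e = trans (length-++ (spokes p bs x))
    (cong₂ _+_ (cong suc (trans (length-map (P x ,_) bs) e)) (length-fanEdges p bs xs e))

  fanEdges-unique : ∀ p bs xs → Unique bs → Unique (map P xs) → Unique (map B xs) → p ∉ map P xs → Unique (fanEdges (p , bs , xs))
  fanEdges-unique p bs [] ub uP uB p∉ = []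
  fanEdges-unique p bs (x ∷ xs) ub (qP ∷ uP) (qB ∷ uB) p∉ = Uniq.++⁺
    (all-∉ first ∷ unique-map (P x ,_) ub (λ _ _ e → cong proj₂ e))
    (fanEdges-unique p bs xs ub uP uB (p∉ ∘ there))
    disjoint
    where
    first : (p , B x) ∉ map (P x ,_) bs
    first m with ∈-map⁻ (P x ,_) m
    ... | _ , _ , e = p∉ (here (cong proj₁ e))
    disjoint : ∀ {e} → ¬ (e ∈ spokes p bs x × e ∈ concatMap (spokes p bs) xs)
    disjoint (m , m′) with ∈-concatMap⁻′ (spokes p bs) xs m′
    disjoint (here refl , m′) | x′ , x∈ , here e = ∉-all qB (subst (_∈ map B xs) (sym (cong proj₂ e)) (∈-map⁺ B x∈))
    disjoint (here refl , m′) | x′ , x∈ , there k with ∈-map⁻ (P x′ ,_) k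
    ... | _ , _ , e = p∉ (there (subst (_∈ map P xs) (sym (cong proj₁ e)) (∈-map⁺ P x∈)))
    disjoint (there j , m′) | x′ , x∈ , k with ∈-map⁻ (P x ,_) j
    disjoint (there j , m′) | x′ , x∈ , here e | _ , _ , refl = p∉ (here (sym (cong proj₁ e)))
    disjoint (there j , m′) | x′ , x∈ , there k | _ , _ , refl with ∈-map⁻ (P x′ ,_) k
    ... | _ , _ , e = ∉-all qP (subst (_∈ map P xs) (sym (cong proj₁ e)) (∈-map⁺ P x∈))

  N : ℕ
  N = m * m

  fan-mass : ∀ Y → Y ∈ fans → count (λ ω → properFan Y ∧ all (on ω) (fanEdges Y)) (vecs q N) * q ^ (K * r) ≤ q ^ N
  fan-mass Y@(p , bs , xs) Y∈ with properFan Y in pr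
  ... | false = ≤-trans (≤-reflexive (cong (_* q ^ (K * r)) (trans (∑-const (vecs q N) 0) (*-zeroʳ (length (vecs q N)))))) z≤n
  ... | true = ≤-reflexive (begin
      count (λ ω → all (on ω) F) (vecs q N) * q ^ (K * r)
        ≡⟨ cong₂ _*_ (∑-cong (vecs q N) (λ ω → cong ⟦_⟧ (sym (∧-identity (allOn ω F))))) (cong (q ^_) (sym len)) ⟩
      count (λ ω → allOn ω F ∧ allOff ω []) (vecs q N) * q ^ (length F + 0)
        ≡⟨ cylinder F [] (subst Unique (sym (++-[] F)) uF) ⟩
      q ^ N * 1
        ≡⟨ *-identityʳ (q ^ N) ⟩
      q ^ N ∎)
    where
    open ≡-Reasoning
    F = fanEdges (p , bs , xs)
    ∧-identity : ∀ b → b ∧ true ≡ b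
    ∧-identity true  = refl
    ∧-identity false = refl
    ++-[] : ∀ {A : Set} (as : List A) → as ++ [] ≡ as
    ++-[] []       = refl
    ++-[] (a ∷ as) = cong (a ∷_) (++-[] as)
    len : length F + 0 ≡ K * r
    len = trans (+-identityʳ _) (trans (length-fanEdges p bs xs (proj₁ (fans-∈ Y∈)))
      (cong (_* r) (proj₂ (proj₂ (combos-unique K (allFin n) (Uniq.allFin⁺ n) (proj₂ (fans-∈ Y∈)))))))
    uF : Unique F
    uF with properFan-elim {p} {bs} {xs} pr
    ... | ub , uP , uB , p∉ = fanEdges-unique p bs xs ub uP uB p∉

  -- There are m^r choices for part and blocks, at most n^K / K! for the vertices, and a fan is
  -- present with probability q^(-rK). The hypothesis on n cancels the powers of q and leaves m^r
  -- ρ^K / K!.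
  niceness-bound : ∀ ρ → n ≤ ρ * q ^ r → count (λ ω → not (nice (on ω))) (vecs q N) * K ! ≤ m ^ r * ρ ^ K * q ^ N
  niceness-bound ρ n≤ = *-cancelʳ-≤ _ _ (q ^ (K * r)) {{m^n≢0 q (K * r)}} (begin
    cnt * K ! * q ^ (K * r)
      ≡⟨ e₁ cnt (K !) (q ^ (K * r)) ⟩
    cnt * q ^ (K * r) * K !
      ≤⟨ *-monoˡ-≤ (K !) (*-monoˡ-≤ (q ^ (K * r)) cnt≤) ⟩
    ∑ fans mass′ * q ^ (K * r) * K !
      ≡⟨ cong (_* K !) (sym (∑-*ʳ fans (q ^ (K * r)) mass′)) ⟩
    ∑ fans (λ Y → mass′ Y * q ^ (K * r)) * K !
      ≤⟨ *-monoˡ-≤ (K !) (∑-bound fans (q ^ N) fan-mass) ⟩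
    length fans * q ^ N * K !
      ≡⟨ cong (λ l → l * q ^ N * K !) length-fans ⟩
    m * (m ^ suc c * C) * q ^ N * K !
      ≡⟨ e₂ m (m ^ suc c) C (q ^ N) (K !) ⟩
    m * m ^ suc c * q ^ N * (K ! * C)
      ≤⟨ *-monoʳ-≤ (m * m ^ suc c * q ^ N) (≤-trans (combos-length K (allFin n)) (≤-reflexive (cong (_^ K) (length-allFin n)))) ⟩
    m * m ^ suc c * q ^ N * n ^ K
      ≤⟨ *-monoʳ-≤ (m * m ^ suc c * q ^ N) (^-monoˡ-≤ K n≤) ⟩
    m * m ^ suc c * q ^ N * (ρ * q ^ r) ^ K
      ≡⟨ cong (m * m ^ suc c * q ^ N *_) (trans (^-distribʳ-* K ρ (q ^ r)) (cong (ρ ^ K *_) (trans (^-*-assoc q r K) (cong (q ^_) (*-comm r K))))) ⟩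
    m * m ^ suc c * q ^ N * (ρ ^ K * q ^ (K * r))
      ≡⟨ e₃ (m * m ^ suc c) (q ^ N) (ρ ^ K) (q ^ (K * r)) ⟩
    m ^ r * ρ ^ K * q ^ N * q ^ (K * r) ∎)
    where
    open ≤-Reasoning
    cnt = count (λ ω → not (nice (on ω))) (vecs q N)
    C = length (combos K (allFin n))
    mass′ : Fan → ℕ
    mass′ Y = count (λ ω → properFan Y ∧ all (on ω) (fanEdges Y)) (vecs q N)
    e₁ : ∀ a b c → a * b * c ≡ a * c * b
    e₁ = solve-∀
    e₂ : ∀ m m′ C q k → m * (m′ * C) * q * k ≡ m * m′ * q * (k * C)
    e₂ = solve-∀
    e₃ : ∀ a b c d → a * b * (c * d) ≡ a * c * b * d
    e₃ = solve-∀
    not-not : ∀ b → not (not b) ≡ b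
    not-not true  = refl
    not-not false = refl
    cnt≤ : cnt ≤ ∑ fans mass′
    cnt≤ = ≤-trans (≤-reflexive (∑-cong (vecs q N) (λ ω → cong ⟦_⟧ (trans (cong not (nice-def (on ω))) (not-not (any (λ Y → properFan Y ∧ all (on ω) (fanEdges Y)) fans))))))
      (count-any (vecs q N) fans (λ ω Y → properFan Y ∧ all (on ω) (fanEdges Y)))

-- The two partitions in general position

module _ {n m ρ : ℕ} (n≤mρ : n ≤ m * ρ) where

  -- Runs of ρ consecutive vertices; the randomness of the blocks alone produces general position.
  part : Fin n → Fin m
  part v = quotient {m} ρ (inject≤ v n≤mρ)

  part-load : Load part ρ
  part-load p xs u h = ≤-trans (≤-reflexive (sym (length-map rem xs)))
    (≤-trans (unique-length (unique-map rem u inj) (λ {o} _ → ∈allFin o)) (≤-reflexive (length-allFin ρ)))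
    where
    rem : Fin n → Fin ρ
    rem v = remainder {m} ρ (inject≤ v n≤mρ)
    inj : InjOn rem xs
    inj {v} {v′} a b e = inject≤-injective n≤mρ n≤mρ v v′ (trans (sym (combine-remQuot {m} ρ (inject≤ v n≤mρ)))
      (trans (cong₂ combine (trans (h a) (sym (h b))) e) (combine-remQuot {m} ρ (inject≤ v′ n≤mρ))))

load-mono : ∀ {A C : Set} {f : A → C} {Λ Λ′} → Λ ≤ Λ′ → Load f Λ → Load f Λ′
load-mono le load c xs u h = ≤-trans (load c xs u h) le

-- General position: i vertices never lie both in a parts and in a blocks. Lists may repeat cells,
-- so length exactly a also covers fewer cells.
Transversal : ∀ {n m} → (Fin n → Fin m) → (Fin n → Fin m) → ℕ → ℕ → Set
Transversal {n} {m} P B a i = ∀ (I : List (Fin n)) (𝒜 ℬ : List (Fin m)) → Unique I → length I ≡ i → length 𝒜 ≡ a → length ℬ ≡ a →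
  (∀ {v} → v ∈ I → P v ∈ 𝒜) → (∀ {v} → v ∈ I → B v ∈ ℬ) → ⊥

module _ {n m : ℕ} (P : Fin n → Fin m) where

  cell : Fin m → List (Fin n)
  cell p = keep (λ v → does (P v ≟ p)) (allFin n)

  cells : List (Fin m) → List (Fin n)
  cells = concatMap cell

  ∈-cells : ∀ {𝒜 v} → P v ∈ 𝒜 → v ∈ cells 𝒜
  ∈-cells {𝒜} {v} m = ∈-concatMap⁺′ m (keep-∈ _ (∈allFin v) (true-dec (P v ≟ P v) refl))

  cells-length : ∀ {Λ} → Load P Λ → ∀ 𝒜 → length (cells 𝒜) ≤ length 𝒜 * Λ
  cells-length load [] = z≤n
  cells-length load (p ∷ 𝒜) = ≤-trans (≤-reflexive (length-++ (cell p)))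
    (+-mono-≤ (load p (cell p) (AllPairs-keep _ (Uniq.allFin⁺ n)) (λ v∈ → dec-true (P _ ≟ p) (proj₂ (∈-keep _ (allFin n) v∈))))
              (cells-length load 𝒜))

-- Every vertex chooses its block uniformly and independently. The two numerical hypotheses give
-- probability at most 1/4 each to an overfull block and to a violation of general position.
module Blocks {n m : ℕ} (P : Fin n → Fin m) (Λ : ℕ) (loadP : Load P Λ) (ρ a i : ℕ) (m≥1 : 1 ≤ m) (n≤ : n ≤ ρ * m)
  (few-overloads : 4 * (m * ρ ^ suc Λ) ≤ suc Λ !)
  (few-tangles : 4 * (m ^ a * (m ^ a * ((a * Λ) ^ i * a ^ i))) ≤ m ^ i)
  where

  Assignment : Set
  Assignment = Vec (Fin m) n

  K : ℕ
  K = suc Λ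

  fibre : Assignment → Fin m × List (Fin n) → Bool
  fibre ω (b , xs) = all (λ x → does (lookup ω x ≟ b)) xs

  heavyFibres : List (Fin m × List (Fin n))
  heavyFibres = concatMap (λ b → map (b ,_) (combos K (allFin n))) (allFin m)

  Tangle : Set
  Tangle = List (Fin m) × List (Fin m) × List (Fin n)

  tangles : List Tangle
  tangles = concatMap (λ 𝒜 → concatMap (λ ℬ → map (λ I → 𝒜 , ℬ , I) (allLists i (cells P 𝒜))) (allLists a (allFin m))) (allLists a (allFin m))

  tangled : Assignment → Tangle → Bool
  tangled ω (𝒜 , ℬ , I) = does (distinct? _≟_ I) ∧ all (λ v → memᵇ (lookup ω v) ℬ) I

  #Ω = m ^ n

  instance
    m-nonZero : NonZero m
    m-nonZero = >-nonZero m≥1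

  -- A block and a set of K = Λ + 1 vertices can be chosen in at most m n^K / K! ways, and the set
  -- falls into the block with probability m^(-K); n ≤ ρm leaves m ρ^K / K!.
  overload-count : 4 * count (λ ω → any (fibre ω) heavyFibres) (vecs m n) ≤ #Ω
  overload-count = *-cancelʳ-≤ _ _ (K !) {{>-nonZero (1≤n! K)}} (*-cancelʳ-≤ _ _ (m ^ K) {{m^n≢0 m K}} (begin
    4 * cnt * K ! * m ^ K
      ≡⟨ e₁ cnt (K !) (m ^ K) ⟩
    4 * (cnt * m ^ K * K !)
      ≤⟨ *-monoʳ-≤ 4 (*-monoˡ-≤ (K !) (*-monoˡ-≤ (m ^ K) (count-any (vecs m n) heavyFibres fibre))) ⟩
    4 * (∑ heavyFibres mass * m ^ K * K !)
      ≡⟨ cong (λ t → 4 * (t * K !)) (sym (∑-*ʳ heavyFibres (m ^ K) mass)) ⟩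
    4 * (∑ heavyFibres (λ Y → mass Y * m ^ K) * K !)
      ≤⟨ *-monoʳ-≤ 4 (*-monoˡ-≤ (K !) (∑-bound heavyFibres #Ω each)) ⟩
    4 * (length heavyFibres * #Ω * K !)
      ≡⟨ cong (λ l → 4 * (l * #Ω * K !)) len ⟩
    4 * (m * C * #Ω * K !)
      ≡⟨ e₂ m C #Ω (K !) ⟩
    4 * (m * #Ω * (K ! * C))
      ≤⟨ *-monoʳ-≤ 4 (*-monoʳ-≤ (m * #Ω) (≤-trans (combos-length K (allFin n)) (^-monoˡ-≤ K (≤-trans (≤-reflexive (length-allFin n)) n≤)))) ⟩
    4 * (m * #Ω * (ρ * m) ^ K)
      ≡⟨ cong (λ t → 4 * (m * #Ω * t)) (^-distribʳ-* K ρ m) ⟩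
    4 * (m * #Ω * (ρ ^ K * m ^ K))
      ≡⟨ e₃ m #Ω (ρ ^ K) (m ^ K) ⟩
    4 * (m * ρ ^ K) * (#Ω * m ^ K)
      ≤⟨ *-monoˡ-≤ (#Ω * m ^ K) few-overloads ⟩
    K ! * (#Ω * m ^ K)
      ≡⟨ e₄ (K !) #Ω (m ^ K) ⟩
    #Ω * K ! * m ^ K ∎))
    where
    open ≤-Reasoning
    cnt = count (λ ω → any (fibre ω) heavyFibres) (vecs m n)
    C = length (combos K (allFin n))
    mass : Fin m × List (Fin n) → ℕ
    mass Y = count (λ ω → fibre ω Y) (vecs m n)
    e₁ : ∀ a b c → 4 * a * b * c ≡ 4 * (a * c * b)
    e₁ = solve-∀
    e₂ : ∀ m c w k → 4 * (m * c * w * k) ≡ 4 * (m * w * (k * c))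
    e₂ = solve-∀
    e₃ : ∀ m w r k → 4 * (m * w * (r * k)) ≡ 4 * (m * r) * (w * k)
    e₃ = solve-∀
    e₄ : ∀ k w x → k * (w * x) ≡ w * k * x
    e₄ = solve-∀
    len : length heavyFibres ≡ m * C
    len = trans (sym (∑1 heavyFibres)) (trans (∑-concatMap _ (allFin m) (λ _ → 1))
      (trans (∑-cong (allFin m) (λ b → trans (∑1 (map (b ,_) (combos K (allFin n)))) (length-map (b ,_) (combos K (allFin n)))))
      (trans (∑-const (allFin m) C) (cong (_* C) (length-allFin m)))))
    each : ∀ Y → Y ∈ heavyFibres → mass Y * m ^ K ≤ #Ω
    each Y Y∈ with ∈-concatMap⁻′ _ (allFin m) Y∈
    ... | b , _ , m₁ with ∈-map⁻ (b ,_) m₁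
    ...   | xs , xs∈ , refl with combos-unique K (allFin n) (Uniq.allFin⁺ n) xs∈
    ...     | u , _ , lx = begin
      mass (b , xs) * m ^ K
        ≡⟨ cong (λ k → mass (b , xs) * m ^ k) (sym lx) ⟩
      mass (b , xs) * m ^ length xs
        ≡⟨ count-same id (λ c → does (c ≟ b)) xs (subst Unique (sym (map-id′ xs)) u) ⟩
      #Ω * count (λ c → does (c ≟ b)) (allFin m) ^ length xs
        ≤⟨ *-monoʳ-≤ #Ω (^-monoˡ-≤ (length xs) one) ⟩
      #Ω * 1 ^ length xs
        ≡⟨ trans (cong (#Ω *_) (^-zeroˡ (length xs))) (*-identityʳ #Ω) ⟩
      #Ω ∎
      where
      one : count (λ c → does (c ≟ b)) (allFin m) ≤ 1
      one = ≤-trans (count-mono (allFin m) (λ c _ e → memᵇ-intro (here (dec-true (c ≟ b) e)))) (memᵇ-count (b ∷ []))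

  -- The cells are chosen in m^(2a) ways and the vertices, inside the chosen parts, in at most
  -- (aΛ)^i; they all land in the chosen blocks with probability at most (a / m)^i.
  tangle-count : 4 * count (λ ω → any (tangled ω) tangles) (vecs m n) ≤ #Ω
  tangle-count = *-cancelʳ-≤ _ _ (m ^ i) {{m^n≢0 m i}} (begin
    4 * cnt * m ^ i
      ≡⟨ *-assoc 4 cnt (m ^ i) ⟩
    4 * (cnt * m ^ i)
      ≤⟨ *-monoʳ-≤ 4 (*-monoˡ-≤ (m ^ i) (count-any (vecs m n) tangles tangled)) ⟩
    4 * (∑ tangles mass * m ^ i)
      ≡⟨ cong (4 *_) (sym (∑-*ʳ tangles (m ^ i) mass)) ⟩
    4 * ∑ tangles (λ Y → mass Y * m ^ i)
      ≤⟨ *-monoʳ-≤ 4 (∑-bound tangles (#Ω * a ^ i) each) ⟩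
    4 * (length tangles * (#Ω * a ^ i))
      ≤⟨ *-monoʳ-≤ 4 (*-monoˡ-≤ (#Ω * a ^ i) len) ⟩
    4 * (m ^ a * (m ^ a * (a * Λ) ^ i) * (#Ω * a ^ i))
      ≡⟨ e₁ (m ^ a) ((a * Λ) ^ i) #Ω (a ^ i) ⟩
    #Ω * (4 * (m ^ a * (m ^ a * ((a * Λ) ^ i * a ^ i))))
      ≤⟨ *-monoʳ-≤ #Ω few-tangles ⟩
    #Ω * m ^ i ∎)
    where
    open ≤-Reasoning
    cnt = count (λ ω → any (tangled ω) tangles) (vecs m n)
    mass : Tangle → ℕ
    mass Y = count (λ ω → tangled ω Y) (vecs m n)
    Ls = allLists a (allFin m)
    e₁ : ∀ x y w z → 4 * (x * (x * y) * (w * z)) ≡ w * (4 * (x * (x * (y * z))))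
    e₁ = solve-∀
    lenLs : length Ls ≡ m ^ a
    lenLs = trans (length-allLists a (allFin m)) (cong (_^ a) (length-allFin m))
    len : length tangles ≤ m ^ a * (m ^ a * (a * Λ) ^ i)
    len = begin
      length tangles
        ≡⟨ trans (sym (∑1 tangles)) (∑-concatMap _ Ls (λ _ → 1)) ⟩
      ∑ Ls (λ 𝒜 → ∑ (concatMap (λ ℬ → map (λ I → 𝒜 , ℬ , I) (allLists i (cells P 𝒜))) Ls) (λ _ → 1))
        ≤⟨ ∑-bound Ls (m ^ a * (a * Λ) ^ i) (λ 𝒜 𝒜∈ → ≤-trans (≤-reflexive (∑-concatMap _ Ls (λ _ → 1)))
             (≤-trans (∑-bound Ls ((a * Λ) ^ i) (λ ℬ _ → one 𝒜 ℬ (proj₁ (∈-allLists-length a (allFin m) 𝒜∈)))) (≤-reflexive (cong (_* (a * Λ) ^ i) lenLs)))) ⟩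
      length Ls * (m ^ a * (a * Λ) ^ i)
        ≡⟨ cong (_* (m ^ a * (a * Λ) ^ i)) lenLs ⟩
      m ^ a * (m ^ a * (a * Λ) ^ i) ∎
      where
      one : ∀ 𝒜 ℬ → length 𝒜 ≡ a → ∑ (map (λ I → 𝒜 , ℬ , I) (allLists i (cells P 𝒜))) (λ _ → 1) ≤ (a * Λ) ^ i
      one 𝒜 ℬ e = ≤-trans (≤-reflexive (trans (∑1 (map (λ I → 𝒜 , ℬ , I) (allLists i (cells P 𝒜)))) (trans (length-map (λ I → 𝒜 , ℬ , I) (allLists i (cells P 𝒜))) (length-allLists i (cells P 𝒜)))))
        (^-monoˡ-≤ i (≤-trans (cells-length P loadP 𝒜) (≤-reflexive (cong (_* Λ) e))))
    each : ∀ Y → Y ∈ tangles → mass Y * m ^ i ≤ #Ω * a ^ i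
    each Y Y∈ with ∈-concatMap⁻′ _ Ls Y∈
    ... | 𝒜 , 𝒜∈ , m₁ with ∈-concatMap⁻′ _ Ls m₁
    ...   | ℬ , ℬ∈ , m₂ with ∈-map⁻ (λ I → 𝒜 , ℬ , I) m₂
    ...     | I , I∈ , refl with distinct? _≟_ I
    ...       | no _ = ≤-trans (≤-reflexive (cong (_* m ^ i) (trans (∑-const (vecs m n) 0) (*-zeroʳ (length (vecs m n)))))) z≤n
    ...       | yes u = begin
      count (λ ω → all (λ v → memᵇ (lookup ω v) ℬ) I) (vecs m n) * m ^ i
        ≡⟨ cong (λ k → count (λ ω → all (λ v → memᵇ (lookup ω v) ℬ) I) (vecs m n) * m ^ k) (sym lI) ⟩
      count (λ ω → all (λ v → memᵇ (lookup ω v) ℬ) I) (vecs m n) * m ^ length I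
        ≡⟨ count-same id (λ c → memᵇ c ℬ) I (subst Unique (sym (map-id′ I)) u) ⟩
      #Ω * count (λ c → memᵇ c ℬ) (allFin m) ^ length I
        ≤⟨ *-monoʳ-≤ #Ω (^-monoˡ-≤ (length I) (≤-trans (memᵇ-count ℬ) (≤-reflexive (proj₁ (∈-allLists-length a (allFin m) ℬ∈))))) ⟩
      #Ω * a ^ length I
        ≡⟨ cong (λ k → #Ω * a ^ k) lI ⟩
      #Ω * a ^ i ∎
      where
      lI : length I ≡ i
      lI = proj₁ (∈-allLists-length i (cells P 𝒜) I∈)

  acceptable : Assignment → Bool
  acceptable ω = not (any (fibre ω) heavyFibres) ∧ not (any (tangled ω) tangles)

  some-acceptable : any acceptable (vecs m n) ≡ true
  some-acceptable with any acceptable (vecs m n) in eq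
  ... | true = refl
  ... | false = ⊥-elim (<-irrefl refl (begin-strict
      2 * #Ω <⟨ *-monoˡ-< #Ω {{m^n≢0 m n}} {2} {4} (s≤s (s≤s (s≤s z≤n))) ⟩
      4 * #Ω ≡⟨ cong (4 *_) (sym (∑-vecs-1 m n)) ⟩
      4 * ∑ (vecs m n) (λ _ → 1)
        ≤⟨ *-monoʳ-≤ 4 (∑-mono (vecs m n) (λ ω ω∈ → bad (any (fibre ω) heavyFibres) (any (tangled ω) tangles) (any-false acceptable eq ω∈))) ⟩
      4 * ∑ (vecs m n) (λ ω → ⟦ any (fibre ω) heavyFibres ⟧ + ⟦ any (tangled ω) tangles ⟧)
        ≡⟨ trans (cong (4 *_) (∑-+ (vecs m n) _ _)) (*-distribˡ-+ 4 (count (λ ω → any (fibre ω) heavyFibres) (vecs m n)) (count (λ ω → any (tangled ω) tangles) (vecs m n))) ⟩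
      4 * count (λ ω → any (fibre ω) heavyFibres) (vecs m n) + 4 * count (λ ω → any (tangled ω) tangles) (vecs m n)
        ≤⟨ +-mono-≤ overload-count tangle-count ⟩
      #Ω + #Ω ≡⟨ cong (#Ω +_) (sym (+-identityʳ #Ω)) ⟩
      2 * #Ω ∎))
    where
    open ≤-Reasoning
    bad : ∀ a b → not a ∧ not b ≡ false → 1 ≤ ⟦ a ⟧ + ⟦ b ⟧
    bad true  _    _ = s≤s z≤n
    bad false true _ = s≤s z≤n

  blocks : Σ (Fin n → Fin m) λ B → Load B Λ × Transversal P B a i
  blocks with any-elim acceptable (vecs m n) some-acceptable
  ... | ω , _ , acc = lookup ω , load , transversal
    where
    no-heavy : any (fibre ω) heavyFibres ≡ false
    no-heavy = not-true (∧-elim₁ acc)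
    no-tangle : any (tangled ω) tangles ≡ false
    no-tangle = not-true (∧-elim₂ {not (any (fibre ω) heavyFibres)} acc)
    load : Load (lookup ω) Λ
    load b xs u h with length xs ≤? Λ
    ... | yes le = le
    ... | no gt with combos-keep K (λ v → memᵇ v xs) (allFin n) (≤-trans (≰⇒> gt) (≤-trans
                 (unique-length u (λ {v} v∈ → keep-∈ _ (∈allFin v) (memᵇ-intro v∈))) (≤-reflexive (length-keep _ (allFin n)))))
    ...   | ys , ys∈ , sub = true≢false (any-intro (fibre ω) (∈-concatMap⁺′ (∈allFin b) (∈-map⁺ (b ,_) ys∈))
              (all-intro _ ys (λ y y∈ → true-dec (lookup ω y ≟ b) (h (memᵇ-true (proj₂ (sub y∈))))))) no-heavy
    transversal : Transversal P (lookup ω) a i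
    transversal I 𝒜 ℬ u lI l𝒜 lℬ hP hB = true≢false (any-intro (tangled ω)
      (∈-concatMap⁺′ (list 𝒜 l𝒜) (∈-concatMap⁺′ (list ℬ lℬ) (∈-map⁺ (λ I → 𝒜 , ℬ , I)
        (subst (λ k → I ∈ allLists k (cells P 𝒜)) lI (∈-allLists I (λ v∈ → ∈-cells P {𝒜} (hP v∈)))))))
      (∧-intro (true-dec (distinct? _≟_ I) u) (all-intro _ I (λ v v∈ → memᵇ-intro (hB v∈))))) no-tangle
      where
      list : ∀ L → length L ≡ a → L ∈ allLists a (allFin m)
      list L e = subst (λ k → L ∈ allLists k (allFin m)) e (∈-allLists L (λ {b} _ → ∈allFin b))

-- The graph after deletion

increasing-image : ∀ {k n} (f : Fin k → Fin n) → (∀ i j → f i ≡ f j → i ≡ j) →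
  ∃ λ L → length L ≡ k × AllPairs (λ a b → toℕ a < toℕ b) L × (∀ {v} → v ∈ L → ∃ λ i → v ≡ f i)
-- Filtering `allFin n` sorts the image; `take k` fixes the length, for which the lower bound `k≤`
-- is at hand.
increasing-image {k} {n} f inj = take k L , trans (length-take k L) (m≤n⇒m⊓n≡m k≤) , AllPairsₚ.take⁺ k sorted ,
    λ v∈ → ∈-tabulate⁻ (memᵇ-true (proj₂ (∈-keep p (allFin n) (take-⊑ k L v∈))))
  where
  p : Fin n → Bool
  p v = memᵇ v (tabulate f)
  L = keep p (allFin n)
  sorted : AllPairs (λ a b → toℕ a < toℕ b) L
  sorted = AllPairs-keep p (AllPairsₚ.tabulate⁺-< (λ lt → lt))
  k≤ : k ≤ length L
  k≤ = subst (_≤ length L) (length-tabulate f) (unique-length (Uniq.tabulate⁺ (λ e → inj _ _ e))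
    (λ {v} v∈ → keep-∈ p (∈allFin v) (memᵇ-intro v∈)))

lookup-pair : ∀ {A : Set} {R : A → A → Set} {S : A → A → Set} xs → AllPairs R xs →
  (∀ {a b} → a ∈ xs → b ∈ xs → R a b → S a b) → AllPairs S xs
lookup-pair [] [] h = []
lookup-pair (x ∷ xs) (p ∷ ps) h =
  All.tabulate (λ b∈ → h (here refl) (there b∈) (All.lookup p b∈)) ∷ lookup-pair xs ps (λ a b → h (there a) (there b))

module DeletedGraph {n m : ℕ} (c K : ℕ) (P B : Fin n → Fin m) (H : Fin m × Fin m → Bool) where

  open Copies c P B
  open Graphs c K P B

  before : Fin n → Fin n → Bool
  before v v′ = does (toℕ v <? toℕ v′)

  arrow : Fin n → Fin n → Bool
  arrow v v′ = before v v′ ∧ (separated v v′ ∧ (H (P v , B v′) ∧ not (closed H v v′)))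

  graph : Graph n
  graph = record
    { adj    = λ v v′ → arrow v v′ ∨ arrow v′ v
    ; sym    = λ v v′ → ∨-swap (arrow v v′) (arrow v′ v)
    ; irrefl = λ v → no-loop (before v v) (separated v v ∧ (H (P v , B v) ∧ not (closed H v v))) (irr v)
    }
    where
    ∨-swap : ∀ a b → a ∨ b ≡ b ∨ a
    ∨-swap true  true  = refl
    ∨-swap true  false = refl
    ∨-swap false true  = refl
    ∨-swap false false = refl
    no-loop : ∀ b d → b ≡ false → (b ∧ d) ∨ (b ∧ d) ≡ false
    no-loop false d refl = refl
    irr : ∀ v → before v v ≡ false
    irr v = false-dec (toℕ v <? toℕ v) (<-irrefl refl)

  not-before : ∀ {v v′} → toℕ v < toℕ v′ → before v′ v ≡ false
  not-before {v} {v′} lt = false-dec (toℕ v′ <? toℕ v) (<-asym lt)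

  adjacent⇒arrow : ∀ {v v′} → toℕ v < toℕ v′ → adj graph v v′ ≡ true → arrow v v′ ≡ true
  adjacent⇒arrow {v} {v′} lt e with ∨-elim {arrow v v′} e
  ... | inj₁ a = a
  ... | inj₂ a = true≢false (∧-elim₁ a) (not-before lt)

  nonadjacent⇒missing : ∀ {v v′} → toℕ v < toℕ v′ → adj graph v v′ ≡ false → missing H v v′ ≡ true
  nonadjacent⇒missing {v} {v′} lt e = de-morgan (before v v′) (separated v v′) (H (P v , B v′)) (closed H v v′) (arrow v′ v)
      (true-dec (toℕ v <? toℕ v′) lt) e
    where
    de-morgan : ∀ l s h k d → l ≡ true → (l ∧ (s ∧ (h ∧ not k))) ∨ d ≡ false → not s ∨ (not h ∨ k) ≡ true
    de-morgan true false h     k     d refl e = refl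
    de-morgan true true  false k     d refl e = refl
    de-morgan true true  true  true  d refl e = refl

  separated-P : ∀ {v v′} → separated v v′ ≡ true → P v ≢ P v′
  separated-P {v} {v′} s e = true≢false (true-dec (P v ≟ P v′) e) (not-true (∧-elim₁ s))

  separated-B : ∀ {v v′} → separated v v′ ≡ true → B v ≢ B v′
  separated-B {v} {v′} s e = true≢false (true-dec (B v ≟ B v′) e) (not-true (∧-elim₂ {not (does (P v ≟ P v′))} s))

  stair-on : ∀ a L e → AllPairs (λ v v′ → arrow v v′ ≡ true) (a ∷ L ++ e ∷ []) →
    all H (stair (map P (a ∷ L)) (map B L ++ B e ∷ [])) ≡ true
  stair-on a L e (row ∷ rest) = all-intro H (stair (map P (a ∷ L)) (map B L ++ B e ∷ [])) (λ g g∈ → go L row rest g∈)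
    where
    on-arrow : ∀ {v v′} → arrow v v′ ≡ true → H (P v , B v′) ≡ true
    on-arrow {v} {v′} r = ∧-elim₁ (∧-elim₂ {separated v v′} (∧-elim₂ {before v v′} r))
    row-on : ∀ {a} L → All (λ v′ → arrow a v′ ≡ true) (L ++ e ∷ []) → ∀ {b} → b ∈ map B L ++ B e ∷ [] → H (P a , b) ≡ true
    row-on []      (r ∷ [])  (here refl) = on-arrow r
    row-on (v ∷ L) (r ∷ rs) (here refl) = on-arrow r
    row-on (v ∷ L) (r ∷ rs) (there m)   = row-on L rs m
    go : ∀ {a} L → All (λ v′ → arrow a v′ ≡ true) (L ++ e ∷ []) → AllPairs (λ v v′ → arrow v v′ ≡ true) (L ++ e ∷ []) →
      ∀ {g} → g ∈ stair (map P (a ∷ L)) (map B L ++ B e ∷ []) → H g ≡ true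
    go {a} [] row rest (here refl) = row-on [] row (here refl)
    go {a} (v ∷ L) row (row′ ∷ rest) g∈ with ∈-++⁻ (map (P a ,_) (map B (v ∷ L) ++ B e ∷ [])) g∈
    ... | inj₂ m = go L row′ rest m
    ... | inj₁ m with ∈-map⁻ (P a ,_) m
    ...   | b , b∈ , refl = row-on (v ∷ L) row b∈

  AllPairs-init : ∀ {A : Set} {R : A → A → Set} L {e} → AllPairs R (L ++ e ∷ []) → AllPairs R L
  AllPairs-init [] _ = []
  AllPairs-init (x ∷ L) (p ∷ ps) = All.tabulate (λ m → All.lookup p (∈-++⁺ˡ m)) ∷ AllPairs-init L ps

  AllPairs-map : ∀ {A C : Set} (f : A → C) {xs} → AllPairs (λ a b → f a ≢ f b) xs → Unique (map f xs)
  AllPairs-map f {[]} [] = []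
  AllPairs-map f {x ∷ xs} (p ∷ ps) = all-∉ (λ m → case ∈-map⁻ f m of λ { (y , y∈ , e) → All.lookup p y∈ e }) ∷ AllPairs-map f ps

  -- The arrows of a clique x₁ < ... < x_s keep its parts and blocks distinct and put all its edges
  -- into `H`. So it is a valid copy through x₂ and x₃, and the arrow between these two should have
  -- been deleted.
  clique-free : ¬ HasClique graph (4 + c)
  clique-free (f , inj , cl) with increasing-image f inj
  ... | L , lenL , inc , img = go L lenL (lookup-pair L inc step)
    where
    step : ∀ {a b} → a ∈ L → b ∈ L → toℕ a < toℕ b → arrow a b ≡ true
    step a∈ b∈ lt with img a∈ | img b∈
    ... | i , refl | j , refl = adjacent⇒arrow lt (cl i j (λ { refl → <-irrefl refl lt }))
    go : ∀ L → length L ≡ 4 + c → AllPairs (λ a b → arrow a b ≡ true) L → ⊥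
    go (x₁ ∷ x₂ ∷ x₃ ∷ rest) len ap with initLast rest
    go (x₁ ∷ x₂ ∷ x₃ ∷ .[]) () ap | []
    go (x₁ ∷ x₂ ∷ x₃ ∷ .(vs ++ e ∷ [])) len ap@(_ ∷ ap′@((a₂₃ ∷ _) ∷ _)) | vs ∷ʳ′ e =
      true≢false closed₂₃ (not-true (∧-elim₂ {H (P x₂ , B x₃)} (∧-elim₂ {separated x₂ x₃} (∧-elim₂ {before x₂ x₃} a₂₃))))
      where
      τ : Copy
      τ = P x₁ , vs , B e
      lenvs : length vs ≡ c
      lenvs = +-cancelʳ-≡ 1 (length vs) c (trans (sym (length-++ vs)) (trans (suc-injective (suc-injective (suc-injective len))) (+-comm 1 c)))
      sep : ∀ {v v′} → arrow v v′ ≡ true → separated v v′ ≡ true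
      sep {v} {v′} r = ∧-elim₁ (∧-elim₂ {before v v′} r)
      uP : Unique (partsOf x₂ x₃ τ)
      uP = AllPairs-map P (AllPairs-init (x₁ ∷ x₂ ∷ x₃ ∷ vs) (AllPairs.map (λ r → separated-P (sep r)) ap))
      map-snoc : ∀ (us : List (Fin n)) → map B (us ++ e ∷ []) ≡ map B us ++ B e ∷ []
      map-snoc []       = refl
      map-snoc (u ∷ us) = cong (B u ∷_) (map-snoc us)
      uB : Unique (blocksOf x₂ x₃ τ)
      uB = subst Unique (map-snoc (x₂ ∷ x₃ ∷ vs)) (AllPairs-map B (AllPairs.map (λ r → separated-B (sep r)) ap′))
      closed₂₃ : closed H x₂ x₃ ≡ true
      closed₂₃ = closed-intro (∈-copies (P x₁) vs (B e) lenvs) (valid-intro uP uB)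
        (subst (λ L → all H L ≡ true) (sym (edges-stair x₂ x₃ τ)) (stair-on x₁ (x₂ ∷ x₃ ∷ vs) e ap))

  independent-list : ∀ {t} → HasIndependentSet graph t →
    ∃ λ L → length L ≡ t × AllPairs (λ a b → toℕ a < toℕ b) L × AllPairs (λ a b → missing H a b ≡ true) L
  independent-list (f , inj , ind) with increasing-image f inj
  ... | L , lenL , inc , img = L , lenL , inc , lookup-pair L inc step
    where
    step : ∀ {a b} → a ∈ L → b ∈ L → toℕ a < toℕ b → missing H a b ≡ true
    step a∈ b∈ lt with img a∈ | img b∈
    ... | i , refl | j , refl = nonadjacent⇒missing lt (ind i j (λ { refl → <-irrefl refl lt }))

-- Finding a configuration inside an independent set

module Chains {n m : ℕ} (P B : Fin n → Fin m) {Λ a i R k : ℕ} (loadP : Load P Λ) (loadB : Load B Λ)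
  (transversal : Transversal P B a i) (m≥1 : 1 ≤ m) (a≥1 : 1 ≤ a) (R≥1 : 1 ≤ R) (i≥1 : 1 ≤ i) (i≤aΛ : i ≤ a * Λ) (steep : Λ < R ^ k)
  (S : Fin n → Fin n → Set)
  where

  -- The representatives W and X are covered by A cells of one of the two partitions; A is what the union
  -- bound pays for, and the area |W||X| exceeds A by the factor a / 2R.
  record Config (Q : Fin n → Fin m) : Set where
    field
      A     : ℕ
      A≥1   : 1 ≤ A
      cs    : List (Fin m)
      W X   : List (Fin n)
      uW    : Unique W
      uX    : Unique X
      injP  : InjOn P W
      injB  : InjOn B X
      linked : ∀ {w x} → w ∈ W → x ∈ X → S w x
      covW  : ∀ {v} → v ∈ W → Q v ∈ cs
      covX  : ∀ {v} → v ∈ X → Q v ∈ cs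
      lenA  : length cs ≡ A
      A≤W   : A ≤ 2 * R * length W
      A≤X   : A ≤ 2 * R * length X
      area  : A * a ≤ 2 * R * (length W * length X)
      A≤    : A ≤ 2 * R * a
      bigW  : i ≤ length W * Λ
      bigX  : i ≤ length X * Λ

  Interval : List (Fin n) → Set
  Interval I = Unique I × length I ≡ i

  Before : List (Fin n) → List (Fin n) → Set
  Before I J = ∀ {x y} → x ∈ I → y ∈ J → S x y

  #parts #blocks : List (Fin n) → ℕ
  #parts  I = length (reps _≟_ P I)
  #blocks I = length (reps _≟_ B I)

  reps-load : ∀ {f : Fin n → Fin m} → Load f Λ → ∀ {I} → Interval I → i ≤ length (reps _≟_ f I) * Λ
  reps-load {f} load {I} (u , e) = subst (_≤ length (reps _≟_ f I) * Λ) e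
    (≤-trans (load-cover _≟_ f load I (map f (reps _≟_ f I)) u (reps-cover _≟_ f I)) (≤-reflexive (cong (_* Λ) (length-map f (reps _≟_ f I)))))

  reps-length : ∀ {f : Fin n → Fin m} {I} → Interval I → length (reps _≟_ f I) ≤ i
  reps-length {f} {I} (u , e) = ≤-trans (unique-length (unique-of-map f (reps-unique _≟_ f I)) (reps-⊑ _≟_ f I)) (≤-reflexive e)

  anElement : ∃ λ (p : Fin m) → p ∈ allFin m
  anElement = go m≥1
    where
    go : ∀ {m} → 1 ≤ m → ∃ λ (p : Fin m) → p ∈ allFin m
    go (s≤s _) = Fin.zero , here refl

  -- Covers are enumerated by lists of exact length, so shorter ones are filled up with an arbitrary
  -- cell.
  pad : (L : List (Fin m)) (A : ℕ) → List (Fin m)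
  pad L A = L ++ replicate (A ∸ length L) (proj₁ anElement)

  pad-length : ∀ L A → length L ≤ A → length (pad L A) ≡ A
  pad-length L A le = trans (length-++ L) (trans (cong (length L +_) (length-replicate (A ∸ length L))) (m+[n∸m]≡n le))

  -- Otherwise the parts and the blocks that meet `I`, padded to a of each, would contradict general
  -- position.
  dichotomy : ∀ {I} → Interval I → a ≤ #parts I ⊎ a ≤ #blocks I
  dichotomy {I} (u , e) with a ≤? #parts I | a ≤? #blocks I
  ... | yes p | _     = inj₁ p
  ... | no _  | yes p = inj₂ p
  ... | no p  | no q  = ⊥-elim (transversal I (pad (map P (reps _≟_ P I)) a) (pad (map B (reps _≟_ B I)) a) u e
          (pad-length (map P (reps _≟_ P I)) a (≤-trans (≤-reflexive (length-map P (reps _≟_ P I))) (<⇒≤ (≰⇒> p))))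
          (pad-length (map B (reps _≟_ B I)) a (≤-trans (≤-reflexive (length-map B (reps _≟_ B I))) (<⇒≤ (≰⇒> q))))
          (λ v∈ → ∈-++⁺ˡ (reps-cover _≟_ P I v∈)) (λ v∈ → ∈-++⁺ˡ (reps-cover _≟_ B I v∈)))

  some : (f : Fin n → Fin m) (I : List (Fin n)) → a ≤ length (reps _≟_ f I) →
    ∃ λ W → Unique W × InjOn f W × W ⊑ I × length W ≡ a
  some f I le = take a (reps _≟_ f I) ,
    AllPairsₚ.take⁺ a (unique-of-map f (reps-unique _≟_ f I)) ,
    (λ x∈ y∈ → unique-map-inj f (reps-unique _≟_ f I) (take-⊑ a _ x∈) (take-⊑ a _ y∈)) ,
    (λ x∈ → reps-⊑ _≟_ f I (take-⊑ a _ x∈)) ,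
    trans (length-take a (reps _≟_ f I)) (m≤n⇒m⊓n≡m le)

  a≤2Ra : ∀ b → b ≤ 2 * R * b
  a≤2Ra b = ≤-trans (≤-reflexive (sym (*-identityˡ b))) (*-monoˡ-≤ b (*-mono-≤ {1} {2} (s≤s z≤n) R≥1))

  2≤2R : 2 ≤ 2 * R
  2≤2R = *-mono-≤ {2} {2} ≤-refl R≥1

  reps≥1 : ∀ {f : Fin n → Fin m} → Load f Λ → ∀ {I} → Interval I → 1 ≤ length (reps _≟_ f I)
  reps≥1 {f} load {I} int with length (reps _≟_ f I) | reps-load {f} load int
  ... | zero  | h = ⊥-elim (<-irrefl refl (≤-trans i≥1 h))
  ... | suc _ | h = s≤s z≤n

  -- With a representatives on either side, even one cell per vertex is affordable: A = 2a against
  -- the area a².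
  mixed : ∀ {I J} → Interval I → Interval J → Before I J → a ≤ #parts I → a ≤ #blocks J → Config P
  mixed {I} {J} iI iJ bef aI bJ with some P I aI | some B J bJ
  ... | W , uW , injW , W⊑ , lW | X , uX , injX , X⊑ , lX = record
    { A = 2 * a ; A≥1 = ≤-trans a≥1 (m≤m+n a _) ; cs = map P (W ++ X) ; W = W ; X = X ; uW = uW ; uX = uX ; injP = injW ; injB = injX
    ; linked = λ w∈ x∈ → bef (W⊑ w∈) (X⊑ x∈)
    ; covW = λ v∈ → ∈-map⁺ P (∈-++⁺ˡ v∈) ; covX = λ v∈ → ∈-map⁺ P (∈-++⁺ʳ W v∈)
    ; lenA = trans (length-map P (W ++ X)) (trans (length-++ W) (trans (cong₂ _+_ lW lX) (cong (a +_) (sym (+-identityʳ a)))))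
    ; A≤W = subst (λ l → 2 * a ≤ 2 * R * l) (sym lW) 2a≤
    ; A≤X = subst (λ l → 2 * a ≤ 2 * R * l) (sym lX) 2a≤
    ; area = subst (λ l → 2 * a * a ≤ 2 * R * l) (sym (cong₂ _*_ lW lX)) (≤-trans (≤-reflexive (*-assoc 2 a a)) (*-monoˡ-≤ (a * a) 2≤2R))
    ; A≤ = 2a≤
    ; bigW = subst (λ l → i ≤ l * Λ) (sym lW) i≤aΛ
    ; bigX = subst (λ l → i ≤ l * Λ) (sym lX) i≤aΛ }
    where
    2a≤ : 2 * a ≤ 2 * R * a
    2a≤ = *-monoˡ-≤ a 2≤2R

  double : ∀ {b b′} → b′ ≤ R * b → b + b′ ≤ 2 * R * b
  double {b} {b′} le = ≤-trans (+-mono-≤ (≤-trans (≤-reflexive (sym (*-identityˡ b))) (*-monoˡ-≤ b R≥1)) le) (≤-reflexive (e R b))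
    where
    e : ∀ R b → R * b + R * b ≡ 2 * R * b
    e = solve-∀

  -- `W` represents all parts of `I`, and `X` a blocks of `J`. As `J` meets at most R times as many
  -- parts as `I`, the cover has order R |W|, although `X` may be much larger than `W`.
  rising-pair : ∀ {I J} → Interval I → Interval J → Before I J → a ≤ #blocks J → #parts I ≤ a → #parts J ≤ R * #parts I → Config P
  rising-pair {I} {J} iI iJ bef bJ aI≤ rise with some B J bJ
  ... | X , uX , injX , X⊑ , lX = record
    { A = 2 * R * #parts I ; A≥1 = ≤-trans (reps≥1 loadP iI) (a≤2Ra (#parts I))
    ; cs = pad L (2 * R * #parts I) ; W = reps _≟_ P I ; X = X
    ; uW = unique-of-map P (reps-unique _≟_ P I) ; uX = uX ; injP = unique-map-inj P (reps-unique _≟_ P I) ; injB = injX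
    ; linked = λ w∈ x∈ → bef (reps-⊑ _≟_ P I w∈) (X⊑ x∈)
    ; covW = λ v∈ → ∈-++⁺ˡ (∈-++⁺ˡ (∈-map⁺ P v∈))
    ; covX = λ v∈ → ∈-++⁺ˡ (∈-++⁺ʳ (map P (reps _≟_ P I)) (reps-cover _≟_ P J (X⊑ v∈)))
    ; lenA = pad-length L _ (≤-trans (≤-reflexive (trans (length-++ (map P (reps _≟_ P I)))
        (cong₂ _+_ (length-map P (reps _≟_ P I)) (length-map P (reps _≟_ P J))))) (double rise))
    ; A≤W = ≤-refl
    ; A≤X = ≤-trans (*-monoʳ-≤ (2 * R) aI≤) (≤-reflexive (cong (2 * R *_) (sym lX)))
    ; area = ≤-reflexive (trans (*-assoc (2 * R) (#parts I) a) (cong (λ l → 2 * R * (#parts I * l)) (sym lX)))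
    ; A≤ = *-monoʳ-≤ (2 * R) aI≤
    ; bigW = reps-load loadP iI
    ; bigX = subst (λ l → i ≤ l * Λ) (sym lX) i≤aΛ }
    where
    L = map P (reps _≟_ P I) ++ map P (reps _≟_ P J)

  -- The mirror image of `rising-pair`: the later interval is the poor one, and the cover consists
  -- of blocks.
  falling-pair : ∀ {I J} → Interval I → Interval J → Before I J → a ≤ #parts I → #blocks J ≤ a → #blocks I ≤ R * #blocks J → Config B
  falling-pair {I} {J} iI iJ bef aI bJ≤ fall with some P I aI
  ... | W , uW , injW , W⊑ , lW = record
    { A = 2 * R * #blocks J ; A≥1 = ≤-trans (reps≥1 loadB iJ) (a≤2Ra (#blocks J))
    ; cs = pad L (2 * R * #blocks J) ; W = W ; X = reps _≟_ B J
    ; uW = uW ; uX = unique-of-map B (reps-unique _≟_ B J) ; injP = injW ; injB = unique-map-inj B (reps-unique _≟_ B J)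
    ; linked = λ w∈ x∈ → bef (W⊑ w∈) (reps-⊑ _≟_ B J x∈)
    ; covW = λ v∈ → ∈-++⁺ˡ (∈-++⁺ʳ (map B (reps _≟_ B J)) (reps-cover _≟_ B I (W⊑ v∈)))
    ; covX = λ v∈ → ∈-++⁺ˡ (∈-++⁺ˡ (∈-map⁺ B v∈))
    ; lenA = pad-length L _ (≤-trans (≤-reflexive (trans (length-++ (map B (reps _≟_ B J)))
        (cong₂ _+_ (length-map B (reps _≟_ B J)) (length-map B (reps _≟_ B I))))) (double fall))
    ; A≤W = ≤-trans (*-monoʳ-≤ (2 * R) bJ≤) (≤-reflexive (cong (2 * R *_) (sym lW)))
    ; A≤X = ≤-refl
    ; area = ≤-reflexive (trans (*-assoc (2 * R) (#blocks J) a) (cong (2 * R *_) (trans (*-comm (#blocks J) a) (cong (_* #blocks J) (sym lW)))))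
    ; A≤ = *-monoʳ-≤ (2 * R) bJ≤
    ; bigW = subst (λ l → i ≤ l * Λ) (sym lW) i≤aΛ
    ; bigX = reps-load loadB iJ }
    where
    L = map B (reps _≟_ B J) ++ map B (reps _≟_ B I)

  PartPoor BlockPoor : List (Fin n) → Set
  PartPoor  I = Interval I × #parts I < a
  BlockPoor I = Interval I × #blocks I < a

  part-poor : ∀ {I} → PartPoor I → a ≤ #blocks I
  part-poor (iI , lt) = [ (λ le → ⊥-elim (<-irrefl refl (≤-trans lt le))) , id ]′ (dichotomy iI)

  block-poor : ∀ {I} → BlockPoor I → a ≤ #parts I
  block-poor (iI , lt) = [ id , (λ le → ⊥-elim (<-irrefl refl (≤-trans lt le))) ]′ (dichotomy iI)

  -- If no consecutive pair is usable, the number of parts grows by the factor R at each step, which is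
  -- impossible because it always lies between i / Λ and i.
  rising : ∀ I Js → All PartPoor (I ∷ Js) → AllPairs Before (I ∷ Js) → Config P ⊎ R ^ length Js * #parts I ≤ i
  rising I [] ((iI , _) ∷ []) _ = inj₂ (≤-trans (≤-reflexive (+-identityʳ _)) (reps-length iI))
  rising I (J ∷ Js) (pI@(iI , I<) ∷ pJs@(pJ@(iJ , _) ∷ _)) ((bef ∷ _) ∷ ap) with #parts J ≤? R * #parts I
  ... | yes le = inj₁ (rising-pair iI iJ bef (part-poor pJ) (<⇒≤ I<) le)
  ... | no gt with rising J Js pJs ap
  ...   | inj₁ cfg = inj₁ cfg
  ...   | inj₂ le = inj₂ (≤-trans (≤-reflexive (e R (R ^ length Js) (#parts I))) (≤-trans (*-monoʳ-≤ (R ^ length Js) (<⇒≤ (≰⇒> gt))) le))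
    where
    e : ∀ R x p → R * x * p ≡ x * (R * p)
    e = solve-∀

  -- The mirror image of `rising`: without a usable pair the number of blocks shrinks by the factor
  -- R at each step, yet it cannot go below i / Λ.
  falling : ∀ I Js → All BlockPoor (I ∷ Js) → AllPairs Before (I ∷ Js) → Config B ⊎ i * R ^ length Js ≤ #blocks I * Λ
  falling I [] ((iI , _) ∷ []) _ = inj₂ (≤-trans (≤-reflexive (*-identityʳ i)) (reps-load loadB iI))
  falling I (J ∷ Js) (pI@(iI , _) ∷ pJs@(pJ@(iJ , J<) ∷ _)) ((bef ∷ _) ∷ ap) with #blocks I ≤? R * #blocks J
  ... | yes le = inj₁ (falling-pair iI iJ bef (block-poor pI) (<⇒≤ J<) le)
  ... | no gt with falling J Js pJs ap
  ...   | inj₁ cfg = inj₁ cfg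
  ...   | inj₂ le = inj₂ (≤-trans (≤-reflexive (e₁ i R (R ^ length Js))) (≤-trans (*-monoʳ-≤ R le)
            (≤-trans (≤-reflexive (sym (*-assoc R (#blocks J) Λ))) (*-monoˡ-≤ Λ (<⇒≤ (≰⇒> gt))))))
    where
    e₁ : ∀ i R x → i * (R * x) ≡ R * (i * x)
    e₁ = solve-∀

  find-or-all : (f : List (Fin n) → ℕ) → ∀ Is → All Interval Is →
    (∃ λ I → I ∈ Is × a ≤ f I) ⊎ All (λ I → Interval I × f I < a) Is
  find-or-all f [] [] = inj₂ []
  find-or-all f (I ∷ Is) (iI ∷ ints) with a ≤? f I
  ... | yes le = inj₁ (I , here refl , le)
  ... | no gt with find-or-all f Is ints
  ...   | inj₁ (J , J∈ , le) = inj₁ (J , there J∈ , le)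
  ...   | inj₂ all = inj₂ ((iI , ≰⇒> gt) ∷ all)

  AllPairs-++ : ∀ {A : Set} {T : A → A → Set} xs {ys} → AllPairs T (xs ++ ys) →
    AllPairs T xs × AllPairs T ys × (∀ {x y} → x ∈ xs → y ∈ ys → T x y)
  AllPairs-++ [] ap = [] , ap , λ ()
  AllPairs-++ (x ∷ xs) (p ∷ ps) with AllPairs-++ xs ps
  ... | ax , ay , cross = All.tabulate (λ m → All.lookup p (∈-++⁺ˡ m)) ∷ ax , ay ,
          λ { (here refl) y∈ → All.lookup p (∈-++⁺ʳ xs y∈) ; (there x∈) y∈ → cross x∈ y∈ }

  -- An early interval with many parts and a late one with many blocks form a mixed pair. Otherwise
  -- all early intervals are poor in parts or all late ones poor in blocks, and a chain of k steps
  -- without a usable pair would give R^k ≤ Λ.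
  configuration : ∀ Is Js → length Is ≡ suc k → length Js ≡ suc k → All Interval Is → All Interval Js → AllPairs Before (Is ++ Js) →
    Config P ⊎ Config B
  configuration Is Js lI lJ iIs iJs ap with AllPairs-++ Is ap
  ... | apI , apJ , cross with find-or-all #parts Is iIs
  ...   | inj₁ (I , I∈ , aI) with find-or-all #blocks Js iJs
  ...     | inj₁ (J , J∈ , bJ) = inj₁ (mixed (All.lookup iIs I∈) (All.lookup iJs J∈) (cross I∈ J∈) aI bJ)
  ...     | inj₂ poor = inj₂ (go Js lJ poor apJ)
    where
    go : ∀ Js → length Js ≡ suc k → All BlockPoor Js → AllPairs Before Js → Config B
    go (J ∷ Js) l poor@((iJ , _) ∷ _) ap with falling J Js poor ap
    ... | inj₁ cfg = cfg
    ... | inj₂ le = ⊥-elim (<-irrefl refl (<-≤-trans steep (*-cancelˡ-≤ i {{>-nonZero i≥1}}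
            (≤-trans (≤-reflexive (cong (λ l → i * R ^ l) (sym (suc-injective l)))) (≤-trans le (*-monoˡ-≤ Λ (reps-length iJ)))))))
  configuration Is Js lI lJ iIs iJs ap | apI , apJ , cross | inj₂ poor = inj₁ (go Is lI poor apI)
    where
    go : ∀ Is → length Is ≡ suc k → All PartPoor Is → AllPairs Before Is → Config P
    go (I ∷ Is) l poor@((iI , _) ∷ _) ap with rising I Is poor ap
    ... | inj₁ cfg = cfg
    ... | inj₂ le = ⊥-elim (<-irrefl refl (<-≤-trans steep (*-cancelʳ-≤ (R ^ k) Λ (#parts I) {{>-nonZero (reps≥1 loadP iI)}}
            (≤-trans (≤-reflexive (cong (λ l → R ^ l * #parts I) (sym (suc-injective l)))) (≤-trans le
              (≤-trans (reps-load loadP iI) (≤-reflexive (*-comm (#parts I) Λ))))))))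

  intervals : ℕ → List (Fin n) → List (List (Fin n))
  intervals zero    L = []
  intervals (suc j) L = take i L ∷ intervals j (drop i L)

  length-intervals : ∀ j L → length (intervals j L) ≡ j
  length-intervals zero    L = refl
  length-intervals (suc j) L = cong suc (length-intervals j (drop i L))

  intervals-⊑ : ∀ j L {J} → J ∈ intervals j L → J ⊑ L
  intervals-⊑ (suc j) L (here refl) x∈ = take-⊑ i L x∈
  intervals-⊑ (suc j) L (there J∈) x∈ = drop-⊑ i L (intervals-⊑ j (drop i L) J∈ x∈)

  take-drop : ∀ j L → AllPairs S L → ∀ {x y} → x ∈ take j L → y ∈ drop j L → S x y
  take-drop (suc j) (x ∷ L) (p ∷ ps) (here refl) y∈ = All.lookup p (drop-⊑ j L y∈)
  take-drop (suc j) (x ∷ L) (p ∷ ps) (there x∈) y∈ = take-drop j L ps x∈ y∈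

  intervals-before : ∀ j L → AllPairs S L → AllPairs Before (intervals j L)
  intervals-before zero    L ap = []
  intervals-before (suc j) L ap =
    All.tabulate (λ {J} J∈ {x} {y} x∈ y∈ → take-drop i L ap x∈ (intervals-⊑ j (drop i L) J∈ y∈))
    ∷ intervals-before j (drop i L) (AllPairsₚ.drop⁺ i ap)

  intervals-ok : ∀ j L → Unique L → j * i ≤ length L → All Interval (intervals j L)
  intervals-ok zero    L u le = []
  intervals-ok (suc j) L u le = (AllPairsₚ.take⁺ i u , trans (length-take i L) (m≤n⇒m⊓n≡m (≤-trans (m≤m+n i (j * i)) le)))
    ∷ intervals-ok j (drop i L) (AllPairsₚ.drop⁺ i u) (≤-trans (m+n≤o⇒n≤o∸m i le) (≤-reflexive (sym (length-drop i L))))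
    where
    m+n≤o⇒n≤o∸m : ∀ m {n o} → m + n ≤ o → n ≤ o ∸ m
    m+n≤o⇒n≤o∸m m {n} {o} h = ≤-trans (≤-reflexive (sym (m+n∸m≡n m n))) (∸-monoˡ-≤ m h)

  find-configuration : ∀ L → Unique L → AllPairs S L → 2 * suc k * i ≤ length L → Config P ⊎ Config B
  find-configuration L u ap le = configuration Is Js (length-intervals (suc k) L) (length-intervals (suc k) L′)
      (intervals-ok (suc k) L u (≤-trans (*-monoˡ-≤ i (m≤m+n (suc k) (suc k + 0))) le))
      (intervals-ok (suc k) L′ (AllPairsₚ.drop⁺ (suc k * i) u) (≤-trans (≤-reflexive (sym (m+n∸m≡n (suc k * i) (suc k * i))))
        (≤-trans (∸-monoˡ-≤ (suc k * i) (≤-trans (≤-reflexive (e (suc k) i)) le)) (≤-reflexive (sym (length-drop (suc k * i) L))))))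
      (joined (suc k) L ap)
    where
    e : ∀ k i → k * i + k * i ≡ 2 * k * i
    e = solve-∀
    L′ = drop (suc k * i) L
    Is = intervals (suc k) L
    Js = intervals (suc k) L′
    joined : ∀ j L → AllPairs S L → AllPairs Before (intervals j L ++ intervals (suc k) (drop (j * i) L))
    joined zero    L ap = intervals-before (suc k) L ap
    joined (suc j) L ap = All.tabulate (λ {J} J∈ {x} {y} x∈ y∈ → take-drop i L ap x∈ (later J∈ y∈))
      ∷ subst (λ M → AllPairs Before (intervals j (drop i L) ++ intervals (suc k) M)) (drop-drop i (j * i) L) (joined j (drop i L) (AllPairsₚ.drop⁺ i ap))
      where
      drop-drop : ∀ {A : Set} p q (xs : List A) → drop q (drop p xs) ≡ drop (p + q) xs
      drop-drop zero    q       xs       = refl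
      drop-drop (suc p) zero    []       = refl
      drop-drop (suc p) (suc q) []       = refl
      drop-drop (suc p) q       (x ∷ xs) = drop-drop p q xs
      later : ∀ {J y} → J ∈ intervals j (drop i L) ++ intervals (suc k) (drop (suc j * i) L) → y ∈ J → y ∈ drop i L
      later J∈ y∈ with ∈-++⁻ (intervals j (drop i L)) J∈
      ... | inj₁ m = intervals-⊑ j (drop i L) m y∈
      ... | inj₂ m = drop-⊑ (j * i) (drop i L) (subst (_ ∈_) (sym (drop-drop i (j * i) L)) (intervals-⊑ (suc k) (drop (suc j * i) L) m y∈))

-- The union bound over configurations

factors-positive : ∀ x y → 1 ≤ x * y → 1 ≤ x × 1 ≤ y
factors-positive (suc x) (suc y) _ = s≤s z≤n , s≤s z≤n
factors-positive (suc x) zero    h = ⊥-elim (<-irrefl refl (≤-trans h (≤-reflexive (*-zeroʳ x))))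

module Union {n m : ℕ} (c K : ℕ) (P B : Fin n → Fin m) {Λ : ℕ} (loadP : Load P Λ) (loadB : Load B Λ)
  (c≥1 : 1 ≤ c) (y₀ Δ fmax Ψ : ℕ)
  (Ψ-end : 2 * suc Δ * suc y₀ ^ (2 + c + 3) + suc fmax * suc y₀ ^ (2 + c + 1) + m ≤ Ψ * suc y₀ ^ (2 + c + 3))
  (Ψ-mid : 2 * suc Δ * Λ * suc y₀ ^ (2 + c + 3) + 2 * suc fmax * Λ * suc y₀ ^ (2 + c + 1) + n ≤ Ψ * suc y₀ ^ (2 + c + 3))
  (main : 4 * (m * n ^ c * m) ≤ suc y₀ ^ ((2 + c) * (2 + c + 3)))
  (rest : 4 * Ψ ^ (2 + c) ≤ suc y₀ * suc y₀)
  (a i R k κ e ρ : ℕ) (transversal : Transversal P B a i) (m≥1 : 1 ≤ m) (a≥1 : 1 ≤ a) (R≥1 : 1 ≤ R) (i≥1 : 1 ≤ i)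
  (i≤aΛ : i ≤ a * Λ) (steep : Λ < R ^ k)
  (fits : κ * (2 * R * a) * suc (tri (3 + c)) ≤ fmax)
  (Δ-large : 64 * Λ * κ * suc (tri (3 + c)) * R ≤ suc Δ)
  (a-large₁ : 32 * κ * suc (tri (3 + c)) * R ≤ a)
  (a-large₂ : 64 * (suc y₀ * suc y₀) * κ * R ≤ a)
  (i-large₁ : 16 * (Δ ^ (2 + c) * (K * Λ)) * Λ ≤ i)
  (i-large₂ : 32 * Λ * Λ ≤ i)
  (κ-large : m * (2 ^ Λ * 2 ^ Λ) * 2 ^ e ≤ 2 ^ κ)
  (e-large : 16 * R * a ≤ 2 ^ e)
  (n≤ : n ≤ ρ * (suc y₀ * suc y₀) ^ (2 + c))
  (K-large : 4 * (m ^ (2 + c) * ρ ^ K) ≤ K !)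
  where

  open Configurations c K P B loadP loadB c≥1 y₀ Δ fmax Ψ Ψ-end Ψ-mid main rest

  N : ℕ
  N = m * m

  -- The conditions of `Config` that involve neither the cover nor the relation between `W` and `X`.
  -- They are made decidable so that the union bound can run over all pairs of sets, illegal ones
  -- counting zero.
  record Legal (A : ℕ) (W X : List (Fin n)) : Set where
    constructor mkLegal
    field
      uW   : Unique W
      uX   : Unique X
      uPW  : Unique (map P W)
      uBX  : Unique (map B X)
      A≤W  : A ≤ 2 * R * length W
      A≤X  : A ≤ 2 * R * length X
      area : A * a ≤ 2 * R * (length W * length X)
      bigW : i ≤ length W * Λ
      bigX : i ≤ length X * Λ

  opaque
    legal : ℕ → List (Fin n) → List (Fin n) → Bool
    legal A W X = does (distinct? _≟_ W) ∧ (does (distinct? _≟_ X) ∧ (does (distinct? _≟_ (map P W)) ∧ (does (distinct? _≟_ (map B X)) ∧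
      (does (A ≤? 2 * R * length W) ∧ (does (A ≤? 2 * R * length X) ∧ (does (A * a ≤? 2 * R * (length W * length X)) ∧
      (does (i ≤? length W * Λ) ∧ does (i ≤? length X * Λ))))))))

    legal⇒Legal : ∀ A W X → legal A W X ≡ true → Legal A W X
    legal⇒Legal A W X l₁ =
      let d₁ = distinct? _≟_ W
          d₂ = distinct? _≟_ X
          d₃ = distinct? _≟_ (map P W)
          d₄ = distinct? _≟_ (map B X)
          d₅ = A ≤? 2 * R * length W
          d₆ = A ≤? 2 * R * length X
          d₇ = A * a ≤? 2 * R * (length W * length X)
          d₈ = i ≤? length W * Λ
          d₉ = i ≤? length X * Λ
          l₂ = ∧-elim₂ {does d₁} l₁
          l₃ = ∧-elim₂ {does d₂} l₂
          l₄ = ∧-elim₂ {does d₃} l₃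
          l₅ = ∧-elim₂ {does d₄} l₄
          l₆ = ∧-elim₂ {does d₅} l₅
          l₇ = ∧-elim₂ {does d₆} l₆
          l₈ = ∧-elim₂ {does d₇} l₇
      in mkLegal (dec-true d₁ (∧-elim₁ {does d₁} l₁)) (dec-true d₂ (∧-elim₁ {does d₂} l₂)) (dec-true d₃ (∧-elim₁ {does d₃} l₃))
           (dec-true d₄ (∧-elim₁ {does d₄} l₄)) (dec-true d₅ (∧-elim₁ {does d₅} l₅)) (dec-true d₆ (∧-elim₁ {does d₆} l₆))
           (dec-true d₇ (∧-elim₁ {does d₇} l₇)) (dec-true d₈ (∧-elim₁ {does d₈} l₈)) (dec-true d₉ (∧-elim₂ {does d₈} l₈))

    Legal⇒legal : ∀ A W X → Legal A W X → legal A W X ≡ true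
    Legal⇒legal A W X (mkLegal p₁ p₂ p₃ p₄ p₅ p₆ p₇ p₈ p₉) = ∧-intro (true-dec (distinct? _≟_ W) p₁) (∧-intro (true-dec (distinct? _≟_ X) p₂)
      (∧-intro (true-dec (distinct? _≟_ (map P W)) p₃) (∧-intro (true-dec (distinct? _≟_ (map B X)) p₄)
      (∧-intro (true-dec (A ≤? 2 * R * length W) p₅) (∧-intro (true-dec (A ≤? 2 * R * length X) p₆)
      (∧-intro (true-dec (A * a ≤? 2 * R * (length W * length X)) p₇)
      (∧-intro (true-dec (i ≤? length W * Λ) p₈) (true-dec (i ≤? length X * Λ) p₉))))))))

  hit : ℕ → List (Fin n) → List (Fin n) → Ω → Bool
  hit A W X ω = legal A W X ∧ avoids W X ω

  -- A configuration with A cells is exposed until κA hits, with budgets of κA(h + 1) edges found on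
  -- and 2qκA found off. Both are a sixteenth of the area at most, which is at least Aa / (2R),
  -- because a is large.
  hit-bound : ∀ A → A ≤ 2 * R * a → ∀ W X → count (hit A W X) (vecs q N) * 2 ^ (κ * A) ≤ 2 * q ^ N
  hit-bound A A≤ W X with legal A W X in lg
  ... | false = ≤-trans (≤-reflexive (cong (_* 2 ^ (κ * A)) (trans (∑-const (vecs q N) 0) (*-zeroʳ (length (vecs q N)))))) z≤n
  ... | true = configuration-bound W X uW uX (unique-map-inj P uPW) (unique-map-inj B uBX) f n₀ f≤ (pos W bigW) (pos X bigX)
        (heavy W A≤W) (heavy X A≤X) few-on few-off few-full few-equal (κ * A) ≤-refl ≤-refl
    where
    open Legal (legal⇒Legal A W X lg)
    open ≤-Reasoning
    s = suc (tri (3 + c))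
    f  = κ * A * s
    n₀ = 2 * q * (κ * A)
    Λ≥1 : ∀ Y → i ≤ length Y * Λ → 1 ≤ length Y × 1 ≤ Λ
    Λ≥1 Y h = factors-positive (length Y) Λ (≤-trans i≥1 h)
    pos : ∀ Y → i ≤ length Y * Λ → 1 ≤ length Y
    pos Y h = proj₁ (Λ≥1 Y h)
    instance
      Λ-nz : NonZero Λ
      Λ-nz = >-nonZero (proj₂ (Λ≥1 W bigW))
      2R-nz : NonZero (2 * R)
      2R-nz = >-nonZero (*-mono-≤ {1} {2} (s≤s z≤n) R≥1)
    f≤ : f ≤ fmax
    f≤ = ≤-trans (*-monoˡ-≤ s (*-monoʳ-≤ κ A≤)) fits
    heavy : ∀ Y → A ≤ 2 * R * length Y → 32 * Λ * f ≤ suc Δ * length Y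
    heavy Y h = begin
      32 * Λ * (κ * A * s)                ≤⟨ *-monoʳ-≤ (32 * Λ) (*-monoˡ-≤ s (*-monoʳ-≤ κ h)) ⟩
      32 * Λ * (κ * (2 * R * length Y) * s) ≡⟨ e₁ Λ κ R (length Y) s ⟩
      64 * Λ * κ * s * R * length Y       ≤⟨ *-monoˡ-≤ (length Y) Δ-large ⟩
      suc Δ * length Y ∎
      where
      e₁ : ∀ Λ κ R y s → 32 * Λ * (κ * (2 * R * y) * s) ≡ 64 * Λ * κ * s * R * y
      e₁ = solve-∀
    few-on : 16 * f ≤ length W * length X
    few-on = *-cancelˡ-≤ (2 * R) (begin
      2 * R * (16 * (κ * A * s))       ≡⟨ e₁ R κ A s ⟩
      A * (32 * κ * s * R)             ≤⟨ *-monoʳ-≤ A a-large₁ ⟩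
      A * a                            ≤⟨ area ⟩
      2 * R * (length W * length X) ∎)
      where
      e₁ : ∀ R κ A s → 2 * R * (16 * (κ * A * s)) ≡ A * (32 * κ * s * R)
      e₁ = solve-∀
    few-off : 16 * n₀ ≤ length W * length X
    few-off = *-cancelˡ-≤ (2 * R) (begin
      2 * R * (16 * (2 * q * (κ * A))) ≡⟨ e₁ R q κ A ⟩
      A * (64 * q * κ * R)             ≤⟨ *-monoʳ-≤ A a-large₂ ⟩
      A * a                            ≤⟨ area ⟩
      2 * R * (length W * length X) ∎)
      where
      e₁ : ∀ R q κ A → 2 * R * (16 * (2 * q * (κ * A))) ≡ A * (64 * q * κ * R)
      e₁ = solve-∀
    few-full : 16 * (Δ ^ (2 + c) * (K * Λ)) ≤ length X
    few-full = *-cancelʳ-≤ _ _ Λ (≤-trans i-large₁ bigX)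
    few-equal : 32 * Λ ≤ length W
    few-equal = *-cancelʳ-≤ _ _ Λ (≤-trans i-large₂ bigW)

  universe : (Fin n → Fin m) → List (Fin m) → List (Fin n)
  universe Q cs = keep (λ v → memᵇ (Q v) cs) (allFin n)

  -- Choosing the cells first confines `W` and `X` to at most ΛA vertices instead of n.
  codes : ℕ → (Fin n → Fin m) → (List (Fin n) → List (Fin n) → ℕ) → ℕ
  codes A Q t = ∑ (allLists A (allFin m)) (λ cs → ∑ (subs (universe Q cs)) (λ W → ∑ (subs (universe Q cs)) (t W)))

  codes-mass : ∀ A Q → ∑ (vecs q N) (λ ω → codes A Q (λ W X → ⟦ hit A W X ω ⟧)) ≡ codes A Q (λ W X → count (hit A W X) (vecs q N))
  codes-mass A Q = trans (∑-swap (vecs q N) (allLists A (allFin m)) _) (∑-cong (allLists A (allFin m)) (λ cs →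
    trans (∑-swap (vecs q N) (subs (universe Q cs)) _) (∑-cong (subs (universe Q cs)) (λ W →
      ∑-swap (vecs q N) (subs (universe Q cs)) (λ ω X → ⟦ hit A W X ω ⟧)))))

  2^e≢0 : ∀ j → NonZero (2 ^ j)
  2^e≢0 j = m^n≢0 2 j

  -- Per cell the union bound pays m for its choice and 2^Λ for each of the traces of `W` and `X` on
  -- it, and gains 2^κ; by `κ-large` a factor 2^e is left over.
  codes-bound : ∀ A Q → Load Q Λ → 1 ≤ A → A ≤ 2 * R * a → codes A Q (λ W X → count (hit A W X) (vecs q N)) * 2 ^ e ≤ 2 * q ^ N
  codes-bound A Q load A≥1 A≤ = begin
    C * 2 ^ e
      ≤⟨ *-monoʳ-≤ C (^-monoʳ-≤ 2 (≤-trans (≤-reflexive (sym (*-identityʳ e))) (*-monoʳ-≤ e A≥1))) ⟩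
    C * 2 ^ (e * A)
      ≤⟨ *-cancelʳ-≤ _ _ (m ^ A * (s * s)) {{>-nonZero (*-mono-≤ (m^n>0 m {{>-nonZero m≥1}} A) (*-mono-≤ s≥1 s≥1))}} (begin
        C * 2 ^ (e * A) * (m ^ A * (s * s))
          ≡⟨ e₁ C (2 ^ (e * A)) (m ^ A) (s * s) ⟩
        C * (m ^ A * (s * s) * 2 ^ (e * A))
          ≡⟨ cong (C *_) powers ⟩
        C * (m * (2 ^ Λ * 2 ^ Λ) * 2 ^ e) ^ A
          ≤⟨ *-monoʳ-≤ C (^-monoˡ-≤ A κ-large) ⟩
        C * (2 ^ κ) ^ A
          ≡⟨ cong (C *_) (^-*-assoc 2 κ A) ⟩
        C * 2 ^ (κ * A)
          ≡⟨ distribute ⟩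
        codes A Q (λ W X → count (hit A W X) (vecs q N) * 2 ^ (κ * A))
          ≤⟨ ∑-bound (allLists A (allFin m)) (s * (s * (2 * q ^ N))) each ⟩
        length (allLists A (allFin m)) * (s * (s * (2 * q ^ N)))
          ≡⟨ cong (_* (s * (s * (2 * q ^ N)))) (trans (length-allLists A (allFin m)) (cong (_^ A) (length-allFin m))) ⟩
        m ^ A * (s * (s * (2 * q ^ N)))
          ≡⟨ e₂ (m ^ A) s (q ^ N) ⟩
        2 * q ^ N * (m ^ A * (s * s)) ∎) ⟩
    2 * q ^ N ∎
    where
    open ≤-Reasoning
    C = codes A Q (λ W X → count (hit A W X) (vecs q N))
    s = 2 ^ (Λ * A)
    s≥1 : 1 ≤ s
    s≥1 = m^n>0 2 (Λ * A)
    e₁ : ∀ a b c d → a * b * (c * d) ≡ a * (c * d * b)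
    e₁ = solve-∀
    e₂ : ∀ a s q → a * (s * (s * (2 * q))) ≡ 2 * q * (a * (s * s))
    e₂ = solve-∀
    powers : m ^ A * (s * s) * 2 ^ (e * A) ≡ (m * (2 ^ Λ * 2 ^ Λ) * 2 ^ e) ^ A
    powers = sym (trans (^-distribʳ-* A (m * (2 ^ Λ * 2 ^ Λ)) (2 ^ e)) (cong₂ _*_
      (trans (^-distribʳ-* A m (2 ^ Λ * 2 ^ Λ)) (cong (m ^ A *_) (trans (^-distribʳ-* A (2 ^ Λ) (2 ^ Λ)) (cong₂ _*_ (^-*-assoc 2 Λ A) (^-*-assoc 2 Λ A)))))
      (^-*-assoc 2 e A)))
    distribute : C * 2 ^ (κ * A) ≡ codes A Q (λ W X → count (hit A W X) (vecs q N) * 2 ^ (κ * A))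
    distribute = trans (sym (∑-*ʳ (allLists A (allFin m)) (2 ^ (κ * A)) _)) (∑-cong (allLists A (allFin m)) (λ cs →
      trans (sym (∑-*ʳ (subs (universe Q cs)) (2 ^ (κ * A)) _)) (∑-cong (subs (universe Q cs)) (λ W →
        sym (∑-*ʳ (subs (universe Q cs)) (2 ^ (κ * A)) _)))))
    subs-length : ∀ cs → cs ∈ allLists A (allFin m) → length (subs (universe Q cs)) ≤ s
    subs-length cs cs∈ = ≤-trans (≤-reflexive (length-subs (universe Q cs))) (^-monoʳ-≤ 2 (≤-trans (≤-reflexive (length-keep _ (allFin n)))
      (≤-trans (memᵇ-load Q load cs) (≤-reflexive (trans (cong (_* Λ) (proj₁ (∈-allLists-length A (allFin m) cs∈))) (*-comm A Λ))))))
    each : ∀ cs → cs ∈ allLists A (allFin m) →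
      ∑ (subs (universe Q cs)) (λ W → ∑ (subs (universe Q cs)) (λ X → count (hit A W X) (vecs q N) * 2 ^ (κ * A))) ≤ s * (s * (2 * q ^ N))
    each cs cs∈ = ≤-trans (∑-bound (subs (universe Q cs)) (s * (2 * q ^ N)) (λ W _ →
        ≤-trans (∑-bound (subs (universe Q cs)) (2 * q ^ N) (λ X _ → hit-bound A A≤ W X)) (*-monoˡ-≤ (2 * q ^ N) (subs-length cs cs∈))))
      (*-monoˡ-≤ (s * (2 * q ^ N)) (subs-length cs cs∈))

  sizes : List (Fin (2 * R * a))
  sizes = allFin (2 * R * a)

  -- Runs from 1 to 2Ra: an empty cover would leave no cell to pay for the factor 2^e.
  size : Fin (2 * R * a) → ℕ
  size j = suc (toℕ j)

  bothCodes : Ω → Fin (2 * R * a) → ℕ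
  bothCodes ω j = codes (size j) P (λ W X → ⟦ hit (size j) W X ω ⟧) + codes (size j) B (λ W X → ⟦ hit (size j) W X ω ⟧)

  module _ (ω : Ω) where
    open Chains {n} {m} P B {Λ} {a} {i} {R} {k} loadP loadB transversal m≥1 a≥1 R≥1 i≥1 i≤aΛ steep (λ w x → missing (on ω) w x ≡ true)

    module _ (nc : nice (on ω) ≡ true) {Q : Fin n → Fin m} (cfg : Config Q) where
      open Config cfg

      U = universe Q cs
      -- `subs` enumerates sublists of `U` in its own order, so `W` and `X` are rearranged along
      -- `U`.
      W′ = keep (λ v → memᵇ v W) U
      X′ = keep (λ v → memᵇ v X) U

      module _ (Y : List (Fin n)) (cov : ∀ {v} → v ∈ Y → Q v ∈ cs) (uY : Unique Y) where
        Y′ = keep (λ v → memᵇ v Y) U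
        to : Y′ ⊑ Y
        to m = memᵇ-true (proj₂ (∈-keep (λ v → memᵇ v Y) U m))
        from : Y ⊑ Y′
        from {v} m = keep-∈ (λ v → memᵇ v Y) (keep-∈ (λ v → memᵇ (Q v) cs) (∈allFin v) (memᵇ-intro (cov m))) (memᵇ-intro m)
        uY′ : Unique Y′
        uY′ = AllPairs-keep _ (AllPairs-keep _ (Uniq.allFin⁺ n))
        longer : length Y ≤ length Y′
        longer = unique-length uY from

      found-legal : Legal A W′ X′
      found-legal = mkLegal (uY′ W covW uW) (uY′ X covX uX)
        (unique-map P (uY′ W covW uW) (λ x y → injP (to W covW uW x) (to W covW uW y)))
        (unique-map B (uY′ X covX uX) (λ x y → injB (to X covX uX x) (to X covX uX y)))
        (≤-trans A≤W (*-monoʳ-≤ (2 * R) lW)) (≤-trans A≤X (*-monoʳ-≤ (2 * R) lX))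
        (≤-trans area (*-monoʳ-≤ (2 * R) (*-mono-≤ lW lX)))
        (≤-trans bigW (*-monoˡ-≤ Λ lW)) (≤-trans bigX (*-monoˡ-≤ Λ lX))
        where
        lW : length W ≤ length W′
        lW = longer W covW uW
        lX : length X ≤ length X′
        lX = longer X covX uX

      found-hit : hit A W′ X′ ω ≡ true
      found-hit = ∧-intro (Legal⇒legal A W′ X′ found-legal) (∧-intro nc (all-intro (λ w → all (missing (on ω) w) X′) W′
        (λ w w∈ → all-intro (missing (on ω) w) X′ (λ x x∈ → linked (to W covW uW w∈) (to X covX uX x∈)))))

      found-code : 1 ≤ codes A Q (λ W X → ⟦ hit A W X ω ⟧)
      found-code = ≤-trans (≤-reflexive (cong ⟦_⟧ (sym found-hit)))
        (≤-trans (∑-member (λ X → ⟦ hit A W′ X ω ⟧) (keep∈subs (λ v → memᵇ v X) U))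
        (≤-trans (∑-member (λ W → ∑ (subs U) (λ X → ⟦ hit A W X ω ⟧)) (keep∈subs (λ v → memᵇ v W) U))
          (∑-member (λ cs → ∑ (subs (universe Q cs)) (λ W → ∑ (subs (universe Q cs)) (λ X → ⟦ hit A W X ω ⟧)))
            (subst (λ l → cs ∈ allLists l (allFin m)) lenA (∈-allLists cs (λ {v} _ → ∈allFin v))))))

      found-size : ∃ λ j → size j ≡ A
      found-size with A | A≥1 | A≤
      ... | suc A′ | _ | le = fromℕ< le , cong suc (toℕ-fromℕ< le)

    placed : nice (on ω) ≡ true → ∀ {Q} (cfg : Config Q) → (∀ j → size j ≡ Config.A cfg → 1 ≤ bothCodes ω j) → 1 ≤ ∑ sizes (bothCodes ω)
    placed nc cfg h with found-size nc cfg
    ... | j , e = ≤-trans (h j e) (∑-member (bothCodes ω) (∈allFin j))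

    placed-P : nice (on ω) ≡ true → Config P → 1 ≤ ∑ sizes (bothCodes ω)
    placed-P nc cfg = placed nc cfg (λ j e → ≤-trans (≤-trans (found-code nc cfg)
      (≤-reflexive (cong (λ A → codes A P (λ W X → ⟦ hit A W X ω ⟧)) (sym e)))) (m≤m+n _ _))

    placed-B : nice (on ω) ≡ true → Config B → 1 ≤ ∑ sizes (bothCodes ω)
    placed-B nc cfg = placed nc cfg (λ j e → ≤-trans (≤-trans (found-code nc cfg)
      (≤-reflexive (cong (λ A → codes A B (λ W X → ⟦ hit A W X ω ⟧)) (sym e)))) (m≤n+m _ (codes (size j) P (λ W X → ⟦ hit (size j) W X ω ⟧))))

    -- The graph of `ω` is clique-free, so the Ramsey property yields an independent set of size t
    -- and with it a configuration, which is coded unless `ω` contains a fan.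
    accounted : ∀ t → 2 * suc k * i ≤ t → RamseyProperty (4 + c) t n → 1 ≤ ⟦ not (nice (on ω)) ⟧ + ∑ sizes (bothCodes ω)
    accounted t t≥ ramsey = by-niceness (nice (on ω)) refl
      where
      by-graph : nice (on ω) ≡ true → HasClique (DeletedGraph.graph c K P B (on ω)) (4 + c) ⊎ HasIndependentSet (DeletedGraph.graph c K P B (on ω)) t →
        1 ≤ ∑ sizes (bothCodes ω)
      by-graph nc (inj₁ cl) = ⊥-elim (DeletedGraph.clique-free c K P B (on ω) cl)
      by-graph nc (inj₂ ind) with DeletedGraph.independent-list c K P B (on ω) ind
      ... | L , lenL , inc , miss = [ placed-P nc , placed-B nc ]′
              (find-configuration L (AllPairs.map (λ lt e → <-irrefl (cong toℕ e) lt) inc) miss (≤-trans t≥ (≤-reflexive (sym lenL))))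
      by-niceness : ∀ b → nice (on ω) ≡ b → 1 ≤ ⟦ not b ⟧ + ∑ sizes (bothCodes ω)
      by-niceness false _  = s≤s z≤n
      by-niceness true  nc = by-graph nc (ramsey (DeletedGraph.graph c K P B (on ω)))

  -- Fans account for at most a quarter of all outcomes and coded configurations for at most a half.
  not-ramsey : ∀ t → 2 * suc k * i ≤ t → ¬ RamseyProperty (4 + c) t n
  not-ramsey t t≥ ramsey = <-irrefl refl (begin-strict
    3 * q ^ N
      <⟨ *-monoˡ-< (q ^ N) {{m^n≢0 q N}} {3} {4} ≤-refl ⟩
    4 * q ^ N
      ≡⟨ cong (4 *_) (sym (∑-vecs-1 q N)) ⟩
    4 * ∑ (vecs q N) (λ _ → 1)
      ≤⟨ *-monoʳ-≤ 4 (∑-mono (vecs q N) (λ ω _ → accounted ω t t≥ ramsey)) ⟩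
    4 * ∑ (vecs q N) (λ ω → ⟦ not (nice (on ω)) ⟧ + ∑ sizes (bothCodes ω))
      ≡⟨ trans (cong (4 *_) (trans (∑-+ (vecs q N) _ _) (cong (count (λ ω → not (nice (on ω))) (vecs q N) +_)
           (∑-swap (vecs q N) sizes bothCodes)))) (*-distribˡ-+ 4 (count (λ ω → not (nice (on ω))) (vecs q N)) T) ⟩
    4 * count (λ ω → not (nice (on ω))) (vecs q N) + 4 * T
      ≤⟨ +-mono-≤ few-ugly few-hit ⟩
    q ^ N + 2 * q ^ N
      ≡⟨⟩
    3 * q ^ N ∎)
    where
    open ≤-Reasoning
    T = ∑ sizes (λ j → ∑ (vecs q N) (λ ω → bothCodes ω j))
    few-ugly : 4 * count (λ ω → not (nice (on ω))) (vecs q N) ≤ q ^ N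
    few-ugly = *-cancelʳ-≤ _ _ (K !) {{>-nonZero (1≤n! K)}} (begin
      4 * count (λ ω → not (nice (on ω))) (vecs q N) * K !
        ≡⟨ *-assoc 4 (count (λ ω → not (nice (on ω))) (vecs q N)) (K !) ⟩
      4 * (count (λ ω → not (nice (on ω))) (vecs q N) * K !)
        ≤⟨ *-monoʳ-≤ 4 (Niceness.niceness-bound c K P B y₀ ρ n≤) ⟩
      4 * (m ^ r * ρ ^ K * q ^ N)
        ≡⟨ sym (*-assoc 4 (m ^ r * ρ ^ K) (q ^ N)) ⟩
      4 * (m ^ r * ρ ^ K) * q ^ N
        ≤⟨ *-monoˡ-≤ (q ^ N) K-large ⟩
      K ! * q ^ N
        ≡⟨ *-comm (K !) (q ^ N) ⟩
      q ^ N * K ! ∎)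
    -- 2Ra sizes, two partitions, and the factor 2 of the exposure bound: hence 16Ra ≤ 2^e.
    few-hit : 4 * T ≤ 2 * q ^ N
    few-hit = *-cancelʳ-≤ _ _ (2 ^ e) {{2^e≢0 e}} (begin
      4 * T * 2 ^ e
        ≡⟨ trans (*-assoc 4 T (2 ^ e)) (cong (4 *_) (sym (∑-*ʳ sizes (2 ^ e) _))) ⟩
      4 * ∑ sizes (λ j → ∑ (vecs q N) (λ ω → bothCodes ω j) * 2 ^ e)
        ≤⟨ *-monoʳ-≤ 4 (∑-bound sizes (4 * q ^ N) each) ⟩
      4 * (length sizes * (4 * q ^ N))
        ≡⟨ cong (λ l → 4 * (l * (4 * q ^ N))) (length-allFin (2 * R * a)) ⟩
      4 * (2 * R * a * (4 * q ^ N))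
        ≡⟨ e₁ R a (q ^ N) ⟩
      2 * q ^ N * (16 * R * a)
        ≤⟨ *-monoʳ-≤ (2 * q ^ N) e-large ⟩
      2 * q ^ N * 2 ^ e ∎)
      where
      e₁ : ∀ R a q → 4 * (2 * R * a * (4 * q)) ≡ 2 * q * (16 * R * a)
      e₁ = solve-∀
      each : ∀ j → j ∈ sizes → ∑ (vecs q N) (λ ω → bothCodes ω j) * 2 ^ e ≤ 4 * q ^ N
      each j _ = begin
        ∑ (vecs q N) (λ ω → bothCodes ω j) * 2 ^ e
          ≡⟨ cong (_* 2 ^ e) (trans (∑-+ (vecs q N) _ _) (cong₂ _+_ (codes-mass (size j) P) (codes-mass (size j) B))) ⟩
        (CP + CB) * 2 ^ e
          ≡⟨ *-distribʳ-+ (2 ^ e) CP CB ⟩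
        CP * 2 ^ e + CB * 2 ^ e
          ≤⟨ +-mono-≤ (codes-bound (size j) P loadP (s≤s z≤n) (toℕ<n j)) (codes-bound (size j) B loadB (s≤s z≤n) (toℕ<n j)) ⟩
        2 * q ^ N + 2 * q ^ N
          ≡⟨ e₂ (q ^ N) ⟩
        4 * q ^ N ∎
        where
        CP = codes (size j) P (λ W X → count (hit (size j) W X) (vecs q N))
        CB = codes (size j) B (λ W X → count (hit (size j) W X) (vecs q N))
        e₂ : ∀ x → 2 * x + 2 * x ≡ 4 * x
        e₂ = solve-∀

-- Factorials, polynomial bounds and the threshold for Y

factorial-bound : ∀ p j → j ^ p ≤ (p + j) !
factorial-bound zero    j = 1≤n! j
factorial-bound (suc p) j = *-mono-≤ (m≤n+m j (suc p)) (factorial-bound p j)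

n<2^n : ∀ n → n < 2 ^ n
n<2^n zero    = s≤s z≤n
n<2^n (suc n) = ≤-trans (s≤s (n<2^n n)) (≤-trans (+-monoˡ-≤ (2 ^ n) (m^n>0 2 n)) (≤-reflexive (cong (2 ^ n +_) (sym (+-identityʳ (2 ^ n))))))

-- Domination by a single monomial for l ≥ 1; the lower bounds required of `Y` are of this kind in
-- log t.
Polynomial : (ℕ → ℕ) → Set
Polynomial f = ∃ λ C → ∃ λ E → ∀ l → 1 ≤ l → f l ≤ C * l ^ E

poly-const : ∀ k → Polynomial (λ _ → k)
poly-const k = k , 0 , λ l _ → ≤-reflexive (sym (*-identityʳ k))

poly-id : Polynomial (λ l → l)
poly-id = 1 , 1 , λ l _ → ≤-reflexive (sym (trans (*-identityˡ (l * 1)) (*-identityʳ l)))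

poly-+ : ∀ {f f′} → Polynomial f → Polynomial f′ → Polynomial (λ l → f l + f′ l)
poly-+ (C , E , h) (C′ , E′ , h′) = C + C′ , E + E′ , λ l l≥1 → ≤-trans (+-mono-≤
  (≤-trans (h l l≥1) (*-monoʳ-≤ C (^-monoʳ-≤ l {{>-nonZero l≥1}} (m≤m+n E E′))))
  (≤-trans (h′ l l≥1) (*-monoʳ-≤ C′ (^-monoʳ-≤ l {{>-nonZero l≥1}} (m≤n+m E′ E)))))
  (≤-reflexive (sym (*-distribʳ-+ (l ^ (E + E′)) C C′)))

poly-* : ∀ {f f′} → Polynomial f → Polynomial f′ → Polynomial (λ l → f l * f′ l)
poly-* (C , E , h) (C′ , E′ , h′) = C * C′ , E + E′ , λ l l≥1 → ≤-trans (*-mono-≤ (h l l≥1) (h′ l l≥1))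
  (≤-reflexive (trans (e C (l ^ E) C′ (l ^ E′)) (cong (C * C′ *_) (sym (^-distribˡ-+-* l E E′)))))
  where
  e : ∀ a b c d → a * b * (c * d) ≡ a * c * (b * d)
  e = solve-∀

poly-^ : ∀ {f} k → Polynomial f → Polynomial (λ l → f l ^ k)
poly-^ zero    p = poly-const 1
poly-^ (suc k) p = poly-* p (poly-^ k p)

module Theta (c s CΛ D : ℕ) where

  -- `Φ` bounds the number of revealed edges divided by q, `Ξ` bounds a²Λ / Y⁴, and `Θ` adds up all
  -- that `Y` has to exceed. R is replaced by ℓ ≥ R, so that everything depends on ℓ alone.
  Λ κ Δ Φ Ψ Ξ Θ : ℕ → ℕ
  Λ ℓ = CΛ * ℓ
  κ ℓ = D * ℓ
  Δ ℓ = 64 * Λ ℓ * κ ℓ * s * ℓ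
  Φ ℓ = 128 * κ ℓ * κ ℓ * ℓ * ℓ * s + 1
  Ψ ℓ = 2 * suc (Δ ℓ) * Λ ℓ + 2 * Φ ℓ * Λ ℓ + ℓ
  Ξ ℓ = (64 * κ ℓ * ℓ * (4 * ℓ ^ (4 * c))) * (64 * κ ℓ * ℓ * (4 * ℓ ^ (4 * c))) * Λ ℓ
  Θ ℓ = 4 * Ψ ℓ ^ (2 + c) + s + 16 * (Δ ℓ ^ (2 + c) * (suc (Λ ℓ) * Λ ℓ)) * Λ ℓ + 32 * Λ ℓ * Λ ℓ + 4 * Ξ ℓ ^ 7

  pΛ : Polynomial Λ
  pΛ = poly-* (poly-const CΛ) poly-id
  pκ : Polynomial κ
  pκ = poly-* (poly-const D) poly-id
  pΔ : Polynomial Δ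
  pΔ = poly-* (poly-* (poly-* (poly-* (poly-const 64) pΛ) pκ) (poly-const s)) poly-id
  pΦ : Polynomial Φ
  pΦ = poly-+ (poly-* (poly-* (poly-* (poly-* (poly-* (poly-const 128) pκ) pκ) poly-id) poly-id) (poly-const s)) (poly-const 1)
  pΨ : Polynomial Ψ
  pΨ = poly-+ (poly-+ (poly-* (poly-* (poly-const 2) (poly-+ (poly-const 1) pΔ)) pΛ) (poly-* (poly-* (poly-const 2) pΦ) pΛ)) poly-id
  pξ : Polynomial (λ ℓ → 64 * κ ℓ * ℓ * (4 * ℓ ^ (4 * c)))
  pξ = poly-* (poly-* (poly-* (poly-const 64) pκ) poly-id) (poly-* (poly-const 4) (poly-^ (4 * c) poly-id))
  pΞ : Polynomial Ξ
  pΞ = poly-* (poly-* pξ pξ) pΛ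
  pΘ : Polynomial Θ
  pΘ = poly-+ (poly-+ (poly-+ (poly-+ (poly-* (poly-const 4) (poly-^ (2 + c) pΨ)) (poly-const s))
    (poly-* (poly-* (poly-const 16) (poly-* (poly-^ (2 + c) pΔ) (poly-* (poly-+ (poly-const 1) pΛ) pΛ))) pΛ))
    (poly-* (poly-* (poly-const 32) pΛ) pΛ)) (poly-* (poly-const 4) (poly-^ 7 pΞ))

-- The choice of parameters

module Scale (c : ℕ) (c≥1 : 1 ≤ c) (g J′ CΛ D ℓ R Y y₀ : ℕ)
  (2g : 2 * g ≡ (2 + c) * (2 + c + 3)) (J-def : suc J′ ≡ 4 * g)
  (CΛ-def : CΛ ≡ (suc J′ + 2) * (4 * g + 2)) (D-def : D ≡ 2 * (2 + c + 3) + 2 * CΛ + 7)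
  (ℓ≥1 : 1 ≤ ℓ) (R≥2 : 2 ≤ R) (R^J≤ℓ : R ^ suc J′ ≤ ℓ) (steep : CΛ * ℓ < R ^ (2 + J′))
  (x-def : suc y₀ ≡ 2 * R ^ (2 * c) * Y)
  where

  r s Λ κ Δ Φ Ψ Ξ x q a i ρ m : ℕ
  r = 2 + c
  s = suc (tri (3 + c))
  Λ = Theta.Λ c s CΛ D ℓ
  κ = Theta.κ c s CΛ D ℓ
  Δ = Theta.Δ c s CΛ D ℓ
  Φ = Theta.Φ c s CΛ D ℓ
  Ψ = Theta.Ψ c s CΛ D ℓ
  Ξ = Theta.Ξ c s CΛ D ℓ
  x = suc y₀
  q = x * x
  -- The least value for which the 2qκA misses fit into a sixteenth of the area Aa / (2R).
  a = 64 * q * κ * R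
  i = 7 * a
  -- Since ρR ≤ ℓ, powers of R are to spare when ρ^Λ is compared with Λ!.
  ρ = R ^ J′
  -- Then m^r = (Y²)^g, as r(r + 3) = 2g.
  m = Y ^ (r + 3)

  R≥1 : 1 ≤ R
  R≥1 = ≤-trans (s≤s z≤n) R≥2

  instance
    R-nz : NonZero R
    R-nz = >-nonZero R≥1
    ℓ-nz : NonZero ℓ
    ℓ-nz = >-nonZero ℓ≥1

  module _ (Θ≤Y : Theta.Θ c (suc (tri (3 + c))) CΛ D ℓ ≤ Y) (a≤ : a ≤ 2 ^ (2 * ℓ)) where

    Y≥₁ : 4 * Ψ ^ r ≤ Y
    Y≥₁ = ≤-trans (≤-trans (m≤m+n _ s) (≤-trans (m≤m+n _ _) (≤-trans (m≤m+n _ (32 * Λ * Λ)) (m≤m+n _ (4 * Ξ ^ 7))))) Θ≤Y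
    Y≥₂ : s ≤ Y
    Y≥₂ = ≤-trans (≤-trans (m≤n+m s (4 * Ψ ^ r)) (≤-trans (m≤m+n _ _) (≤-trans (m≤m+n _ (32 * Λ * Λ)) (m≤m+n _ (4 * Ξ ^ 7))))) Θ≤Y
    Y≥₃ : 16 * (Δ ^ r * (suc Λ * Λ)) * Λ ≤ Y
    Y≥₃ = ≤-trans (≤-trans (m≤n+m _ (4 * Ψ ^ r + s)) (≤-trans (m≤m+n _ (32 * Λ * Λ)) (m≤m+n _ (4 * Ξ ^ 7)))) Θ≤Y
    Y≥₄ : 32 * Λ * Λ ≤ Y
    Y≥₄ = ≤-trans (≤-trans (m≤n+m _ (4 * Ψ ^ r + s + 16 * (Δ ^ r * (suc Λ * Λ)) * Λ)) (m≤m+n _ (4 * Ξ ^ 7))) Θ≤Y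
    Y≥₅ : 4 * Ξ ^ 7 ≤ Y
    Y≥₅ = ≤-trans (m≤n+m _ (4 * Ψ ^ r + s + 16 * (Δ ^ r * (suc Λ * Λ)) * Λ + 32 * Λ * Λ)) Θ≤Y

    Y≥1 : 1 ≤ Y
    Y≥1 = ≤-trans (s≤s z≤n) Y≥₂

    instance
      Y-nz : NonZero Y
      Y-nz = >-nonZero Y≥1

    m≥1 : 1 ≤ m
    m≥1 = m^n>0 Y (r + 3)

    D≥7 : 7 ≤ D
    D≥7 = ≤-trans (m≤n+m 7 (2 * (r + 3) + 2 * CΛ)) (≤-reflexive (sym D-def))

    κ≥1 : 1 ≤ κ
    κ≥1 = *-mono-≤ (≤-trans (s≤s z≤n) D≥7) ℓ≥1

    Λ≥7 : 7 ≤ Λ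
    Λ≥7 = ≤-trans (≤-trans (≤-trans seven (*-mono-≤ (m≤n+m 2 (suc J′)) (+-monoˡ-≤ 2 g4))) (≤-reflexive (sym CΛ-def))) (m≤m*n CΛ ℓ)
      where
      g4 : 4 ≤ 4 * g
      g4 = *-monoʳ-≤ 4 {1} (positive g J-def)
        where
        positive : ∀ g {J} → suc J ≡ 4 * g → 1 ≤ g
        positive (suc _) _ = s≤s z≤n
      seven : 7 ≤ 2 * (4 + 2)
      seven = s≤s (s≤s (s≤s (s≤s (s≤s (s≤s (s≤s z≤n))))))

    Λ≥1 : 1 ≤ Λ
    Λ≥1 = ≤-trans (s≤s z≤n) Λ≥7

    R≤ℓ : R ≤ ℓ
    R≤ℓ = ≤-trans (≤-trans (≤-reflexive (sym (*-identityʳ R))) (*-monoʳ-≤ R (m^n>0 R J′))) R^J≤ℓ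

    ρ≤ℓ : ρ ≤ ℓ
    ρ≤ℓ = ≤-trans (≤-trans (≤-reflexive (sym (*-identityˡ ρ))) (*-monoˡ-≤ ρ R≥1)) R^J≤ℓ

    Y≤x : Y ≤ x
    Y≤x = ≤-trans (≤-trans (≤-reflexive (sym (*-identityˡ Y))) (*-monoˡ-≤ Y (*-mono-≤ {1} {2} (s≤s z≤n) (m^n>0 R (2 * c))))) (≤-reflexive (sym x-def))

    x≤q : x ≤ q
    x≤q = m≤m*n x x

    q≤a : q ≤ a
    q≤a = begin
      q               ≡⟨ e q ⟩
      1 * q * 1 * 1   ≤⟨ *-mono-≤ (*-mono-≤ (*-monoˡ-≤ q {1} {64} (s≤s z≤n)) κ≥1) R≥1 ⟩
      64 * q * κ * R  ∎
      where
      open ≤-Reasoning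
      e : ∀ q → q ≡ 1 * q * 1 * 1
      e = solve-∀

    Y≤a : Y ≤ a
    Y≤a = ≤-trans Y≤x (≤-trans x≤q q≤a)

    a≥1 : 1 ≤ a
    a≥1 = ≤-trans Y≥1 Y≤a

    a≤i : a ≤ i
    a≤i = m≤m+n a (6 * a)

    X₁ X₃ : ℕ
    X₁ = x ^ (2 + c + 1)
    X₃ = x ^ (2 + c + 3)

    X₃-eq : X₃ ≡ q * X₁
    X₃-eq = trans (cong (x ^_) (e c)) (sym (*-assoc x x X₁))
      where
      e : ∀ c → 2 + c + 3 ≡ suc (suc (2 + c + 1))
      e = solve-∀

    m≤X₃ : m ≤ X₃
    m≤X₃ = ^-monoˡ-≤ (r + 3) Y≤x

    fmax : ℕ
    fmax = κ * (2 * R * a) * s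

    fmax≤ : suc fmax ≤ Φ * q
    fmax≤ = begin
      suc (κ * (2 * R * (64 * q * κ * R)) * s)
        ≡⟨ cong suc (e₁ κ R q s) ⟩
      suc (128 * κ * κ * R * R * s * q)
        ≤⟨ +-mono-≤ {1} {q} (s≤s z≤n) (*-monoˡ-≤ q (*-monoˡ-≤ s (*-mono-≤ (*-monoʳ-≤ (128 * κ * κ) R≤ℓ) R≤ℓ))) ⟩
      q + 128 * κ * κ * ℓ * ℓ * s * q
        ≡⟨ e₂ (128 * κ * κ * ℓ * ℓ * s) q ⟩
      (128 * κ * κ * ℓ * ℓ * s + 1) * q ∎
      where
      open ≤-Reasoning
      e₁ : ∀ κ R q s → κ * (2 * R * (64 * q * κ * R)) * s ≡ 128 * κ * κ * R * R * s * q
      e₁ = solve-∀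
      e₂ : ∀ w q → q + w * q ≡ (w + 1) * q
      e₂ = solve-∀

    Ψ-end : 2 * suc Δ * X₃ + suc fmax * X₁ + m ≤ Ψ * X₃
    Ψ-end = begin
      2 * suc Δ * X₃ + suc fmax * X₁ + m
        ≤⟨ +-mono-≤ (+-monoʳ-≤ (2 * suc Δ * X₃) (*-monoˡ-≤ X₁ fmax≤)) m≤X₃ ⟩
      2 * suc Δ * X₃ + Φ * q * X₁ + X₃
        ≡⟨ cong (λ t → 2 * suc Δ * X₃ + t + X₃) (trans (*-assoc Φ q X₁) (cong (Φ *_) (sym X₃-eq))) ⟩
      2 * suc Δ * X₃ + Φ * X₃ + X₃
        ≡⟨ e₁ (2 * suc Δ) Φ X₃ ⟩
      (2 * suc Δ * 1 + Φ * 1 + 1) * X₃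
        ≤⟨ *-monoˡ-≤ X₃ (+-mono-≤ (+-mono-≤ (*-monoʳ-≤ (2 * suc Δ) Λ≥1) (*-mono-≤ (m≤m+n Φ (Φ + 0)) Λ≥1)) ℓ≥1) ⟩
      Ψ * X₃ ∎
      where
      open ≤-Reasoning
      e₁ : ∀ d f y → d * y + f * y + y ≡ (d * 1 + f * 1 + 1) * y
      e₁ = solve-∀

    rest : 4 * Ψ ^ (2 + c) ≤ x * x
    rest = ≤-trans Y≥₁ (≤-trans Y≤x x≤q)

    Δ-large : 64 * Λ * κ * s * R ≤ suc Δ
    Δ-large = ≤-trans (*-monoʳ-≤ (64 * Λ * κ * s) R≤ℓ) (n≤1+n Δ)

    a-large₁ : 32 * κ * s * R ≤ a
    a-large₁ = ≤-trans (*-monoˡ-≤ R (≤-trans (≤-trans (≤-reflexive (e₁ κ s)) (*-monoˡ-≤ κ (*-monoʳ-≤ 32 (≤-trans Y≥₂ (≤-trans Y≤x x≤q))))) (*-monoˡ-≤ κ (*-monoˡ-≤ q {32} {64} (m≤m+n 32 32))))) ≤-refl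
      where
      e₁ : ∀ κ s → 32 * κ * s ≡ 32 * s * κ
      e₁ = solve-∀

    i-large₁ : 16 * (Δ ^ (2 + c) * (suc Λ * Λ)) * Λ ≤ i
    i-large₁ = ≤-trans Y≥₃ (≤-trans Y≤a a≤i)

    i-large₂ : 32 * Λ * Λ ≤ i
    i-large₂ = ≤-trans Y≥₄ (≤-trans Y≤a a≤i)

    i≤aΛ : i ≤ a * Λ
    i≤aΛ = ≤-trans (≤-reflexive (*-comm 7 a)) (*-monoʳ-≤ a Λ≥7)

    m≤2^ : m ≤ 2 ^ (2 * ℓ * (r + 3))
    m≤2^ = ≤-trans (^-monoˡ-≤ (r + 3) (≤-trans Y≤a a≤)) (≤-reflexive (^-*-assoc 2 (2 * ℓ) (r + 3)))

    -- The origin of `D`: its three terms are the exponents, per ℓ, of the bound on m, of the two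
    -- subset counts and of 2^e.
    κ-large : m * (2 ^ Λ * 2 ^ Λ) * 2 ^ (7 * ℓ) ≤ 2 ^ κ
    κ-large = begin
      m * (2 ^ Λ * 2 ^ Λ) * 2 ^ (7 * ℓ)
        ≤⟨ *-monoˡ-≤ (2 ^ (7 * ℓ)) (*-monoˡ-≤ (2 ^ Λ * 2 ^ Λ) m≤2^) ⟩
      2 ^ (2 * ℓ * (r + 3)) * (2 ^ Λ * 2 ^ Λ) * 2 ^ (7 * ℓ)
        ≡⟨ trans (cong (λ t → 2 ^ (2 * ℓ * (r + 3)) * t * 2 ^ (7 * ℓ)) (sym (^-distribˡ-+-* 2 Λ Λ)))
             (trans (cong (_* 2 ^ (7 * ℓ)) (sym (^-distribˡ-+-* 2 (2 * ℓ * (r + 3)) (Λ + Λ)))) (sym (^-distribˡ-+-* 2 (2 * ℓ * (r + 3) + (Λ + Λ)) (7 * ℓ)))) ⟩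
      2 ^ (2 * ℓ * (r + 3) + (CΛ * ℓ + CΛ * ℓ) + 7 * ℓ)
        ≡⟨ cong (2 ^_) (trans (e₁ ℓ (r + 3) CΛ) (cong (_* ℓ) (sym D-def))) ⟩
      2 ^ (D * ℓ) ∎
      where
      open ≤-Reasoning
      e₁ : ∀ l r C → 2 * l * r + (C * l + C * l) + 7 * l ≡ (2 * r + 2 * C + 7) * l
      e₁ = solve-∀

    -- The exponent is 4ℓ for 16, ℓ for R and 2ℓ for a.
    e-large : 16 * R * a ≤ 2 ^ (7 * ℓ)
    e-large = begin
      16 * R * a
        ≤⟨ *-mono-≤ (*-mono-≤ (^-monoʳ-≤ 2 {4} {4 * ℓ} (m≤m*n 4 ℓ)) (≤-trans R≤ℓ (<⇒≤ (n<2^n ℓ)))) a≤ ⟩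
      2 ^ (4 * ℓ) * 2 ^ ℓ * 2 ^ (2 * ℓ)
        ≡⟨ trans (cong (_* 2 ^ (2 * ℓ)) (sym (^-distribˡ-+-* 2 (4 * ℓ) ℓ))) (sym (^-distribˡ-+-* 2 (4 * ℓ + ℓ) (2 * ℓ))) ⟩
      2 ^ (4 * ℓ + ℓ + 2 * ℓ)
        ≡⟨ cong (2 ^_) (e₁ ℓ) ⟩
      2 ^ (7 * ℓ) ∎
      where
      open ≤-Reasoning
      e₁ : ∀ l → 4 * l + l + 2 * l ≡ 7 * l
      e₁ = solve-∀

    j : ℕ
    j = (4 * g + 2) * ℓ

    Λ-split : Λ ≡ (suc (suc J′) * j) + j
    Λ-split = trans (cong (_* ℓ) CΛ-def) (e₁ J′ (4 * g + 2) ℓ)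
      where
      e₁ : ∀ J w l → (suc J + 2) * w * l ≡ (suc (suc J) * (w * l)) + w * l
      e₁ = solve-∀

    4m^r≤ : 4 * m ^ r ≤ 2 ^ j
    4m^r≤ = begin
      4 * m ^ r
        ≤⟨ *-mono-≤ (^-monoʳ-≤ 2 {2} {2 * ℓ} (m≤m*n 2 ℓ)) (^-monoˡ-≤ r m≤2^) ⟩
      2 ^ (2 * ℓ) * (2 ^ (2 * ℓ * (r + 3))) ^ r
        ≡⟨ trans (cong (2 ^ (2 * ℓ) *_) (^-*-assoc 2 (2 * ℓ * (r + 3)) r)) (sym (^-distribˡ-+-* 2 (2 * ℓ) (2 * ℓ * (r + 3) * r))) ⟩
      2 ^ (2 * ℓ + 2 * ℓ * (r + 3) * r)
        ≡⟨ cong (2 ^_) (trans (e₁ ℓ r) (trans (cong (λ t → 2 * ℓ + 2 * ℓ * t) (sym 2g)) (e₂ ℓ g))) ⟩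
      2 ^ j ∎
      where
      open ≤-Reasoning
      e₁ : ∀ l r → 2 * l + 2 * l * (r + 3) * r ≡ 2 * l + 2 * l * (r * (r + 3))
      e₁ = solve-∀
      e₂ : ∀ l g → 2 * l + 2 * l * (2 * g) ≡ (4 * g + 2) * l
      e₂ = solve-∀

    ℓ≤j : ℓ ≤ j
    ℓ≤j = ≤-trans (≤-reflexive (sym (*-identityˡ ℓ))) (*-monoˡ-≤ ℓ (≤-trans (s≤s z≤n) (m≤n+m 2 (4 * g))))

    -- `CΛ` is chosen so that Λ = p + j with 4m^r ≤ 2^j and p = (J + 1)j. Then 4m^r ≤ R^j and ρ^j ≤
    -- R^(Jj) together are at most R^p, and (Rρ)^p ≤ ℓ^p ≤ j^p is below (p + j)!.
    Λ-large : 4 * m ^ r * ρ ^ Λ ≤ Λ !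
    Λ-large = begin
      4 * m ^ r * ρ ^ Λ
        ≡⟨ cong (λ t → 4 * m ^ r * ρ ^ t) Λ-split ⟩
      4 * m ^ r * ρ ^ (p + j)
        ≡⟨ cong (4 * m ^ r *_) (^-distribˡ-+-* ρ p j) ⟩
      4 * m ^ r * (ρ ^ p * ρ ^ j)
        ≤⟨ *-mono-≤ (≤-trans 4m^r≤ (^-monoˡ-≤ j R≥2)) (*-monoʳ-≤ (ρ ^ p) ρ^j≤) ⟩
      R ^ j * (ρ ^ p * R ^ (suc J′ * j))
        ≡⟨ e₁ (R ^ j) (ρ ^ p) (R ^ (suc J′ * j)) ⟩
      R ^ j * R ^ (suc J′ * j) * ρ ^ p
        ≡⟨ cong (_* ρ ^ p) (sym (^-distribˡ-+-* R j (suc J′ * j))) ⟩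
      R ^ p * ρ ^ p
        ≡⟨ sym (^-distribʳ-* p R ρ) ⟩
      (R * ρ) ^ p
        ≤⟨ ^-monoˡ-≤ p (≤-trans R^J≤ℓ ℓ≤j) ⟩
      j ^ p
        ≤⟨ factorial-bound p j ⟩
      (p + j) !
        ≡⟨ cong _! (sym Λ-split) ⟩
      Λ ! ∎
      where
      open ≤-Reasoning
      p = suc (suc J′) * j
      e₁ : ∀ a b c → a * (b * c) ≡ a * c * b
      e₁ = solve-∀
      ρ^j≤ : ρ ^ j ≤ R ^ (suc J′ * j)
      ρ^j≤ = ≤-trans (≤-reflexive (^-*-assoc R J′ j)) (^-monoʳ-≤ R (*-monoˡ-≤ j (n≤1+n J′)))

    ρ≤K : ρ ≤ suc Λ
    ρ≤K = ≤-trans ρ≤ℓ (≤-trans (≤-trans ℓ≤j (≤-trans (m≤n+m j (suc (suc J′) * j)) (≤-reflexive (sym Λ-split)))) (n≤1+n Λ))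

    K-large : 4 * (m ^ (2 + c) * ρ ^ suc Λ) ≤ suc Λ !
    K-large = ≤-trans (≤-reflexive (e₁ (m ^ r) ρ (ρ ^ Λ))) (*-mono-≤ ρ≤K Λ-large)
      where
      e₁ : ∀ m p k → 4 * (m * (p * k)) ≡ p * (4 * m * k)
      e₁ = solve-∀

    few-overloads : 4 * (m * ρ ^ suc Λ) ≤ suc Λ !
    few-overloads = ≤-trans (*-monoʳ-≤ 4 (*-monoˡ-≤ (ρ ^ suc Λ) (m≤m*n m (m ^ suc c) {{>-nonZero (m^n>0 m {{>-nonZero m≥1}} (suc c))}}))) K-large

    a≤Y² : a ≤ 64 * κ * ℓ * (4 * ℓ ^ (4 * c)) * (Y * Y)
    a≤Y² = begin
      64 * (x * x) * κ * R
        ≡⟨ cong (λ t → 64 * (t * t) * κ * R) x-def ⟩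
      64 * (2 * R ^ (2 * c) * Y * (2 * R ^ (2 * c) * Y)) * κ * R
        ≡⟨ e₁ (R ^ (2 * c)) Y κ R ⟩
      64 * κ * R * (4 * (R ^ (2 * c) * R ^ (2 * c))) * (Y * Y)
        ≡⟨ cong (λ t → 64 * κ * R * (4 * t) * (Y * Y)) (trans (sym (^-distribˡ-+-* R (2 * c) (2 * c))) (cong (R ^_) (e₂ c))) ⟩
      64 * κ * R * (4 * R ^ (4 * c)) * (Y * Y)
        ≤⟨ *-monoˡ-≤ (Y * Y) (*-mono-≤ (*-monoʳ-≤ (64 * κ) R≤ℓ) (*-monoʳ-≤ 4 (^-monoˡ-≤ (4 * c) R≤ℓ))) ⟩
      64 * κ * ℓ * (4 * ℓ ^ (4 * c)) * (Y * Y) ∎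
      where
      open ≤-Reasoning
      e₁ : ∀ u y k r → 64 * (2 * u * y * (2 * u * y)) * k * r ≡ 64 * k * r * (4 * (u * u)) * (y * y)
      e₁ = solve-∀
      e₂ : ∀ c → 2 * c + 2 * c ≡ 4 * c
      e₂ = solve-∀

    aaΛ≤ : a * Λ * a ≤ Ξ * Y ^ 4
    aaΛ≤ = ≤-trans (*-mono-≤ (*-monoˡ-≤ Λ a≤Y²) a≤Y²) (≤-reflexive (e₁ (64 * κ * ℓ * (4 * ℓ ^ (4 * c))) Y Λ))
      where
      e₁ : ∀ u y l → u * (y * y) * l * (u * (y * y)) ≡ u * u * l * (y * (y * (y * (y * 1))))
      e₁ = solve-∀

    -- Up to powers of ℓ, a²Λ is Y⁴ and m is Y^(r+3). With i = 7a the claim is the power a of m²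
    -- (a²Λ)^7 ≤ m^7, that is 28 < 5(r + 3), with room for the logarithms. For r = 3 a multiple i =
    -- ba requires 4b < 6(b - 2), and 7 is the first that works.
    few-tangles : 4 * (m ^ a * (m ^ a * ((a * Λ) ^ i * a ^ i))) ≤ m ^ i
    few-tangles = begin
      4 * (m ^ a * (m ^ a * ((a * Λ) ^ i * a ^ i)))
        ≡⟨ cong (λ t → 4 * (m ^ a * (m ^ a * t))) (trans (sym (^-distribʳ-* i (a * Λ) a)) (sym (^-*-assoc (a * Λ * a) 7 a))) ⟩
      4 * (m ^ a * (m ^ a * ((a * Λ * a) ^ 7) ^ a))
        ≤⟨ *-mono-≤ (≤-trans (≤-reflexive (sym (*-identityʳ 4))) (^-monoʳ-≤ 4 {1} {a} a≥1)) (≤-refl {m ^ a * (m ^ a * ((a * Λ * a) ^ 7) ^ a)}) ⟩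
      4 ^ a * (m ^ a * (m ^ a * ((a * Λ * a) ^ 7) ^ a))
        ≡⟨ sym (trans (^-distribʳ-* a 4 (m * (m * (a * Λ * a) ^ 7))) (cong (4 ^ a *_) (trans (^-distribʳ-* a m (m * (a * Λ * a) ^ 7))
             (cong (m ^ a *_) (^-distribʳ-* a m ((a * Λ * a) ^ 7)))))) ⟩
      (4 * (m * (m * (a * Λ * a) ^ 7))) ^ a
        ≤⟨ ^-monoˡ-≤ a seventh ⟩
      (m ^ 7) ^ a
        ≡⟨ ^-*-assoc m 7 a ⟩
      m ^ i ∎
      where
      open ≤-Reasoning
      fifth : 4 * (a * Λ * a) ^ 7 ≤ m ^ 5
      fifth = begin
        4 * (a * Λ * a) ^ 7
          ≤⟨ *-monoʳ-≤ 4 (^-monoˡ-≤ 7 aaΛ≤) ⟩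
        4 * (Ξ * Y ^ 4) ^ 7
          ≡⟨ trans (cong (4 *_) (trans (^-distribʳ-* 7 Ξ (Y ^ 4)) (cong (Ξ ^ 7 *_) (^-*-assoc Y 4 7)))) (sym (*-assoc 4 (Ξ ^ 7) (Y ^ 28))) ⟩
        4 * Ξ ^ 7 * Y ^ 28
          ≤⟨ *-monoˡ-≤ (Y ^ 28) Y≥₅ ⟩
        Y ^ 29
          ≤⟨ ^-monoʳ-≤ Y {29} {(r + 3) * 5} (≤-trans (n≤1+n 29) (*-monoˡ-≤ 5 (+-monoˡ-≤ 3 (s≤s (s≤s c≥1))))) ⟩
        Y ^ ((r + 3) * 5)
          ≡⟨ sym (^-*-assoc Y (r + 3) 5) ⟩
        m ^ 5 ∎
      seventh : 4 * (m * (m * (a * Λ * a) ^ 7)) ≤ m ^ 7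
      seventh = ≤-trans (≤-reflexive (e₁ m ((a * Λ * a) ^ 7))) (*-monoʳ-≤ m (*-monoʳ-≤ m fifth))
        where
        e₁ : ∀ m w → 4 * (m * (m * w)) ≡ m * (m * (4 * w))
        e₁ = solve-∀

    module _ {n : ℕ} (n≤mρ : n ≤ m * ρ) where

      n≤X₃ : n ≤ ℓ * X₃
      n≤X₃ = ≤-trans n≤mρ (≤-trans (*-mono-≤ m≤X₃ ρ≤ℓ) (≤-reflexive (*-comm X₃ ℓ)))

      Ψ-mid : 2 * suc Δ * Λ * X₃ + 2 * suc fmax * Λ * X₁ + n ≤ Ψ * X₃
      Ψ-mid = begin
        2 * suc Δ * Λ * X₃ + 2 * suc fmax * Λ * X₁ + n
          ≤⟨ +-mono-≤ (+-monoʳ-≤ (2 * suc Δ * Λ * X₃) (*-monoˡ-≤ X₁ (*-monoˡ-≤ Λ (*-monoʳ-≤ 2 fmax≤)))) n≤X₃ ⟩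
        2 * suc Δ * Λ * X₃ + 2 * (Φ * q) * Λ * X₁ + ℓ * X₃
          ≡⟨ cong (λ t → 2 * suc Δ * Λ * X₃ + t + ℓ * X₃) (trans (e₁ Φ q Λ X₁) (cong (2 * Φ * Λ *_) (sym X₃-eq))) ⟩
        2 * suc Δ * Λ * X₃ + 2 * Φ * Λ * X₃ + ℓ * X₃
          ≡⟨ e₂ (2 * suc Δ * Λ) (2 * Φ * Λ) ℓ X₃ ⟩
        Ψ * X₃ ∎
        where
        open ≤-Reasoning
        e₁ : ∀ f q l w → 2 * (f * q) * l * w ≡ 2 * f * l * (q * w)
        e₁ = solve-∀
        e₂ : ∀ u v w y → u * y + v * y + w * y ≡ (u + v + w) * y
        e₂ = solve-∀

      -- The left side is at most 4ρ^c m^r with m^r = Y^(2g). The factor 2R^(2c) of x over Y is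
      -- there to pay for 4ρ^c: its power 2g contains R^(4gc) = R^(Jc).
      main : 4 * (m * n ^ c * m) ≤ x ^ ((2 + c) * (2 + c + 3))
      main = begin
        4 * (m * n ^ c * m)
          ≤⟨ *-monoʳ-≤ 4 (*-monoˡ-≤ m (*-monoʳ-≤ m (^-monoˡ-≤ c n≤mρ))) ⟩
        4 * (m * (m * ρ) ^ c * m)
          ≡⟨ trans (cong (λ t → 4 * (m * t * m)) (^-distribʳ-* c m ρ)) (e₁ m (m ^ c) (ρ ^ c)) ⟩
        4 * ρ ^ c * m ^ r
          ≤⟨ *-monoˡ-≤ (m ^ r) small ⟩
        (2 * R ^ (2 * c)) ^ (r * (r + 3)) * m ^ r
          ≡⟨ cong ((2 * R ^ (2 * c)) ^ (r * (r + 3)) *_) (trans (^-*-assoc Y (r + 3) r) (cong (Y ^_) (*-comm (r + 3) r))) ⟩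
        (2 * R ^ (2 * c)) ^ (r * (r + 3)) * Y ^ (r * (r + 3))
          ≡⟨ trans (sym (^-distribʳ-* (r * (r + 3)) (2 * R ^ (2 * c)) Y)) (cong (_^ (r * (r + 3))) (sym x-def)) ⟩
        x ^ (r * (r + 3)) ∎
        where
        open ≤-Reasoning
        e₁ : ∀ m mc p → 4 * (m * (mc * p) * m) ≡ 4 * p * (m * (m * mc))
        e₁ = solve-∀
        small : 4 * ρ ^ c ≤ (2 * R ^ (2 * c)) ^ (r * (r + 3))
        small = begin
          4 * ρ ^ c
            ≤⟨ *-mono-≤ (^-monoʳ-≤ 2 {2} {r * (r + 3)} (≤-trans (m≤m+n 2 c) (m≤m*n r (r + 3)))) (≤-reflexive (^-*-assoc R J′ c)) ⟩
          2 ^ (r * (r + 3)) * R ^ (J′ * c)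
            ≤⟨ *-monoʳ-≤ (2 ^ (r * (r + 3))) (^-monoʳ-≤ R (≤-trans (*-monoˡ-≤ c (≤-trans (n≤1+n J′) (≤-reflexive J-def))) (≤-reflexive (trans (e₂ g c) (cong (2 * c *_) 2g))))) ⟩
          2 ^ (r * (r + 3)) * R ^ (2 * c * (r * (r + 3)))
            ≡⟨ cong (2 ^ (r * (r + 3)) *_) (sym (^-*-assoc R (2 * c) (r * (r + 3)))) ⟩
          2 ^ (r * (r + 3)) * (R ^ (2 * c)) ^ (r * (r + 3))
            ≡⟨ sym (^-distribʳ-* (r * (r + 3)) 2 (R ^ (2 * c))) ⟩
          (2 * R ^ (2 * c)) ^ (r * (r + 3)) ∎
          where
          e₂ : ∀ g c → 4 * g * c ≡ 2 * c * (2 * g)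
          e₂ = solve-∀

      -- Needs r + 3 ≤ 2r, which is again s ≥ 5.
      n≤q^r : n ≤ ρ * (x * x) ^ (2 + c)
      n≤q^r = begin
        n               ≤⟨ n≤mρ ⟩
        m * ρ           ≡⟨ *-comm m ρ ⟩
        ρ * m           ≤⟨ *-monoʳ-≤ ρ m≤X₃ ⟩
        ρ * X₃          ≤⟨ *-monoʳ-≤ ρ (^-monoʳ-≤ x (≤-trans (+-monoʳ-≤ r (s≤s (s≤s c≥1))) (≤-reflexive (cong (r +_) (sym (+-identityʳ r)))))) ⟩
        ρ * x ^ (2 * r) ≡⟨ cong (ρ *_) (trans (sym (^-*-assoc x 2 r)) (cong (_^ r) (cong (x *_) (*-identityʳ x)))) ⟩
        ρ * (x * x) ^ r ∎
        where open ≤-Reasoning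

      no-ramsey : ∀ t → 2 * suc (2 + J′) * i ≤ t → ¬ RamseyProperty (4 + c) t n
      -- K = Λ + 1 serves for fans as well as for overfull blocks, since both first moments compare
      -- ρ^K with K!.
      no-ramsey t t≥ = Union.not-ramsey c (suc Λ) P B loadP loadB c≥1 y₀ Δ fmax Ψ Ψ-end Ψ-mid main rest a i R (2 + J′) κ (7 * ℓ) ρ
          transversal m≥1 a≥1 R≥1 (≤-trans a≥1 a≤i) i≤aΛ steep ≤-refl Δ-large a-large₁ ≤-refl i-large₁ i-large₂ κ-large e-large n≤q^r K-large t t≥
        where
        P : Fin n → Fin m
        P = part n≤mρ
        loadP : Load P Λ
        loadP = load-mono (≤-trans ρ≤ℓ (≤-trans ℓ≤j (≤-trans (m≤n+m j (suc (suc J′) * j)) (≤-reflexive (sym Λ-split))))) (part-load n≤mρ)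
        chosen = Blocks.blocks P Λ loadP ρ a i m≥1 (≤-trans n≤mρ (≤-reflexive (*-comm m ρ))) few-overloads few-tangles
        B = proj₁ chosen
        loadB = proj₁ (proj₂ chosen)
        transversal = proj₂ (proj₂ chosen)

-- Integer roots, logarithms and exponential growth

≤-by-contradiction : ∀ a b → (b < a → ⊥) → a ≤ b
≤-by-contradiction a b absurd with a ≤? b
... | yes le = le
... | no gt  = ⊥-elim (absurd (≰⇒> gt))

-- Extracts integer roots: R as the J-th root of ℓ and Y as the square root of t / u.
last-below : ∀ (f : ℕ → ℕ) t b → f 0 ≤ t → t < f b → ∃ λ y → f y ≤ t × t < f (suc y)
last-below f t zero    lo hi = ⊥-elim (<-irrefl refl (≤-trans hi lo))
last-below f t (suc b) lo hi with f b ≤? t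
... | yes le = b , le , hi
... | no gt  = last-below f t b lo (≰⇒> gt)

2^log≤ : ∀ fuel t → t ≤ fuel → 1 ≤ t → 2 ^ ⌊log₂ t ⌋ ≤ t
2^log≤ zero (suc t) () _
2^log≤ (suc fuel) (suc zero) _ _ = ≤-refl
2^log≤ (suc fuel) t@(suc (suc t₀)) (s≤s le) _ = begin
  2 ^ ⌊log₂ t ⌋
    ≤⟨ down ⌊log₂ t ⌋ ⟩
  2 * 2 ^ (⌊log₂ t ⌋ ∸ 1)
    ≡⟨ cong (λ l → 2 * 2 ^ l) (sym (⌊log₂⌊n/2⌋⌋≡⌊log₂n⌋∸1 t)) ⟩
  2 * 2 ^ ⌊log₂ ⌊ t /2⌋ ⌋
    ≤⟨ *-monoʳ-≤ 2 (2^log≤ fuel ⌊ t /2⌋ (≤-trans (≤-pred (⌊n/2⌋<n (suc t₀))) le) (s≤s z≤n)) ⟩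
  2 * ⌊ t /2⌋
    ≡⟨ cong (⌊ t /2⌋ +_) (+-identityʳ ⌊ t /2⌋) ⟩
  ⌊ t /2⌋ + ⌊ t /2⌋
    ≤⟨ +-monoʳ-≤ ⌊ t /2⌋ (⌊n/2⌋≤⌈n/2⌉ t) ⟩
  ⌊ t /2⌋ + ⌈ t /2⌉
    ≡⟨ ⌊n/2⌋+⌈n/2⌉≡n t ⟩
  t ∎
  where
  open ≤-Reasoning
  down : ∀ l → 2 ^ l ≤ 2 * 2 ^ (l ∸ 1)
  down zero    = s≤s z≤n
  down (suc l) = ≤-refl

<2^log : ∀ t → t < 2 ^ suc ⌊log₂ t ⌋
<2^log t = ≰⇒> (λ le → <-irrefl refl (≤-trans (≤-reflexive (sym (⌊log₂[2^n]⌋≡n (suc ⌊log₂ t ⌋)))) (⌊log₂⌋-mono-≤ le)))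

halve : ∀ l → ∃ λ v → 2 * v ≤ l × l ≤ suc (2 * v)
halve zero          = 0 , z≤n , z≤n
halve (suc zero)    = 0 , z≤n , s≤s z≤n
halve (suc (suc l)) with halve l
... | v , lo , hi = suc v , ≤-trans (≤-reflexive (e v)) (s≤s (s≤s lo)) , ≤-trans (s≤s (s≤s hi)) (≤-reflexive (cong suc (sym (e v))))
  where
  e : ∀ v → 2 * suc v ≡ suc (suc (2 * v))
  e = solve-∀

-- With v half of l, l ≤ 3v. By induction 2^v dominates the power v^E with its constant, and a
-- second 2^v dominates the remaining factor v.
exponential-growth : ∀ E C → ∃ λ l₀ → ∀ l → l₀ ≤ l → C * l ^ E ≤ 2 ^ l
exponential-growth zero C = C , λ l le → ≤-trans (≤-reflexive (*-identityʳ C)) (≤-trans le (<⇒≤ (n<2^n l)))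
exponential-growth (suc E) C with exponential-growth E (C * 3 ^ suc E)
... | l₀ , ih = 2 * suc l₀ , λ l le → bound l le (halve l)
  where
  bound : ∀ l → 2 * suc l₀ ≤ l → (∃ λ v → 2 * v ≤ l × l ≤ suc (2 * v)) → C * l ^ suc E ≤ 2 ^ l
  bound l le (v , lo , hi) = begin
    C * l ^ suc E
      ≤⟨ *-monoʳ-≤ C (^-monoˡ-≤ (suc E) l≤3v) ⟩
    C * (3 * v) ^ suc E
      ≡⟨ trans (cong (C *_) (^-distribʳ-* (suc E) 3 v)) (e C (3 ^ suc E) v (v ^ E)) ⟩
    C * 3 ^ suc E * v ^ E * v
      ≤⟨ *-mono-≤ (ih v (≤-trans (n≤1+n l₀) v≥)) (<⇒≤ (n<2^n v)) ⟩
    2 ^ v * 2 ^ v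
      ≡⟨ trans (sym (^-distribˡ-+-* 2 v v)) (cong (2 ^_) (cong (v +_) (sym (+-identityʳ v)))) ⟩
    2 ^ (2 * v)
      ≤⟨ ^-monoʳ-≤ 2 lo ⟩
    2 ^ l ∎
    where
    open ≤-Reasoning
    e : ∀ C a v w → C * (a * (v * w)) ≡ C * a * w * v
    e = solve-∀
    v≥ : suc l₀ ≤ v
    v≥ = ≤-by-contradiction (suc l₀) v (λ lt → <-irrefl refl (≤-trans (s≤s hi) (≤-trans (≤-trans (≤-reflexive (e₂ v)) (*-monoʳ-≤ 2 lt)) le)))
      where
      e₂ : ∀ v → suc (suc (2 * v)) ≡ 2 * suc v
      e₂ = solve-∀
    l≤3v : l ≤ 3 * v
    l≤3v = ≤-trans hi (≤-trans (+-monoˡ-≤ (2 * v) (≤-trans (s≤s z≤n) v≥)) (≤-reflexive (e₃ v)))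
      where
      e₃ : ∀ v → v + 2 * v ≡ 3 * v
      e₃ = solve-∀

below-exponential : ∀ {f} → Polynomial f → ∃ λ l₀ → ∀ l → l₀ ≤ l → 1 ≤ l → f l ≤ 2 ^ l
below-exponential (C , E , h) = proj₁ (exponential-growth E C) , λ l le l≥1 → ≤-trans (h l l≥1) (proj₂ (exponential-growth E C) l le)

-- From parameters to the growth rate

module Constants (c g J′ CΛ D u₀ : ℕ) (c≥1 : 1 ≤ c) (2g : 2 * g ≡ (2 + c) * (2 + c + 3)) (r≤g : 2 + c ≤ g) (J-def : suc J′ ≡ 4 * g)
  (CΛ-def : CΛ ≡ (suc J′ + 2) * (4 * g + 2)) (D-def : D ≡ 2 * (2 + c + 3) + 2 * CΛ + 7)
  (u₀-def : u₀ ≡ 2 * (3 + J′) * (7 * (64 * (4 * D))))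
  where

  r J s : ℕ
  r = 2 + c
  J = 4 * g
  s = suc (tri (3 + c))

  g≥1 : 1 ≤ g
  g≥1 = ≤-trans (s≤s z≤n) r≤g

  u₀≥1 : 1 ≤ u₀
  u₀≥1 = ≤-trans (*-mono-≤ {1} {2 * (3 + J′)} (s≤s z≤n) (*-mono-≤ {1} {7} (s≤s z≤n) (*-mono-≤ {1} {64} (s≤s z≤n) (*-mono-≤ {1} {4} (s≤s z≤n)
    (≤-trans (≤-trans (s≤s z≤n) (m≤n+m 7 (2 * (2 + c + 3) + 2 * CΛ))) (≤-reflexive (sym D-def))))))) (≤-reflexive (sym u₀-def))

  -- The left side bounds uΘ² at l = ℓ. Once it is at most 2^ℓ ≤ t, the choice of `Y` forces Θ ≤ Y.
  threshold : ∃ λ l₀ → ∀ l → l₀ ≤ l → 1 ≤ l → u₀ * l * (l ^ (4 * c) * l) * (Theta.Θ c s CΛ D l * Theta.Θ c s CΛ D l) ≤ 2 ^ l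
  threshold = below-exponential (poly-* (poly-* (poly-* (poly-const u₀) poly-id) (poly-* (poly-^ (4 * c) poly-id) poly-id))
    (poly-* (Theta.pΘ c s CΛ D) (Theta.pΘ c s CΛ D)))

  R₀ ℓ₀ E₀ : ℕ
  R₀ = CΛ * 2 ^ J + 2
  ℓ₀ = proj₁ threshold + R₀ ^ J + 1
  E₀ = (4 * u₀) ^ g * 2 ^ J

  module AtT (t : ℕ) (t≥ : 2 ^ ℓ₀ ≤ t) where

    ℓ : ℕ
    ℓ = ⌊log₂ t ⌋

    ℓ≥ℓ₀ : ℓ₀ ≤ ℓ
    ℓ≥ℓ₀ = ≤-trans (≤-reflexive (sym (⌊log₂[2^n]⌋≡n ℓ₀))) (⌊log₂⌋-mono-≤ t≥)

    ℓ≥1 : 1 ≤ ℓ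
    ℓ≥1 = ≤-trans (m≤n+m 1 (proj₁ threshold + R₀ ^ J)) ℓ≥ℓ₀

    t≥1 : 1 ≤ t
    t≥1 = ≤-trans (m^n>0 2 ℓ₀) t≥

    rootR : ∃ λ R → R ^ suc J′ ≤ ℓ × ℓ < suc R ^ suc J′
    rootR = last-below (_^ suc J′) ℓ (suc ℓ) z≤n (m≤m*n (suc ℓ) (suc ℓ ^ J′) {{m^n≢0 (suc ℓ) J′}})

    R : ℕ
    R = proj₁ rootR

    R≥R₀ : R₀ ≤ R
    R≥R₀ = ≤-by-contradiction R₀ R (λ lt → <-irrefl refl (<-≤-trans (proj₂ (proj₂ rootR)) (≤-trans (^-monoˡ-≤ (suc J′) lt)
            (≤-trans (≤-reflexive (cong (R₀ ^_) J-def)) (≤-trans (≤-trans (m≤n+m (R₀ ^ J) (proj₁ threshold)) (m≤m+n _ 1)) ℓ≥ℓ₀)))))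

    R≥2 : 2 ≤ R
    R≥2 = ≤-trans (m≤n+m 2 (CΛ * 2 ^ J)) R≥R₀

    instance
      R-nz : NonZero R
      R-nz = >-nonZero (≤-trans (s≤s z≤n) R≥2)

    ℓ≤R^J : ℓ ≤ 2 ^ J * R ^ J
    ℓ≤R^J = ≤-trans (<⇒≤ (proj₂ (proj₂ rootR))) (≤-trans (≤-reflexive (cong (suc R ^_) J-def))
      (≤-trans (^-monoˡ-≤ J (≤-trans (+-monoˡ-≤ R (≤-trans (s≤s z≤n) R≥2)) (≤-reflexive (cong (R +_) (sym (+-identityʳ R)))))) (≤-reflexive (^-distribʳ-* J 2 R))))

    -- As ℓ ≤ (2R)^J, one further factor R ≥ R₀ absorbs CΛ 2^J. So chains of the constant length J +
    -- 1 suffice, and t exceeds i only by a constant factor.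
    steep : CΛ * ℓ < R ^ (2 + J′)
    steep = begin-strict
      CΛ * ℓ               ≤⟨ *-monoʳ-≤ CΛ ℓ≤R^J ⟩
      CΛ * (2 ^ J * R ^ J) ≡⟨ sym (*-assoc CΛ (2 ^ J) (R ^ J)) ⟩
      CΛ * 2 ^ J * R ^ J   <⟨ *-monoˡ-< (R ^ J) {{m^n≢0 R J}} (≤-trans (≤-trans (≤-reflexive (+-comm 1 (CΛ * 2 ^ J))) (+-monoʳ-≤ (CΛ * 2 ^ J) (s≤s z≤n))) R≥R₀) ⟩
      R * R ^ J            ≡⟨ cong (λ j → R * R ^ j) (sym J-def) ⟩
      R ^ (2 + J′) ∎
      where open ≤-Reasoning

    -- Collects all of 2(k + 1)i except Y², so that `Y` can be taken as large as t permits.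
    u : ℕ
    u = u₀ * ℓ * (R ^ (4 * c) * R)

    u≥1 : 1 ≤ u
    u≥1 = *-mono-≤ (*-mono-≤ u₀≥1 ℓ≥1) (*-mono-≤ (m^n>0 R (4 * c)) (≤-trans (s≤s z≤n) R≥2))

    rootY : ∃ λ Y → u * (Y * Y) ≤ t × t < u * (suc Y * suc Y)
    rootY = last-below (λ Y → u * (Y * Y)) t (suc t) (≤-trans (≤-reflexive (*-zeroʳ u)) z≤n)
      (≤-trans (≤-trans (≤-reflexive (sym (*-identityˡ (suc t)))) (*-mono-≤ u≥1 (m≤m*n (suc t) (suc t)))) ≤-refl)

    Y : ℕ
    Y = proj₁ rootY

    R≤ℓ : R ≤ ℓ
    R≤ℓ = ≤-trans (≤-trans (≤-reflexive (sym (*-identityʳ R))) (*-monoʳ-≤ R (m^n>0 R J′))) (proj₁ (proj₂ rootR))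

    Θ≤Y : Theta.Θ c s CΛ D ℓ ≤ Y
    Θ≤Y = ≤-by-contradiction (Theta.Θ c s CΛ D ℓ) Y (λ lt → <-irrefl refl (begin-strict
        t
          <⟨ proj₂ (proj₂ rootY) ⟩
        u₀ * ℓ * (R ^ (4 * c) * R) * (suc Y * suc Y)
          ≤⟨ *-mono-≤ (*-monoʳ-≤ (u₀ * ℓ) (*-mono-≤ (^-monoˡ-≤ (4 * c) R≤ℓ) R≤ℓ)) (*-mono-≤ lt lt) ⟩
        u₀ * ℓ * (ℓ ^ (4 * c) * ℓ) * (Theta.Θ c s CΛ D ℓ * Theta.Θ c s CΛ D ℓ)
          ≤⟨ proj₂ threshold ℓ (≤-trans (≤-trans (m≤m+n (proj₁ threshold) (R₀ ^ J)) (m≤m+n _ 1)) ℓ≥ℓ₀) ℓ≥1 ⟩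
        2 ^ ℓ
          ≤⟨ 2^log≤ t t ≤-refl t≥1 ⟩
        t ∎))
      where open ≤-Reasoning

    Y≥1 : 1 ≤ Y
    Y≥1 = ≤-trans (≤-trans (≤-trans (s≤s z≤n) (m≤n+m s (4 * Theta.Ψ c s CΛ D ℓ ^ (2 + c))))
      (≤-trans (m≤m+n _ _) (≤-trans (m≤m+n _ _) (m≤m+n _ (4 * Theta.Ξ c s CΛ D ℓ ^ 7))))) Θ≤Y

    y₀ : ℕ
    y₀ = 2 * R ^ (2 * c) * Y ∸ 1

    x-def : suc y₀ ≡ 2 * R ^ (2 * c) * Y
    x-def = m+[n∸m]≡n {1} (*-mono-≤ (*-mono-≤ {1} {2} (s≤s z≤n) (m^n>0 R (2 * c))) Y≥1)

    module S = Scale c c≥1 g J′ CΛ D ℓ R Y y₀ 2g J-def CΛ-def D-def ℓ≥1 R≥2 (proj₁ (proj₂ rootR)) steep x-def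

    2ki≤t : 2 * suc (2 + J′) * S.i ≤ t
    2ki≤t = ≤-trans (≤-reflexive eq) (proj₁ (proj₂ rootY))
      where
      open ≡-Reasoning
      e₁ : ∀ k w y d l r → 2 * k * (7 * (64 * (2 * w * y * (2 * w * y)) * (d * l) * r)) ≡ 2 * k * (7 * (64 * (4 * d))) * l * ((w * w) * r) * (y * y)
      e₁ = solve-∀
      e₂ : ∀ c → 2 * c + 2 * c ≡ 4 * c
      e₂ = solve-∀
      eq : 2 * suc (2 + J′) * S.i ≡ u * (Y * Y)
      eq = begin
        2 * (3 + J′) * (7 * (64 * (suc y₀ * suc y₀) * (D * ℓ) * R))
          ≡⟨ cong (λ x → 2 * (3 + J′) * (7 * (64 * (x * x) * (D * ℓ) * R))) x-def ⟩
        2 * (3 + J′) * (7 * (64 * (2 * R ^ (2 * c) * Y * (2 * R ^ (2 * c) * Y)) * (D * ℓ) * R))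
          ≡⟨ e₁ (3 + J′) (R ^ (2 * c)) Y D ℓ R ⟩
        2 * (3 + J′) * (7 * (64 * (4 * D))) * ℓ * ((R ^ (2 * c) * R ^ (2 * c)) * R) * (Y * Y)
          ≡⟨ cong (λ w → w * ℓ * ((R ^ (2 * c) * R ^ (2 * c)) * R) * (Y * Y)) (sym u₀-def) ⟩
        u₀ * ℓ * ((R ^ (2 * c) * R ^ (2 * c)) * R) * (Y * Y)
          ≡⟨ cong (λ w → u₀ * ℓ * (w * R) * (Y * Y)) (trans (sym (^-distribˡ-+-* R (2 * c) (2 * c))) (cong (R ^_) (e₂ c))) ⟩
        u₀ * ℓ * (R ^ (4 * c) * R) * (Y * Y) ∎

    a≤ : S.a ≤ 2 ^ (2 * ℓ)
    a≤ = ≤-trans (≤-trans (m≤m+n S.a (6 * S.a)) (≤-trans (≤-reflexive (sym (*-identityˡ S.i))) (≤-trans (*-monoˡ-≤ S.i {1} {2 * suc (2 + J′)} (s≤s z≤n)) 2ki≤t)))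
      (≤-trans (<⇒≤ (<2^log t)) (^-monoʳ-≤ 2 (≤-trans (+-monoˡ-≤ ℓ ℓ≥1) (≤-reflexive (cong (ℓ +_) (sym (+-identityʳ ℓ)))))))

    small-n : ∀ n → n ≤ Y ^ (r + 3) * R ^ J′ → ¬ RamseyProperty (4 + c) t n
    small-n n n≤ = S.no-ramsey Θ≤Y a≤ n≤ t 2ki≤t

    g′ : ℕ
    g′ = g ∸ 1

    g-def : suc g′ ≡ g
    g-def = m+[n∸m]≡n {1} {g} g≥1

    -- t^g is of order u^g m^r with u of order ℓR^(4c+1). One of the g factors ℓ is traded for R^J,
    -- and all powers of R then fit into ρ^r: this is where the load of the parts improves the
    -- exponent of log t.
    large-n : ∀ n → Y ^ (r + 3) * R ^ J′ ≤ n → t ^ g ≤ E₀ * (n ^ r * ℓ ^ g′)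
    large-n n n≥ = begin
      t ^ g
        ≤⟨ ^-monoˡ-≤ g t≤ ⟩
      (4 * u₀ * (ℓ * (R ^ (4 * c) * R) * (Y * Y))) ^ g
        ≡⟨ trans (^-distribʳ-* g (4 * u₀) (ℓ * (R ^ (4 * c) * R) * (Y * Y))) (cong ((4 * u₀) ^ g *_)
             (trans (^-distribʳ-* g (ℓ * (R ^ (4 * c) * R)) (Y * Y)) (cong (_* (Y * Y) ^ g) (^-distribʳ-* g ℓ (R ^ (4 * c) * R))))) ⟩
      (4 * u₀) ^ g * (ℓ ^ g * (R ^ (4 * c) * R) ^ g * (Y * Y) ^ g)
        ≡⟨ cong₂ (λ v w → (4 * u₀) ^ g * (v * (R ^ (4 * c) * R) ^ g * w)) (cong (ℓ ^_) (sym g-def)) Y-power ⟩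
      (4 * u₀) ^ g * (ℓ * ℓ ^ g′ * (R ^ (4 * c) * R) ^ g * (Y ^ (r + 3)) ^ r)
        ≤⟨ *-monoʳ-≤ ((4 * u₀) ^ g) (*-monoˡ-≤ ((Y ^ (r + 3)) ^ r) (*-monoˡ-≤ ((R ^ (4 * c) * R) ^ g) (*-monoˡ-≤ (ℓ ^ g′) ℓ≤R^J))) ⟩
      (4 * u₀) ^ g * (2 ^ J * R ^ J * ℓ ^ g′ * (R ^ (4 * c) * R) ^ g * (Y ^ (r + 3)) ^ r)
        ≡⟨ e₁ ((4 * u₀) ^ g) (2 ^ J) (R ^ J) (ℓ ^ g′) ((R ^ (4 * c) * R) ^ g) ((Y ^ (r + 3)) ^ r) ⟩
      E₀ * ((Y ^ (r + 3)) ^ r * (R ^ J * (R ^ (4 * c) * R) ^ g) * ℓ ^ g′)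
        ≤⟨ *-monoʳ-≤ E₀ (*-monoˡ-≤ (ℓ ^ g′) (*-monoʳ-≤ ((Y ^ (r + 3)) ^ r) R-power)) ⟩
      E₀ * ((Y ^ (r + 3)) ^ r * (R ^ J′) ^ r * ℓ ^ g′)
        ≡⟨ cong (λ w → E₀ * (w * ℓ ^ g′)) (sym (^-distribʳ-* r (Y ^ (r + 3)) (R ^ J′))) ⟩
      E₀ * ((Y ^ (r + 3) * R ^ J′) ^ r * ℓ ^ g′)
        ≤⟨ *-monoʳ-≤ E₀ (*-monoˡ-≤ (ℓ ^ g′) (^-monoˡ-≤ r n≥)) ⟩
      E₀ * (n ^ r * ℓ ^ g′) ∎
      where
      open ≤-Reasoning
      e₁ : ∀ a b R l w y → a * (b * R * l * w * y) ≡ a * b * (y * (R * w) * l)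
      e₁ = solve-∀
      t≤ : t ≤ 4 * u₀ * (ℓ * (R ^ (4 * c) * R) * (Y * Y))
      t≤ = ≤-trans (<⇒≤ (proj₂ (proj₂ rootY))) (≤-trans (*-monoʳ-≤ u (*-mono-≤ dbl dbl)) (≤-reflexive (e₂ u₀ ℓ (R ^ (4 * c) * R) Y)))
        where
        dbl : suc Y ≤ 2 * Y
        dbl = ≤-trans (+-monoˡ-≤ Y Y≥1) (≤-reflexive (cong (Y +_) (sym (+-identityʳ Y))))
        e₂ : ∀ u l w y → u * l * w * (2 * y * (2 * y)) ≡ 4 * u * (l * w * (y * y))
        e₂ = solve-∀
      Y-power : (Y * Y) ^ g ≡ (Y ^ (r + 3)) ^ r
      Y-power = trans (cong (_^ g) (cong (Y *_) (sym (*-identityʳ Y)))) (trans (^-*-assoc Y 2 g)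
        (trans (cong (Y ^_) (trans 2g (*-comm r (r + 3)))) (sym (^-*-assoc Y (r + 3) r))))
      R-power : R ^ J * (R ^ (4 * c) * R) ^ g ≤ (R ^ J′) ^ r
      R-power = ≤-trans (≤-reflexive (trans (cong (λ w → R ^ J * w ^ g) (*-comm (R ^ (4 * c)) R))
          (trans (cong (R ^ J *_) (^-*-assoc R (suc (4 * c)) g)) (sym (^-distribˡ-+-* R J (suc (4 * c) * g))))))
        (≤-trans (^-monoʳ-≤ R exps) (≤-reflexive (sym (^-*-assoc R J′ r))))
        where
        -- J = 4g turns this into r ≤ 3g.
        exps : J + suc (4 * c) * g ≤ J′ * r
        exps = +-cancelʳ-≤ r (J + suc (4 * c) * g) (J′ * r) (begin
          J + suc (4 * c) * g + r       ≤⟨ +-monoʳ-≤ (J + suc (4 * c) * g) (≤-trans r≤g (m≤m+n g (g + (g + 0)))) ⟩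
          4 * g + suc (4 * c) * g + 3 * g ≡⟨ e₃ g c ⟩
          4 * g * (2 + c)               ≡⟨ cong (_* r) (sym J-def) ⟩
          suc J′ * r                    ≡⟨ +-comm r (J′ * r) ⟩
          J′ * r + r ∎)
          where
          e₃ : ∀ g c → 4 * g + suc (4 * c) * g + 3 * g ≡ 4 * g * (2 + c)
          e₃ = solve-∀

    -- The square of `large-n`: (s + 1)(s - 2) is 2g, and the exponent of the logarithm is 2(g - 1).
    conclusion : ∀ n → RamseyProperty (4 + c) t n →
      t ^ ((4 + c + 1) * r) ≤ suc (E₀ * E₀) * n ^ (2 * r) * ℓ ^ ((4 + c + 1) * r ∸ 2)
    conclusion n ramsey = begin
      t ^ ((4 + c + 1) * r)
        ≡⟨ cong (t ^_) expo ⟩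
      t ^ (g * 2)
        ≡⟨ sym (^-*-assoc t g 2) ⟩
      (t ^ g) ^ 2
        ≤⟨ ^-monoˡ-≤ 2 (large-n n (≤-by-contradiction (Y ^ (r + 3) * R ^ J′) n (λ lt → small-n n (<⇒≤ lt) ramsey))) ⟩
      (E₀ * (n ^ r * ℓ ^ g′)) ^ 2
        ≡⟨ e₁ E₀ (n ^ r) (ℓ ^ g′) ⟩
      E₀ * E₀ * (n ^ r) ^ 2 * (ℓ ^ g′) ^ 2
        ≤⟨ *-monoˡ-≤ ((ℓ ^ g′) ^ 2) (*-monoˡ-≤ ((n ^ r) ^ 2) (n≤1+n (E₀ * E₀))) ⟩
      suc (E₀ * E₀) * (n ^ r) ^ 2 * (ℓ ^ g′) ^ 2
        ≡⟨ cong₂ (λ v w → suc (E₀ * E₀) * v * w) (trans (^-*-assoc n r 2) (cong (n ^_) (*-comm r 2)))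
             (trans (^-*-assoc ℓ g′ 2) (cong (ℓ ^_) expo′)) ⟩
      suc (E₀ * E₀) * n ^ (2 * r) * ℓ ^ ((4 + c + 1) * r ∸ 2) ∎
      where
      open ≤-Reasoning
      e₁ : ∀ a b d → (a * (b * d)) * ((a * (b * d)) * 1) ≡ a * a * (b * (b * 1)) * (d * (d * 1))
      e₁ = solve-∀
      e₂ : ∀ c → (4 + c + 1) * (2 + c) ≡ (2 + c) * (2 + c + 3)
      e₂ = solve-∀
      expo : (4 + c + 1) * r ≡ g * 2
      expo = trans (e₂ c) (trans (sym 2g) (*-comm 2 g))
      expo′ : g′ * 2 ≡ (4 + c + 1) * r ∸ 2
      expo′ = sym (trans (cong (_∸ 2) (trans expo (cong (_* 2) (sym g-def)))) refl)

  growth : Σ ℕ λ d → Σ ℕ λ T → (t : ℕ) → T ≤ t → (n : ℕ) → RamseyProperty (4 + c) t n →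
    t ^ ((4 + c + 1) * r) ≤ suc d * n ^ (2 * r) * ⌊log₂ t ⌋ ^ ((4 + c + 1) * r ∸ 2)
  growth = E₀ * E₀ , 2 ^ ℓ₀ , AtT.conclusion

ramsey-growth : ∀ c → 1 ≤ c → Σ ℕ λ d → Σ ℕ λ T → (t : ℕ) → T ≤ t → (n : ℕ) → RamseyProperty (4 + c) t n →
  t ^ ((4 + c + 1) * (2 + c)) ≤ suc d * n ^ (2 * (2 + c)) * ⌊log₂ t ⌋ ^ ((4 + c + 1) * (2 + c) ∸ 2)
ramsey-growth c c≥1 = Constants.growth c g J′ CΛ D u₀ c≥1 2g (m≤m+n r (tri r)) J-def refl refl refl
  where
  r g J′ CΛ D u₀ : ℕ
  r  = 2 + c
  g  = r + tri r
  J′ = 4 * g ∸ 1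
  CΛ = (suc J′ + 2) * (4 * g + 2)
  D  = 2 * (2 + c + 3) + 2 * CΛ + 7
  u₀ = 2 * (3 + J′) * (7 * (64 * (4 * D)))
  2g : 2 * g ≡ r * (r + 3)
  2g = trans (*-distribˡ-+ 2 r (tri r)) (trans (cong (2 * r +_) (2tri r)) (e r))
    where
    e : ∀ r → 2 * r + r * suc r ≡ r * (r + 3)
    e = solve-∀
  J-def : suc J′ ≡ 4 * g
  J-def = m+[n∸m]≡n {1} {4 * g} (s≤s z≤n)

ramsey-number-growth : ∀ c →
  (Σ ℕ λ d → Σ ℕ λ T → (t : ℕ) → T ≤ t → (n : ℕ) → RamseyProperty (4 + c) t n →
    t ^ ((4 + c + 1) * (2 + c)) ≤ suc d * n ^ (2 * (2 + c)) * ⌊log₂ t ⌋ ^ ((4 + c + 1) * (2 + c) ∸ 2)) →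
  Σ ℕ λ d → Σ ℕ λ T → (t : ℕ) → T ≤ t → (n : ℕ) → IsRamseyNumber (4 + c) t n →
    t ^ ((4 + c + 1) * (2 + c)) ≤ suc d * n ^ (2 * (2 + c)) * ⌊log₂ t ⌋ ^ ((4 + c + 1) * (2 + c) ∸ 2)
ramsey-number-growth c (d , T , bound) = d , T , λ t t≥ n isRamsey → bound t t≥ n (proj₁ isRamsey)

-- The asymptotic bound raised to the power 2(s - 2), which clears both fractional exponents, with
-- the negative power of the logarithm moved to the other side. The constant of Ω becomes 1 /
-- `suc d`, valid from `T` on; the base of the logarithm affects only that constant.
theorem1p2 : (s : ℕ) → 5 ≤ s →
    Σ ℕ λ d → Σ ℕ λ T → (t : ℕ) → T ≤ t → (n : ℕ) → IsRamseyNumber s t n →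
    t ^ ((s + 1) * (s ∸ 2)) ≤ suc d * n ^ (2 * (s ∸ 2)) * ⌊log₂ t ⌋ ^ ((s + 1) * (s ∸ 2) ∸ 2)
theorem1p2 (suc (suc (suc (suc c)))) (s≤s (s≤s (s≤s (s≤s c≥1)))) = ramsey-number-growth c (ramsey-growth c c≥1)
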